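{- Let $k \ge 6$ and $N \ge 5k+3$ be integers, and let $G := K_N$ be the complete graph on $N$ vertices with a red-blue coloring of its edges such that $G$ contains no red copy of the cycle $C_{2k+1}$ and no blue copy of the wheel $W_{2k+1}$. Then there is a partition $\{U_0, U_1, U_2, U_3\}$ of $V(G)$ such that $|U_0| \le 2$, $|U_i| \le 2k$ for $1 \le i \le 3$, and in $G - U_0$ every edge with both endpoints in the same class among $U_1, U_2, U_3$ is red, while every edge joining two different classes among $U_1, U_2, U_3$ is blue.
   Context: $C_n$ denotes the cycle on $n$ vertices. The wheel $W_n := C_n \ast K_1$ is the graph obtained from the cycle $C_n$ (the rim) by adding one new vertex (the hub) adjacent to all vertices of the cycle; it has $n+1$ vertices. A red (blue) copy of a graph $F$ is a subgraph isomorphic to $F$ all of whose edges are red (blue). -}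

module Defs where

open import Data.Nat using (ℕ; suc; _≤_; _*_; _+_)
open import Data.Nat.DivMod using (_mod_)
open import Data.Fin using (Fin; toℕ; zero; suc)
open import Data.List using (length; filter)
open import Data.List.Base using (allFin)
open import Data.Fin.Properties using (_≟_)
open import Data.Product using (Σ; _×_)
open import Function.Definitions using (Injective)
open import Relation.Binary.PropositionalEquality using (_≡_; _≢_)

data Colour : Set where
  red blue : Colour

-- a red-blue colouring of the edges of K_N on vertex set Fin N:
-- c u v is the colour of the edge uv (only used for u ≢ v), required symmetric
Colouring : ℕ → Set
Colouring N = Fin N → Fin N → Colour

Symmetric : ∀ {N} → Colouring N → Set
Symmetric {N} c = ∀ (u v : Fin N) → c u v ≡ c v u

next : ∀ {n} → Fin (suc n) → Fin (suc n)
next {n} i = suc (toℕ i) mod suc n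

-- a copy of C_{n+1} in colour col: injective map of the cycle vertices
-- 0,1,…,n (consecutive ones and n,0 adjacent) with all cycle edges of colour col
HasCycle : ∀ {N} → Colouring N → Colour → (n : ℕ) → Set
HasCycle {N} c col n =
  Σ (Fin (suc n) → Fin N) λ f →
    Injective _≡_ _≡_ f × (∀ i → c (f i) (f (next i)) ≡ col)

-- a copy of the wheel W_{n+1} = C_{n+1} * K_1 in colour col:
-- hub is h, rim is the injective map f, h not on the rim,
-- all rim edges and all spokes have colour col
HasWheel : ∀ {N} → Colouring N → Colour → (n : ℕ) → Set
HasWheel {N} c col n =
  Σ (Fin N) λ h → Σ (Fin (suc n) → Fin N) λ f →
    Injective _≡_ _≡_ f × (∀ i → f i ≢ h)
    × (∀ i → c (f i) (f (next i)) ≡ col)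
    × (∀ i → c h (f i) ≡ col)

classSize : ∀ {N} → (Fin N → Fin 4) → Fin 4 → ℕ
classSize {N} part j = length (filter (λ v → part v ≟ j) (allFin N))

{-# OPTIONS --safe #-}
module Submission where

-- A blue K_{k+1,k+1,k+1} determines the partition: its three parts are red cliques (a blue edge in a
-- part gives a wheel), every other vertex has at least three red neighbours in some part, and the red
-- edges between two of the three classes so obtained form a star (two disjoint ones would close up to
-- a red C_{2k+1}); two of the three centres meet all these edges and make up U₀.
--
-- To find such a subgraph, keep 5k + 3 vertices. A 2-coloured complete graph on at least 3k + 2
-- vertices without monochromatic C_{2k+1} contains two cliques of one colour with 3k + 1 vertices in
-- total and only the other colour in between: by Ramsey there is a monochromatic triangle, cycles can be
-- lengthened by one or two up to C_{2k+2}, and the chords of C_{2k+2} are forced. If some vertex has blue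
-- degree at least 3k + 2, this applies to its blue neighbourhood and then to the blue neighbourhood of
-- a suitable vertex of the larger clique; the two cliques of the latter and the larger clique of the
-- former form the tripartite graph up to few vertices.
--
-- Otherwise every red degree is at least 2k + 1. Then some red triangle x y y' has a fourth vertex
-- joined in red to x and y, that is, a red x-y path on 3 vertices avoiding y'. By downward induction
-- no red x-y path avoiding y' has s vertices for 3 ≤ s ≤ 2k + 1: for s ≥ 2k it gives a red C_{2k+1},
-- and if a path on s vertices cannot be lengthened by one or two, then the red neighbourhoods of
-- suitable vertices near it are mutually blue.

open import Defs
open import Data.Bool using (Bool; true; _∧_) renaming (T to IsTrue)
open import Data.Bool.Properties using (T-∧)
open import Data.Empty using (⊥; ⊥-elim)
open import Data.Fin using (Fin; zero; suc; toℕ; inject≤)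
open import Data.Fin.Properties using (_≟_; any?; all?; toℕ<n; toℕ-injective; toℕ-fromℕ<; inject≤-injective)
open import Data.List using (List; lookup; []; _∷_; _++_; length; filter; map; take; allFin; upTo)
open import Data.List.Membership.Propositional using (_∈_; _∉_; find)
open import Data.List.Membership.Propositional.Properties
open import Data.List.Properties using (length-++; length-map; length-take; length-tabulate; length-upTo; map-++; ++-assoc; ++-identityʳ; filter-≐)
open import Data.List.Relation.Binary.Permutation.Propositional using (_↭_; ↭-sym; ↭-trans; ↭-refl; prep; swap; ↭-reflexive; ↭⇒↭ₛ)
open import Data.List.Relation.Binary.Permutation.Propositional.Properties using (shift; shifts; map⁺; ++-comm; ∈-resp-↭; ↭-length; ++⁺; ++⁺ˡ)
import Data.List.Relation.Binary.Permutation.Setoid.Properties as PermS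
open import Data.List.Relation.Unary.All using (All; []; _∷_)
import Data.List.Relation.Unary.All as All
import Data.List.Relation.Unary.All.Properties as AllP
open import Data.List.Relation.Unary.AllPairs using ([]; _∷_)
import Data.List.Relation.Unary.AllPairs as AllPairs
open import Data.List.Relation.Unary.Any using (Any; here; there)
open import Data.List.Relation.Unary.Unique.Propositional using (Unique)
import Data.List.Relation.Unary.Unique.Propositional.Properties as Uniq
open import Data.Nat using (ℕ; zero; suc; _≤_; _<_; _*_; _+_; z≤n; s≤s; _≤ᵇ_; _∸_; _≤?_; _<?_; _%_; _/_)
open import Data.Nat.DivMod using (m<n⇒m%n≡m; n%n≡0; m%n<n; [m+n]%n≡m%n; [m+kn]%n≡m%n; m≡m%n+[m/n]*n)
open import Data.Nat.Properties renaming (_≟_ to _≟ℕ_)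
open import Data.Product using (Σ; _×_; _,_; proj₁; proj₂; ∃)
open import Data.Sum using (_⊎_; inj₁; inj₂; [_,_])
open import Data.Unit using (⊤; tt)
open import Data.Vec using (Vec; []; _∷_)
import Data.Vec as Vec
open import Data.Vec.N-ary using (N-ary; _$ⁿ_)
open import Function using (_∘_; id)
open import Function.Bundles using (Equivalence)
open import Relation.Binary.Definitions using (DecidableEquality; Tri; tri<; tri≈; tri>)
open import Relation.Binary.PropositionalEquality hiding ([_])
open import Relation.Nullary using (¬_; Dec; yes; no; ¬?)
open import Relation.Nullary.Decidable using (decidable-stable; _×-dec_; _⊎-dec_; _→-dec_; toWitness)

-- Linear arithmetic over ℕ

-- A blue C_{2k+1} in a blue neighbourhood is the rim of a wheel, so a blue neighbourhood contains
-- no C_{2k+1} of either colour, and a statement symmetric in the two colours applies to it. The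
-- thresholds fit together through 5k + 3 = 1 + 2k + (3k + 2): blue degree at most 3k + 1 forces red
-- degree at least 2k + 1. Exactly 5k + 3 vertices are kept because both cases also use the upper
-- bound: in the first at most 2k + 1 vertices remain outside two red cliques and a vertex `v`, in
-- the second the red neighbourhoods of a red triangle must overlap.
--
-- The recurring obstacle is parity. Complete bipartite graphs have only even cycles, so each
-- C_{2k+1} needs an odd ingredient: a vertex with neighbours on both sides, an edge inside a side,
-- or a third part.
--
-- Positions `f i` and `f (i + 4)` of a path are compared because a path w d d' w' off it has just
-- one vertex more than the stretch between them.
--
-- The blue K_{k+1,k+1,k+1} is only shown not to be absent; the partition can still be found, since
-- being one is decidable and there are finitely many candidates.

data Ex (n : ℕ) : Set where
  ` : Fin n → Ex n
  # : ℕ → Ex n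
  _⊕_ : Ex n → Ex n → Ex n
  _⊛_ : ℕ → Ex n → Ex n

infixl 6 _⊕_
infixl 7 _⊛_

⟦_⟧ : ∀ {n} → Ex n → Vec ℕ n → ℕ
⟦ ` i ⟧ ρ = Vec.lookup ρ i
⟦ # m ⟧ ρ = m
⟦ a ⊕ b ⟧ ρ = ⟦ a ⟧ ρ + ⟦ b ⟧ ρ
⟦ m ⊛ a ⟧ ρ = m * ⟦ a ⟧ ρ

constant : ∀ {n} → Ex n → ℕ
constant (` i) = 0
constant (# m) = m
constant (a ⊕ b) = constant a + constant b
constant (m ⊛ a) = m * constant a

coeffs : ∀ {n} → Ex n → Vec ℕ n
coeffs (` zero) = 1 ∷ Vec.replicate _ 0
coeffs (` (suc i)) = 0 ∷ coeffs (` i)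
coeffs (# m) = Vec.replicate _ 0
coeffs (a ⊕ b) = Vec.zipWith _+_ (coeffs a) (coeffs b)
coeffs (m ⊛ a) = Vec.map (m *_) (coeffs a)

dot : ∀ {n} → Vec ℕ n → Vec ℕ n → ℕ
dot [] [] = 0
dot (x ∷ xs) (y ∷ ys) = x * y + dot xs ys

dot-0 : ∀ {n} (ρ : Vec ℕ n) → dot (Vec.replicate n 0) ρ ≡ 0
dot-0 [] = refl
dot-0 (x ∷ ρ) = dot-0 ρ

dot-+ : ∀ {n} (a b ρ : Vec ℕ n) → dot (Vec.zipWith _+_ a b) ρ ≡ dot a ρ + dot b ρ
dot-+ [] [] [] = refl
dot-+ (a ∷ as) (b ∷ bs) (x ∷ ρ) = begin
  (a + b) * x + dot (Vec.zipWith _+_ as bs) ρ     ≡⟨ cong₂ _+_ (*-distribʳ-+ x a b) (dot-+ as bs ρ) ⟩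
  a * x + b * x + (dot as ρ + dot bs ρ)       ≡⟨ +-assoc (a * x) (b * x) _ ⟩
  a * x + (b * x + (dot as ρ + dot bs ρ))     ≡⟨ cong (a * x +_) (sym (+-assoc (b * x) (dot as ρ) _)) ⟩
  a * x + (b * x + dot as ρ + dot bs ρ)       ≡⟨ cong (λ t → a * x + (t + dot bs ρ)) (+-comm (b * x) (dot as ρ)) ⟩
  a * x + (dot as ρ + b * x + dot bs ρ)       ≡⟨ cong (a * x +_) (+-assoc (dot as ρ) (b * x) _) ⟩
  a * x + (dot as ρ + (b * x + dot bs ρ))     ≡⟨ +-assoc (a * x) (dot as ρ) _ ⟨
  a * x + dot as ρ + (b * x + dot bs ρ)       ∎
  where open ≡-Reasoning

dot-* : ∀ {n} m (a ρ : Vec ℕ n) → dot (Vec.map (m *_) a) ρ ≡ m * dot a ρ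
dot-* m [] [] = sym (*-zeroʳ m)
dot-* m (a ∷ as) (x ∷ ρ) =
  trans (cong₂ _+_ (*-assoc m a x) (dot-* m as ρ)) (sym (*-distribˡ-+ m (a * x) (dot as ρ)))

dot-var : ∀ {n} (i : Fin n) (ρ : Vec ℕ n) → dot (coeffs (` i)) ρ ≡ Vec.lookup ρ i
dot-var zero (x ∷ ρ) = trans (cong₂ _+_ (*-identityˡ x) (dot-0 ρ)) (+-identityʳ x)
dot-var (suc i) (x ∷ ρ) = dot-var i ρ

normal : ∀ {n} (e : Ex n) ρ → ⟦ e ⟧ ρ ≡ constant e + dot (coeffs e) ρ
normal (` i) ρ = sym (dot-var i ρ)
normal (# m) ρ = sym (trans (cong (m +_) (dot-0 ρ)) (+-identityʳ m))
normal (a ⊕ b) ρ = begin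
  ⟦ a ⟧ ρ + ⟦ b ⟧ ρ                       ≡⟨ cong₂ _+_ (normal a ρ) (normal b ρ) ⟩
  (ka + da) + (kb + db)                   ≡⟨ +-assoc ka da _ ⟩
  ka + (da + (kb + db))                   ≡⟨ cong (ka +_) (sym (+-assoc da kb db)) ⟩
  ka + (da + kb + db)                     ≡⟨ cong (λ t → ka + (t + db)) (+-comm da kb) ⟩
  ka + (kb + da + db)                     ≡⟨ cong (ka +_) (+-assoc kb da db) ⟩
  ka + (kb + (da + db))                   ≡⟨ +-assoc ka kb _ ⟨
  ka + kb + (da + db)                     ≡⟨ cong (ka + kb +_) (sym (dot-+ (coeffs a) (coeffs b) ρ)) ⟩
  ka + kb + dot (coeffs (a ⊕ b)) ρ        ∎
  where
  open ≡-Reasoning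
  ka kb da db : ℕ
  ka = constant a
  kb = constant b
  da = dot (coeffs a) ρ
  db = dot (coeffs b) ρ
normal (m ⊛ a) ρ = begin
  m * ⟦ a ⟧ ρ                                         ≡⟨ cong (m *_) (normal a ρ) ⟩
  m * (constant a + dot (coeffs a) ρ)                 ≡⟨ *-distribˡ-+ m (constant a) _ ⟩
  m * constant a + m * dot (coeffs a) ρ               ≡⟨ cong (m * constant a +_) (sym (dot-* m (coeffs a) ρ)) ⟩
  m * constant a + dot (coeffs (m ⊛ a)) ρ             ∎
  where open ≡-Reasoning

leqᵛ : ∀ {n} → Vec ℕ n → Vec ℕ n → Bool
leqᵛ [] [] = true
leqᵛ (x ∷ xs) (y ∷ ys) = (x ≤ᵇ y) ∧ leqᵛ xs ys

leqᵛ-sound : ∀ {n} (a b ρ : Vec ℕ n) → IsTrue (leqᵛ a b) → dot a ρ ≤ dot b ρ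
leqᵛ-sound [] [] [] _ = z≤n
leqᵛ-sound (a ∷ as) (b ∷ bs) (x ∷ ρ) p with Equivalence.to (T-∧ {a ≤ᵇ b}) p
... | q , r = +-mono-≤ (*-monoˡ-≤ x (≤ᵇ⇒≤ a b q)) (leqᵛ-sound as bs ρ r)

record Ineq (n : ℕ) : Set where
  constructor _:≤_
  field lower upper : Ex n

infix 5 _:≤_

record Sequent (n : ℕ) : Set where
  constructor _⊢_
  field
    premises : List (Ineq n)
    goal : Ineq n

infix 3 _⊢_

⟦_⟧ᴵ : ∀ {n} → Ineq n → Vec ℕ n → Set
⟦ a :≤ b ⟧ᴵ ρ = ⟦ a ⟧ ρ ≤ ⟦ b ⟧ ρ

-- The singleton case avoids a trailing unit, so that the evidence handed to `lin` is a plain tuple.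
Premises : ∀ {n} → List (Ineq n) → Vec ℕ n → Set
Premises [] ρ = ⊤
Premises (h ∷ []) ρ = ⟦ h ⟧ᴵ ρ
Premises (h ∷ hs@(_ ∷ _)) ρ = ⟦ h ⟧ᴵ ρ × Premises hs ρ

total : ∀ {n} → List (Ineq n) → Ineq n
total [] = # 0 :≤ # 0
total ((a :≤ b) ∷ hs) = (a ⊕ Ineq.lower (total hs)) :≤ (b ⊕ Ineq.upper (total hs))

total-sound : ∀ {n} (hs : List (Ineq n)) ρ → Premises hs ρ → ⟦ total hs ⟧ᴵ ρ
total-sound [] ρ _ = z≤n
total-sound (h ∷ []) ρ p = +-mono-≤ p z≤n
total-sound (h ∷ hs@(_ ∷ _)) ρ (p , q) = +-mono-≤ p (total-sound hs ρ q)

-- The goal follows from the sum of the premises by comparing coefficients.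
check : ∀ {n} → Sequent n → Bool
check (hs ⊢ (a :≤ b)) =
  (constant l ≤ᵇ constant r) ∧ leqᵛ (coeffs l) (coeffs r)
  where
  l r : Ex _
  l = a ⊕ Ineq.upper (total hs)
  r = b ⊕ Ineq.lower (total hs)

vars : ∀ {n} → Vec (Ex n) n
vars = Vec.tabulate `

linear : ∀ {n} (s : Sequent n) (ρ : Vec ℕ n) → IsTrue (check s) →
         Premises (Sequent.premises s) ρ → ⟦ Sequent.goal s ⟧ᴵ ρ
linear {n} (hs ⊢ (a :≤ b)) ρ ok ps = +-cancelʳ-≤ (⟦ U ⟧ ρ) _ _ (begin
  ⟦ a ⟧ ρ + ⟦ U ⟧ ρ                           ≡⟨ normal (a ⊕ U) ρ ⟩
  constant (a ⊕ U) + dot (coeffs (a ⊕ U)) ρ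
    ≤⟨ +-mono-≤ (≤ᵇ⇒≤ _ _ (proj₁ both)) (leqᵛ-sound (coeffs (a ⊕ U)) (coeffs (b ⊕ L)) ρ (proj₂ both)) ⟩
  constant (b ⊕ L) + dot (coeffs (b ⊕ L)) ρ   ≡⟨ normal (b ⊕ L) ρ ⟨
  ⟦ b ⟧ ρ + ⟦ L ⟧ ρ                           ≤⟨ +-monoʳ-≤ (⟦ b ⟧ ρ) (total-sound hs ρ ps) ⟩
  ⟦ b ⟧ ρ + ⟦ U ⟧ ρ                           ∎)
  where
  open ≤-Reasoning
  U L : Ex n
  U = Ineq.upper (total hs)
  L = Ineq.lower (total hs)
  both : IsTrue (constant (a ⊕ U) ≤ᵇ constant (b ⊕ L)) × IsTrue (leqᵛ (coeffs (a ⊕ U)) (coeffs (b ⊕ L)))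
  both = Equivalence.to (T-∧ {constant (a ⊕ U) ≤ᵇ constant (b ⊕ L)}) ok

-- The check evaluates to the unit type and is therefore filled in silently. Premises are added with
-- coefficient one; one that needs a larger coefficient is listed that many times. Contradictions
-- are derived as `# 1 :≤ # 0`.
lin : ∀ n (f : N-ary n (Ex n) (Sequent n)) (ρ : Vec ℕ n) →
      {IsTrue (check (f $ⁿ vars))} →
      Premises (Sequent.premises (f $ⁿ vars)) ρ → ⟦ Sequent.goal (f $ⁿ vars) ⟧ᴵ ρ
lin n f ρ {ok} = linear (f $ⁿ vars) ρ ok

linear-≡ : ∀ n (f : N-ary n (Ex n) (Ineq n)) (ρ : Vec ℕ n) → let s = f $ⁿ vars in
           {IsTrue (check ([] ⊢ s))} → {IsTrue (check ([] ⊢ (Ineq.upper s :≤ Ineq.lower s)))} →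
           ⟦ Ineq.lower s ⟧ ρ ≡ ⟦ Ineq.upper s ⟧ ρ
linear-≡ n f ρ {p} {q} = ≤-antisym (linear ([] ⊢ s) ρ p tt) (linear ([] ⊢ (Ineq.upper s :≤ Ineq.lower s)) ρ q tt)
  where
  s : Ineq n
  s = f $ⁿ vars

1≰0 : ¬ (1 ≤ 0)
1≰0 ()

-- Finite sets as lists without repetition

module _ {A : Set} where

  infix 4 _⊑_
  _⊑_ : List A → List A → Set
  xs ⊑ ys = ∀ {x} → x ∈ xs → x ∈ ys

  Unique-head : ∀ {x : A} {xs} → Unique (x ∷ xs) → x ∉ xs
  Unique-head (p ∷ _) q = All.lookup p q refl

  Unique-tail : ∀ {x : A} {xs} → Unique (x ∷ xs) → Unique xs
  Unique-tail (_ ∷ u) = u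

  Unique-cons : ∀ {x : A} {xs} → x ∉ xs → Unique xs → Unique (x ∷ xs)
  Unique-cons p u = All.tabulate (λ q e → p (subst (_∈ _) (sym e) q)) ∷ u

  Unique-[] : ∀ (x : A) → Unique (x ∷ [])
  Unique-[] x = [] ∷ []

  Unique-++ : ∀ {xs ys : List A} → Unique xs → Unique ys →
              (∀ {x} → x ∈ xs → x ∉ ys) → Unique (xs ++ ys)
  Unique-++ u v d = Uniq.++⁺ u v (λ (p , q) → d p q)

  abstract
    card : ∀ {xs ys : List A} → Unique xs → xs ⊑ ys → length xs ≤ length ys
    card {[]} _ _ = z≤n
    card {x ∷ xs} u s with ∈-∃++ (s (here refl))
    ... | as , bs , refl = begin
      suc (length xs)               ≤⟨ s≤s (card (Unique-tail u) rest) ⟩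
      suc (length (as ++ bs))       ≡⟨ cong suc (length-++ as) ⟩
      suc (length as + length bs)   ≡⟨ +-suc (length as) (length bs) ⟨
      length as + suc (length bs)   ≡⟨ length-++ as ⟨
      length (as ++ x ∷ bs)         ∎
      where
      open ≤-Reasoning
      rest : xs ⊑ as ++ bs
      rest p with ∈-++⁻ as (s (there p))
      ... | inj₁ q = ∈-++⁺ˡ q
      ... | inj₂ (here refl) = ⊥-elim (Unique-head u p)
      ... | inj₂ (there q) = ∈-++⁺ʳ as q

  ++-elim : ∀ xs {ys : List A} {x} {P : Set} → x ∈ xs ++ ys → (x ∈ xs → P) → (x ∈ ys → P) → P
  ++-elim xs p f g with ∈-++⁻ xs p
  ... | inj₁ q = f q
  ... | inj₂ q = g q

  ∈-[]⁻ : ∀ {x y : A} → x ∈ y ∷ [] → x ≡ y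
  ∈-[]⁻ (here e) = e

  ∈-take : ∀ n {xs : List A} → take n xs ⊑ xs
  ∈-take (suc n) {x ∷ xs} (here e) = here e
  ∈-take (suc n) {x ∷ xs} (there p) = there (∈-take n p)

  at-most-one : ∀ {xs : List A} → Unique xs → (∀ {x y} → x ∈ xs → y ∈ xs → x ≡ y) →
                length xs ≤ 1
  at-most-one {[]} u f = z≤n
  at-most-one {x ∷ []} u f = s≤s z≤n
  at-most-one {x ∷ y ∷ xs} u f =
    ⊥-elim (Unique-head u (here (f (here refl) (there (here refl)))))

  distinct-pair : ∀ {xs : List A} → Unique xs → 2 ≤ length xs →
                  ∃ λ x → ∃ λ y → x ∈ xs × y ∈ xs × x ≢ y
  distinct-pair {[]} _ ()
  distinct-pair {_ ∷ []} _ (s≤s ())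
  distinct-pair {x ∷ y ∷ xs} u _ =
    x , y , here refl , there (here refl) , λ e → Unique-head u (here e)

  record Selection (n : ℕ) (xs as : List A) : Set where
    field
      list : List A
      unique : Unique list
      size : length list ≡ n
      from : list ⊑ xs
      avoid : ∀ {x} → x ∈ list → x ∉ as

module Sets {A : Set} (_≟_ : DecidableEquality A) where
  open import Data.List.Membership.DecPropositional _≟_ public using (_∈?_)

  infixl 6 _∖_
  _∖_ : List A → List A → List A
  xs ∖ as = filter (λ x → ¬? (x ∈? as)) xs

  ∖⁺ : ∀ {x xs as} → x ∈ xs → x ∉ as → x ∈ xs ∖ as
  ∖⁺ p q = ∈-filter⁺ _ p q

  ∖⁻ : ∀ {x} xs as → x ∈ xs ∖ as → x ∈ xs × x ∉ as
  ∖⁻ xs as p = ∈-filter⁻ _ {xs = xs} p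

  Unique-∖ : ∀ {xs as} → Unique xs → Unique (xs ∖ as)
  Unique-∖ u = Uniq.filter⁺ _ u

  abstract
    card-∖ : ∀ {xs : List A} as → Unique xs → length xs ≤ length (xs ∖ as) + length as
    card-∖ {xs} as u = subst (length xs ≤_) (length-++ (xs ∖ as)) (card u sub)
      where
      sub : xs ⊑ (xs ∖ as) ++ as
      sub {x} p with x ∈? as
      ... | yes q = ∈-++⁺ʳ (xs ∖ as) q
      ... | no q = ∈-++⁺ˡ (∖⁺ p q)

    select : ∀ {n} {xs : List A} as → Unique xs → n + length as ≤ length xs → Selection n xs as
    select {n} {xs} as u h = record
      { list = take n (xs ∖ as)
      ; unique = Uniq.take⁺ n (Unique-∖ u)
      ; size = trans (length-take n (xs ∖ as)) (m≤n⇒m⊓n≡m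
          (+-cancelʳ-≤ (length as) _ _ (≤-trans h (card-∖ as u))))
      ; from = λ p → proj₁ (∖⁻ xs as (∈-take n p))
      ; avoid = λ p → proj₂ (∖⁻ xs as (∈-take n p))
      }

    pick : ∀ {xs as : List A} → Unique xs → length as < length xs → ∃ λ x → x ∈ xs × x ∉ as
    pick {xs} {as} u h with select {1} as u h
    ... | s with Selection.list s | Selection.size s | Selection.from s | Selection.avoid s
    ... | x ∷ [] | _ | f | a = x , f (here refl) , a (here refl)

-- Paths, cycles and cliques in a coloured complete graph

Unique-↭ : ∀ {A : Set} {xs ys : List A} → xs ↭ ys → Unique xs → Unique ys
Unique-↭ p = PermS.Unique-resp-↭ (setoid _) (↭⇒↭ₛ p)

at : {A : Set} → A → List A → ℕ → A
at d [] i = d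
at d (x ∷ xs) zero = x
at d (x ∷ xs) (suc i) = at d xs i

at-∈ : ∀ {A : Set} (d : A) xs {i} → i < length xs → at d xs i ∈ xs
at-∈ d (x ∷ xs) {zero} _ = here refl
at-∈ d (x ∷ xs) {suc i} (s≤s h) = there (at-∈ d xs h)

at-surj : ∀ {A : Set} (d : A) {xs x} → x ∈ xs → ∃ λ i → i < length xs × at d xs i ≡ x
at-surj d (here refl) = 0 , s≤s z≤n , refl
at-surj d (there p) with at-surj d p
... | i , h , e = suc i , s≤s h , e

at-inj : ∀ {A : Set} (d : A) {xs} → Unique xs → ∀ {i j} → i < length xs → j < length xs →
         at d xs i ≡ at d xs j → i ≡ j
at-inj d {x ∷ xs} u {zero} {zero} _ _ _ = refl
at-inj d {x ∷ xs} u {zero} {suc j} _ (s≤s h) e =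
  ⊥-elim (Unique-head u (subst (_∈ xs) (sym e) (at-∈ d xs h)))
at-inj d {x ∷ xs} u {suc i} {zero} (s≤s h) _ e =
  ⊥-elim (Unique-head u (subst (_∈ xs) e (at-∈ d xs h)))
at-inj d {x ∷ xs} u {suc i} {suc j} (s≤s h) (s≤s h') e =
  cong suc (at-inj d (Unique-tail u) h h' e)

op : Colour → Colour
op red = blue
op blue = red

op-op : ∀ α → op (op α) ≡ α
op-op red = refl
op-op blue = refl

_≟ᶜ_ : (α β : Colour) → Dec (α ≡ β)
red ≟ᶜ red = yes refl
red ≟ᶜ blue = no λ ()
blue ≟ᶜ red = no λ ()
blue ≟ᶜ blue = yes refl

≢⇒op : ∀ {α β} → β ≢ α → β ≡ op α
≢⇒op {red} {red} h = ⊥-elim (h refl)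
≢⇒op {red} {blue} h = refl
≢⇒op {blue} {red} h = refl
≢⇒op {blue} {blue} h = ⊥-elim (h refl)

op-≢ : ∀ {α β} → β ≡ α → β ≡ op α → ⊥
op-≢ {red} refl ()
op-≢ {blue} refl ()

module Graph {N : ℕ} (c : Colouring N) (c-sym : Symmetric c) where

  open Sets (_≟_ {N}) public

  V : Set
  V = Fin N

  vertices : List V
  vertices = allFin N

  vertices-unique : Unique vertices
  vertices-unique = Uniq.allFin⁺ N

  vertices-size : length vertices ≡ N
  vertices-size = length-tabulate id

  card-vertices : ∀ {xs} → Unique xs → length xs ≤ N
  card-vertices {xs} u = subst (length xs ≤_) vertices-size (card {xs = xs} {vertices} u (λ {x} _ → ∈-allFin x))

  vertices-card : ∀ xs → (∀ x → x ∈ xs) → N ≤ length xs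
  vertices-card xs h = subst (_≤ length xs) vertices-size (card {xs = vertices} {xs} vertices-unique (λ {x} _ → h x))

  E : Colour → V → V → Set
  E α u v = c u v ≡ α

  E? : ∀ α u v → Dec (E α u v)
  E? α u v = c u v ≟ᶜ α

  E-sym : ∀ {α u v} → E α u v → E α v u
  E-sym {u = u} {v} e = trans (c-sym v u) e

  not-E : ∀ {α u v} → ¬ E α u v → E (op α) u v
  not-E = ≢⇒op

  E-op : ∀ {α u v} → E α u v → E (op α) u v → ⊥
  E-op = op-≢

  Clique : Colour → List V → Set
  Clique α K = ∀ {u v} → u ∈ K → v ∈ K → u ≢ v → E α u v

  Complete : Colour → List V → List V → Set
  Complete α X Y = ∀ {x y} → x ∈ X → y ∈ Y → E α x y

  -- HamPath α u v S: the list S can be ordered into a path of colour α from u to v.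
  data HamPath (α : Colour) : V → V → List V → Set where
    one : ∀ u → HamPath α u u (u ∷ [])
    join : ∀ {u v w z S T} → HamPath α u v S → E α v w → HamPath α w z T → HamPath α u z (S ++ T)
    perm : ∀ {u v S T} → S ↭ T → HamPath α u v S → HamPath α u v T

  HamCycle : Colour → List V → Set
  HamCycle α S = ∃ λ u → ∃ λ v → HamPath α u v S × E α v u

  rev : ∀ {α u v S} → HamPath α u v S → HamPath α v u S
  rev (one u) = one u
  rev (join {S = S} {T} p e q) = perm (++-comm T S) (join (rev q) (E-sym e) (rev p))
  rev (perm h p) = perm h (rev p)

  record Cycle (α : Colour) (n : ℕ) (P : V → Set) : Set where
    constructor cycle
    field
      {support} : List V
      ham : HamCycle α support
      unique : Unique support
      size : length support ≡ n
      within : ∀ {x} → x ∈ support → P x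

  Anywhere : V → Set
  Anywhere _ = ⊤

  -- `HamPath` is closed under permutations of the support and so forgets the order of its vertices;
  -- here the list is the order of traversal, from which positions can be read off.
  data Trail (α : Colour) : V → V → List V → Set where
    stop : ∀ u → Trail α u u (u ∷ [])
    step : ∀ {u w v l} → E α u w → Trail α w v l → Trail α u v (u ∷ l)

  trail-++ : ∀ {α u v w z l m} → Trail α u v l → E α v w → Trail α w z m → Trail α u z (l ++ m)
  trail-++ (stop u) e q = step e q
  trail-++ (step d p) e q = step d (trail-++ p e q)

  trail : ∀ {α u v S} → HamPath α u v S → ∃ λ l → Trail α u v l × l ↭ S
  trail (one u) = _ , stop u , ↭-refl
  trail (join p e q) with trail p | trail q
  ... | l , r , h | m , s , h' = l ++ m , trail-++ r e s , ++⁺ h h'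
  trail (perm h p) with trail p
  ... | l , r , h' = l , r , ↭-trans h' h

  trail-first : ∀ {α u v l} d → Trail α u v l → at d l 0 ≡ u
  trail-first d (stop u) = refl
  trail-first d (step _ _) = refl

  trail-last : ∀ {α u v l} d → Trail α u v l → ∀ {n} → length l ≡ suc n → at d l n ≡ v
  trail-last d (stop u) {zero} _ = refl
  trail-last d (step e (stop u)) {suc zero} _ = refl
  trail-last d (step e p@(step _ _)) {suc n} h = trail-last d p (suc-injective h)

  trail-step : ∀ {α u v l} d → Trail α u v l → ∀ {i} → suc i < length l →
               E α (at d l i) (at d l (suc i))
  trail-step d (stop u) (s≤s ())
  trail-step d (step e p) {zero} _ = subst (E _ _) (sym (trail-first d p)) e
  trail-step d (step e p) {suc i} (s≤s h) = trail-step d p h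

  record Line (α : Colour) (S : List V) (n : ℕ) (u v : V) : Set where
    field
      f : ℕ → V
      edge : ∀ {i} → i < n → E α (f i) (f (suc i))
      inj : ∀ {i j} → i ≤ n → j ≤ n → f i ≡ f j → i ≡ j
      first : f 0 ≡ u
      last : f n ≡ v
      on : ∀ {i} → i ≤ n → f i ∈ S
      onto : ∀ {x} → x ∈ S → ∃ λ i → i ≤ n × f i ≡ x

  line : ∀ {α u v S n} → HamPath α u v S → Unique S → length S ≡ suc n → Line α S n u v
  line {u = u} {n = n} p uS h with trail p
  ... | l , t , q = record
    -- Beyond the last position `at` returns the default `u`, whence the bounds on the indices in
    -- all fields.
    { f = at u l
    ; edge = λ i<n → trail-step u t (subst (_ <_) (sym len) (s≤s i<n))
    ; inj = λ i≤n j≤n → at-inj u (Unique-↭ (↭-sym q) uS) (bound i≤n) (bound j≤n)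
    ; first = trail-first u t
    ; last = trail-last u t len
    ; on = λ i≤n → ∈-resp-↭ q (at-∈ u l (bound i≤n))
    ; onto = λ x∈S → case-onto (at-surj u (∈-resp-↭ (↭-sym q) x∈S))
    }
    where
    len : length l ≡ suc n
    len = trans (↭-length q) h
    bound : ∀ {i} → i ≤ n → i < length l
    bound i≤n = subst (_ <_) (sym len) (s≤s i≤n)
    case-onto : ∀ {x} → (∃ λ i → i < length l × at u l i ≡ x) → ∃ λ i → i ≤ n × at u l i ≡ x
    case-onto (i , i< , e) = i , ≤-pred (subst (i <_) len i<) , e

  toHasCycle : ∀ {α n P} → Cycle α (suc n) P →
    Σ (HasCycle c α n) λ C → ∀ i → P (proj₁ C i)
  toHasCycle {α} {n} (cycle {S} (u , v , p , e) uS h w) =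
    ((L.f ∘ toℕ) , (λ {i} {j} q → toℕ-injective (L.inj (b i) (b j) q)) , adj) , λ i → w (L.on (b i))
    where
    module L = Line (line p uS h)
    b : (i : Fin (suc n)) → toℕ i ≤ n
    b i = ≤-pred (toℕ<n i)
    next-toℕ : ∀ i → toℕ (next {n} i) ≡ suc (toℕ i) % suc n
    next-toℕ i = toℕ-fromℕ< (m%n<n (suc (toℕ i)) (suc n))
    adj : ∀ i → c (L.f (toℕ i)) (L.f (toℕ (next i))) ≡ α
    adj i with toℕ i <? n
    ... | yes i<n = trans (cong (c (L.f (toℕ i)) ∘ L.f)
                      (trans (next-toℕ i) (m<n⇒m%n≡m (s≤s i<n)))) (L.edge i<n)
    ... | no i≮n = trans (cong₂ (λ a b → c (L.f a) (L.f b)) i≡n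
                     (trans (next-toℕ i) (trans (cong (λ a → suc a % suc n) i≡n) (n%n≡0 (suc n)))))
                     (trans (cong₂ c L.last L.first) e)
      where
      i≡n : toℕ i ≡ n
      i≡n = ≤-antisym (b i) (≮⇒≥ i≮n)

  -- The step goes from `x` to `y'` and on to `x'`, saving `y` for the very end, so that both ends
  -- of the alternating path are prescribed.
  zigzag : ∀ {α} x xs y ys → length xs ≡ length ys → Complete α (x ∷ xs) (y ∷ ys) →
           HamPath α x y ((x ∷ xs) ++ (y ∷ ys))
  zigzag x [] y [] _ h = join (one x) (h (here refl) (here refl)) (one y)
  zigzag x (x' ∷ xs) y (y' ∷ ys) l h =
    perm (prep x (↭-trans (↭-sym (shift y' (x' ∷ xs) (y ∷ ys))) (++⁺ (↭-refl {x = x' ∷ xs}) (swap y' y ↭-refl))))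
      (join (one x) (h (here refl) (there (here refl)))
        (join (one y') (E-sym (h (there (here refl)) (there (here refl))))
          (zigzag x' xs y ys (suc-injective l) (λ p q → h (there p) (drop-y' q)))))
    where
    drop-y' : ∀ {z} → z ∈ y ∷ ys → z ∈ y ∷ y' ∷ ys
    drop-y' (here e) = here e
    drop-y' (there q) = there (there q)

  clique-path : ∀ {α K} → Clique α K → ∀ a m b → Unique (a ∷ m ++ b ∷ []) →
                (a ∷ m ++ b ∷ []) ⊑ K → HamPath α a b (a ∷ m ++ b ∷ [])
  clique-path h a [] b u s =
    join (one a) (h (s (here refl)) (s (there (here refl))) (λ e → Unique-head u (here e))) (one b)
  clique-path h a (x ∷ m) b u s =
    join (one a) (h (s (here refl)) (s (there (here refl))) (λ e → Unique-head u (here e)))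
      (clique-path h x m b (Unique-tail u) (s ∘ there))

  -- An alternating path between the sides has an even number of vertices; `w`, with a neighbour on
  -- either side, is the odd vertex that closes it.
  odd-cycle : ∀ {α m P X Y w e o} → 1 ≤ m → Unique X → Unique Y → (∀ {x} → x ∈ X → x ∉ Y) →
    Complete α X Y → m ≤ length X → m ≤ length Y → w ∉ X → w ∉ Y →
    e ∈ X → o ∈ Y → E α w e → E α w o →
    P w → (∀ {x} → x ∈ X → P x) → (∀ {y} → y ∈ Y → P y) → Cycle α (suc (2 * m)) P
  odd-cycle {α} {suc m} {P} {X} {Y} {w} {e} {o} _ uX uY X∩Y h mX mY w∉X w∉Y e∈X o∈Y we wo Pw PX PY =
    cycle (w , o , join (one w) we (zigzag e xs o ys (trans SX.size (sym SY.size)) h') , E-sym wo)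
      (Unique-cons w∉ (Unique-++ u₁ u₂ λ p q → X∩Y (inX p) (inY q)))
      (cong suc (trans (length-++ (e ∷ xs)) (trans (cong₂ (λ a b → suc a + suc b) SX.size SY.size)
        (cong (λ t → suc m + t) (sym (+-identityʳ (suc m)))))))
      λ { (here refl) → Pw
        ; (there p) → [ (λ q → PX (inX q)) , (λ q → PY (inY q)) ] (∈-++⁻ (e ∷ xs) p) }
    where
    module SX = Selection (select {m} (e ∷ []) uX (subst (_≤ length X) (+-comm 1 m) mX))
    module SY = Selection (select {m} (o ∷ []) uY (subst (_≤ length Y) (+-comm 1 m) mY))
    xs = SX.list
    ys = SY.list
    inX : (e ∷ xs) ⊑ X
    inX (here refl) = e∈X
    inX (there p) = SX.from p
    inY : (o ∷ ys) ⊑ Y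
    inY (here refl) = o∈Y
    inY (there p) = SY.from p
    u₁ : Unique (e ∷ xs)
    u₁ = Unique-cons (λ p → SX.avoid p (here refl)) SX.unique
    u₂ : Unique (o ∷ ys)
    u₂ = Unique-cons (λ p → SY.avoid p (here refl)) SY.unique
    h' : Complete α (e ∷ xs) (o ∷ ys)
    h' p q = h (inX p) (inY q)
    w∉ : w ∉ (e ∷ xs) ++ (o ∷ ys)
    w∉ p = [ (λ q → w∉X (inX q)) , (λ q → w∉Y (inY q)) ] (∈-++⁻ (e ∷ xs) p)

  -- An edge inside `X` also breaks the parity: its end `w` is taken out of `X` and plays the
  -- outside vertex. This costs one vertex of `X`, hence `suc m`.
  odd-cycle-edge : ∀ {α m P X Y w e} → 1 ≤ m → Unique X → Unique Y → (∀ {x} → x ∈ X → x ∉ Y) →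
    Complete α X Y → suc m ≤ length X → m ≤ length Y →
    w ∈ X → e ∈ X → w ≢ e → E α w e →
    (∀ {x} → x ∈ X → P x) → (∀ {y} → y ∈ Y → P y) → Cycle α (suc (2 * m)) P
  odd-cycle-edge {m = m} {X = X} {[]} 1≤m _ _ _ _ _ mY _ _ _ _ _ _ = ⊥-elim (1≰0 (≤-trans 1≤m mY))
  odd-cycle-edge {m = m} {X = X} {o ∷ Y} {w} {e} 1≤m uX uY X∩Y h mX mY w∈X e∈X w≢e we PX PY =
    odd-cycle 1≤m (Unique-∖ uX) uY (λ p → X∩Y (proj₁ (∖⁻ X _ p))) (λ p → h (proj₁ (∖⁻ X _ p)))
      (≤-pred (≤-trans mX (subst (length X ≤_) (+-comm _ 1) (card-∖ (w ∷ []) uX)))) mY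
      (λ p → proj₂ (∖⁻ X _ p) (here refl)) (X∩Y w∈X)
      (∖⁺ e∈X λ { (here q) → w≢e (sym q) }) (here refl) we (h w∈X (here refl))
      (PX w∈X) (λ p → PX (proj₁ (∖⁻ X _ p))) PY

  clique-cycle : ∀ {α K n P} → Clique α K → Unique K → suc (suc n) ≤ length K → (∀ {x} → x ∈ K → P x) → Cycle α (suc (suc n)) P
  clique-cycle {α} {a ∷ b ∷ K} {n} h u (s≤s l) PK =
    cycle (a , b , clique-path h a S.list b u' sub , h (there (here refl)) (here refl) (λ e → Unique-head u (here (sym e))))
      u' (cong suc (trans (length-++ S.list) (trans (+-comm _ 1) (cong suc S.size)))) (λ p → PK (sub p))
    where
    module S = Selection (select {n} (b ∷ []) (Unique-tail u) (subst (_≤ suc (length K)) (+-comm 1 n) l))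
    sub : (a ∷ S.list ++ b ∷ []) ⊑ a ∷ b ∷ K
    sub (here e) = here e
    sub (there p) = [ (λ q → there (S.from q)) , (λ q → there (here (∈-[]⁻ q))) ] (∈-++⁻ S.list p)
    u' : Unique (a ∷ S.list ++ b ∷ [])
    u' = Unique-cons (λ p → Unique-head u ([ S.from , (λ q → here (∈-[]⁻ q)) ] (∈-++⁻ S.list p)))
           (Unique-++ S.unique (Unique-[] b) S.avoid)

  big-clique : ∀ {α K k P} → 1 ≤ k → Clique α K → Unique K → suc (2 * k) ≤ length K → (∀ {x} → x ∈ K → P x) →
    Cycle α (suc (2 * k)) P
  big-clique {k = suc _} _ = clique-cycle

  -- Placing `g` between two of its neighbours gains a vertex, so a clique that is one vertex too
  -- small still yields the cycle.
  clique-insert : ∀ {α K n g a b P} → Clique α K → Unique K → suc (suc n) ≤ length K → g ∉ K →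
    a ∈ K → b ∈ K → a ≢ b → E α g a → E α g b → P g → (∀ {x} → x ∈ K → P x) → Cycle α (suc (suc (suc n))) P
  clique-insert {α} {K} {n} {g} {a} {b} {P} h u l g∉K a∈K b∈K a≢b ga gb Pg PK =
    cycle (g , b , join (one g) ga (clique-path h a S.list b u' sub) , E-sym gb)
      (Unique-cons (λ p → g∉K (sub p)) u')
      (cong (λ t → suc (suc t)) (trans (length-++ S.list) (trans (+-comm _ 1) (cong suc S.size)))) λ
          { (here refl) → Pg ; (there p) → PK (sub p) }
    where
    module S = Selection (select {n} (a ∷ b ∷ []) u (subst (_≤ length K) (+-comm 2 n) l))
    sub : (a ∷ S.list ++ b ∷ []) ⊑ K
    sub (here refl) = a∈K
    sub (there p) = [ S.from , (λ q → subst (_∈ K) (sym (∈-[]⁻ q)) b∈K) ] (∈-++⁻ S.list p)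
    u' : Unique (a ∷ S.list ++ b ∷ [])
    u' = Unique-cons (λ p → [ (λ q → S.avoid q (here refl)) , (λ q → a≢b (∈-[]⁻ q)) ] (∈-++⁻ S.list p))
           (Unique-++ S.unique (Unique-[] b) λ p q → S.avoid p (there q))

  -- Two distinct vertices of Q are joined by paths on any number of vertices from 4 to κ.
  record Blob (α : Colour) (κ : ℕ) (Q : V → Set) : Set where
    field
      K : List V
      K-unique : Unique K
      K-size : κ ≤ length K
      K-clique : Clique α K
      K⊂Q : ∀ {x} → x ∈ K → Q x
      foot : ∀ {a} → Q a → a ∉ K → ∀ p q → ∃ λ g → g ∈ K × E α a g × g ≢ p × g ≢ q

  record Link (α : Colour) (Q : V → Set) (t : ℕ) (a b : V) : Set where
    field
      {support} : List V
      path : HamPath α a b support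
      unique : Unique support
      size : length support ≡ t
      within : ∀ {x} → x ∈ support → Q x

  link-cons : ∀ {α Q a g b t} → Q a → E α a g →
    (L : Link α Q t g b) → a ∉ Link.support L → Link α Q (suc t) a b
  link-cons {a = a} Qa ag L a∉L = record
    { path = join (one a) ag (Link.path L)
    ; unique = Unique-cons a∉L (Link.unique L)
    ; size = cong suc (Link.size L)
    ; within = λ { (here refl) → Qa ; (there p) → Link.within L p } }

  link-rev : ∀ {α Q t a b} → Link α Q t a b → Link α Q t b a
  link-rev L = record { path = rev path ; unique = unique ; size = size ; within = within }
    where open Link L

  module _ {α : Colour} {κ : ℕ} {Q : V → Set} (B : Blob α κ Q) where
    open Blob B

    private
      inside : ∀ {a b} t → 2 + t ≤ κ → a ∈ K → b ∈ K → a ≢ b →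
        ∀ as → length as + t ≤ κ → a ∈ as → b ∈ as →
        Σ (Link α Q (2 + t) a b) λ L → ∀ {x} → x ∈ Link.support L → x ∈ K × (x ≡ a ⊎ x ≡ b ⊎ x ∉ as)
      inside {a} {b} t h a∈K b∈K a≢b as h' a∈as b∈as =
        record { path = clique-path K-clique a S.list b u' (proj₁ ∘ sub) ; unique = u'
               ; size = cong suc (trans (length-++ S.list) (trans (+-comm _ 1) (cong suc S.size)))
               ; within = K⊂Q ∘ proj₁ ∘ sub } , sub
        where
        module S = Selection (select {t} as K-unique
          (≤-trans (subst (_≤ κ) (+-comm (length as) t) h') K-size))
        sub : ∀ {x} → x ∈ a ∷ S.list ++ b ∷ [] → x ∈ K × (x ≡ a ⊎ x ≡ b ⊎ x ∉ as)
        sub (here refl) = a∈K , inj₁ refl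
        sub (there p) = [ (λ q → S.from q , inj₂ (inj₂ (S.avoid q)))
                        , (λ q → subst (_∈ K) (sym (∈-[]⁻ q)) b∈K , inj₂ (inj₁ (∈-[]⁻ q))) ] (∈-++⁻ S.list p)
        u' : Unique (a ∷ S.list ++ b ∷ [])
        u' = Unique-cons (λ p → [ (λ q → S.avoid q a∈as) , (λ q → a≢b (∈-[]⁻ q)) ] (∈-++⁻ S.list p))
               (Unique-++ S.unique (Unique-[] b) λ p q → S.avoid p (subst (_∈ as) (sym (∈-[]⁻ q)) b∈as))

    -- Four vertices are the least number that always works: both ends may lie off the core, and
    -- then each needs its own foot in it. Avoiding prescribed vertices in `foot` keeps the two feet
    -- distinct.
    link : ∀ t {a b} → 4 + t ≤ κ → Q a → Q b → a ≢ b → Link α Q (4 + t) a b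
    link t {a} {b} h Qa Qb a≢b with a ∈? K | b ∈? K
    ... | yes a∈K | yes b∈K =
      proj₁ (inside (2 + t) h a∈K b∈K a≢b (a ∷ b ∷ []) h (here refl) (there (here refl)))
    ... | no a∉K | yes b∈K with foot Qa a∉K b b
    ...   | g , g∈K , ag , g≢b , _ with inside (1 + t) (≤-trans (n≤1+n _) h) g∈K b∈K g≢b
                                     (g ∷ b ∷ []) (≤-trans (n≤1+n _) h) (here refl) (there (here refl))
    ...     | L , sub = link-cons Qa ag L (λ p → a∉K (proj₁ (sub p)))
    link t {a} {b} h Qa Qb a≢b | yes a∈K | no b∉K with foot Qb b∉K a a
    ...   | g , g∈K , bg , g≢a , _ with inside (1 + t) (≤-trans (n≤1+n _) h) g∈K a∈K g≢a
                                     (g ∷ a ∷ []) (≤-trans (n≤1+n _) h) (here refl) (there (here refl))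
    ...     | L , sub = link-rev (link-cons Qb bg L (λ p → b∉K (proj₁ (sub p))))
    link t {a} {b} h Qa Qb a≢b | no a∉K | no b∉K with foot Qa a∉K b b
    ...   | g , g∈K , ag , _ with foot Qb b∉K g g
    ...     | g' , g'∈K , bg' , g'≢g , _ with inside t (≤-trans (≤-trans (n≤1+n _) (n≤1+n _)) h) g'∈K g∈K g'≢g
                                     (g' ∷ g ∷ []) (≤-trans (≤-trans (n≤1+n _) (n≤1+n _)) h) (here refl) (there (here refl))
    ...       | L , sub = link-cons Qa ag
                (link-rev (link-cons Qb bg' L (λ p → b∉K (proj₁ (sub p)))))
                λ { (here e) → a≢b e ; (there p) → a∉K (proj₁ (sub p)) }

  two-links : ∀ {α Q R s t a a' b b'} → Link α Q s a a' → Link α R t b b' →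
    (∀ {x} → Q x → R x → ⊥) → E α a' b → E α b' a → Cycle α (s + t) Anywhere
  two-links {s = s} {t} {a} {b' = b'} L M d e e' =
    cycle (a , b' , join L.path e M.path , e')
      (Unique-++ L.unique M.unique λ p q → d (L.within p) (M.within q))
      (trans (length-++ L.support) (cong₂ _+_ L.size M.size)) λ _ → tt
    where
    module L = Link L
    module M = Link M

  link-++ : ∀ {α Q R s t a a' b b'} → Link α Q s a a' → Link α R t b b' →
    (∀ {x} → Q x → R x → ⊥) → E α a' b → Link α (λ x → Q x ⊎ R x) (s + t) a b'
  link-++ L M d e = record
    { path = join L.path e M.path
    ; unique = Unique-++ L.unique M.unique λ p q → d (L.within p) (M.within q)
    ; size = trans (length-++ L.support) (cong₂ _+_ L.size M.size)
    ; within = λ p → [ inj₁ ∘ L.within , inj₂ ∘ M.within ] (∈-++⁻ L.support p) }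
    where
    module L = Link L
    module M = Link M

  link-one : ∀ {α} {Q : V → Set} a → Q a → Link α Q 1 a a
  link-one a Qa = record
    { path = one a ; unique = Unique-[] a ; size = refl ; within = λ { (here refl) → Qa } }

  -- A link on k + 1 vertices on one side and one on k vertices on the other give the odd total; the
  -- shorter one needs at least four vertices, whence `4 ≤ k`.
  two-blobs : ∀ {α k Q R} → 4 ≤ k → Blob α (suc k) Q → Blob α (suc k) R → (∀ {x} → Q x → R x → ⊥) →
    ∀ {a a' b b'} → Q a → R b → E α a b → Q a' → R b' → E α a' b' → a ≢ a' → b ≢ b' →
    Cycle α (suc (2 * k)) Anywhere
  two-blobs {α} {suc (suc (suc (suc j)))} _ BQ BR d {a} {a'} {b} {b'} Qa Rb ab Qa' Rb' ab' a≢a' b≢b' =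
    subst (λ n → Cycle α n Anywhere) (cong (λ t → 5 + (j + t)) (sym (+-identityʳ (4 + j))))
      (two-links (link BQ (suc j) ≤-refl Qa Qa' a≢a') (link BR j (n≤1+n _) Rb' Rb (b≢b' ∘ sym)) d ab' (E-sym ab))
  two-blobs {k = suc zero} (s≤s ())
  two-blobs {k = suc (suc zero)} (s≤s (s≤s ()))
  two-blobs {k = suc (suc (suc zero))} (s≤s (s≤s (s≤s ())))

  module _ (R : V → V → Set) (R? : ∀ a b → Dec (R a b))
           (crossing : ∀ {a b a' b'} → R a b → R a' b' → a ≢ a' → b ≢ b' → ⊥) where

    abstract
      -- König's theorem for matching number one: if no two pairs differ in both coordinates, then
      -- all share their first or all share their second coordinate. The argument is returned as a
      -- dummy centre when there is no pair at all.
      star : V → ∃ λ z → ∀ {a b} → R a b → a ≡ z ⊎ b ≡ z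
      star d with any? (λ a → any? (R? a))
      ... | no none = d , λ {a} {b} r → ⊥-elim (none (a , b , r))
      ... | yes (a₀ , b₀ , r₀) with any? (λ a → R? a b₀ ×-dec ¬? (a ≟ a₀))
      ...   | yes (a₁ , r₁ , a₁≢a₀) = b₀ , λ {a} {b} r → inj₂ (go r)
        where
        go : ∀ {a b} → R a b → b ≡ b₀
        go {a} {b} r with b ≟ b₀
        ... | yes e = e
        ... | no b≢ with a ≟ a₀
        ...   | yes refl = ⊥-elim (crossing r r₁ (a₁≢a₀ ∘ sym) b≢)
        ...   | no a≢ = ⊥-elim (crossing r r₀ a≢ b≢)
      ...   | no none = a₀ , λ {a} {b} r → inj₁ (go r)
        where
        go : ∀ {a b} → R a b → a ≡ a₀
        go {a} {b} r with a ≟ a₀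
        ... | yes e = e
        ... | no a≢ with b ≟ b₀
        ...   | yes refl = ⊥-elim (none (a , r , a≢))
        ...   | no b≢ = ⊥-elim (crossing r r₀ a≢ b≢)

-- The partition defined by a blue K_{k+1,k+1,k+1}

next₃ prev₃ : Fin 3 → Fin 3
next₃ zero = suc zero
next₃ (suc zero) = suc (suc zero)
next₃ (suc (suc zero)) = zero
prev₃ zero = suc (suc zero)
prev₃ (suc zero) = zero
prev₃ (suc (suc zero)) = suc zero

third : Fin 3 → Fin 3 → Fin 3
third i j with next₃ i ≟ j
... | yes _ = prev₃ i
... | no _ = next₃ i

abstract
  third-≢ : ∀ i j → i ≢ j → third i j ≢ i × third i j ≢ j
  third-≢ = toWitness {a? = all? λ i → all? λ j → ¬? (i ≟ j) →-dec (¬? (third i j ≟ i) ×-dec ¬? (third i j ≟ j))} tt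

  third-only : ∀ i j a → i ≢ j → a ≢ i → a ≢ j → a ≡ third i j
  third-only = toWitness {a? = all? λ i → all? λ j → all? λ a →
    ¬? (i ≟ j) →-dec (¬? (a ≟ i) →-dec (¬? (a ≟ j) →-dec (a ≟ third i j)))} tt

  neighbours₃ : ∀ l → next₃ l ≢ l × prev₃ l ≢ l × next₃ l ≢ prev₃ l
  neighbours₃ = toWitness {a? = all? λ l → ¬? (next₃ l ≟ l) ×-dec (¬? (prev₃ l ≟ l) ×-dec ¬? (next₃ l ≟ prev₃ l))} tt

  pair₃ : ∀ l i j → i ≢ j → l ≢ i → l ≢ j → (i ≡ next₃ l × j ≡ prev₃ l) ⊎ (i ≡ prev₃ l × j ≡ next₃ l)
  pair₃ = toWitness {a? = all? λ l → all? λ i → all? λ j → ¬? (i ≟ j) →-dec (¬? (l ≟ i) →-dec (¬? (l ≟ j) →-dec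
    (((i ≟ next₃ l) ×-dec (j ≟ prev₃ l)) ⊎-dec ((i ≟ prev₃ l) ×-dec (j ≟ next₃ l)))))} tt

module _ {N : ℕ} (c : Colouring N) (c-sym : Symmetric c) (k : ℕ) where

  open Graph c c-sym

  BlueNbr : V → V → Set
  BlueNbr h x = h ≢ x × E blue h x

  record Tripartite : Set where
    field
      K : Fin 3 → List V
      K-unique : ∀ i → Unique (K i)
      K-size : ∀ i → suc k ≤ length (K i)
      K-disjoint : ∀ {i j x} → i ≢ j → x ∈ K i → x ∉ K j
      K-blue : ∀ {i j} → i ≢ j → Complete blue (K i) (K j)

  record Partition : Set where
    field
      part : V → Fin 4
      exceptional : classSize part zero ≤ 2
      small : ∀ i → i ≢ zero → classSize part i ≤ 2 * k
      colours : ∀ u v → u ≢ v → part u ≢ zero → part v ≢ zero →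
        (part u ≡ part v → c u v ≡ red) × (part u ≢ part v → c u v ≡ blue)

  NoRed NoWheel : Set
  NoRed = Cycle red (suc (2 * k)) Anywhere → ⊥
  NoWheel = ∀ h → Cycle blue (suc (2 * k)) (BlueNbr h) → ⊥

  -- An excursion through the third part prolongs the path by three vertices rather than two, which
  -- changes its parity.
  triple-path : ∀ {α x y z x' y'} X Y Z → E α x z → E α z y → E α y x' →
    HamPath α x' y' (X ++ (Y ++ Z)) → HamPath α x y' ((x ∷ X) ++ ((y ∷ Y) ++ (z ∷ Z)))
  triple-path {x = x} {y} {z} X Y Z xz zy yx' p =
    perm (prep x (↭-sym (↭-trans (shift y X (Y ++ z ∷ Z)) (↭-trans
           (prep y (↭-trans (++⁺ˡ X (shift z Y Z)) (shift z X (Y ++ Z)))) (swap y z ↭-refl)))))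
      (join (one x) xz (join (one z) zy (join (one y) yx' p)))

  -- 2k + 1 = (k - 1) + (k - 1) + 3. Two parts that may be one short of k are compensated by three
  -- excursions into the third part, which also make the total odd.
  tripartite-cycle : ∀ {α P X Y Z} → 6 ≤ k → Unique X → Unique Y → Unique Z →
    k ≤ suc (length X) → k ≤ suc (length Y) → 3 ≤ length Z →
    (∀ {x} → x ∈ X → x ∉ Y) → (∀ {x} → x ∈ X → x ∉ Z) → (∀ {x} → x ∈ Y → x ∉ Z) →
    Complete α X Y → Complete α X Z → Complete α Y Z →
    (∀ {x} → x ∈ X → P x) → (∀ {x} → x ∈ Y → P x) → (∀ {x} → x ∈ Z → P x) →
    Cycle α (suc (2 * k)) P
  tripartite-cycle {α} {P} {X} {Y} {Z} 6≤k uX uY uZ lX lY lZ XY XZ YZ hXY hXZ hYZ PX PY PZ =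
    go 6≤k (select {k ∸ 1} [] uX (sz lX)) (select {k ∸ 1} [] uY (sz lY)) (select {3} [] uZ lZ)
    where
    sz : ∀ {l} → k ≤ suc l → k ∸ 1 + 0 ≤ l
    sz {l} h = subst (_≤ l) (sym (+-identityʳ _)) (≤-trans (∸-monoˡ-≤ 1 h) ≤-refl)
    go : 6 ≤ k → Selection (k ∸ 1) X [] → Selection (k ∸ 1) Y [] → Selection 3 Z [] → Cycle α (suc (2 * k)) P
    go (s≤s (s≤s (s≤s (s≤s (s≤s {n = j} _))))) SX SY SZ
      with Selection.list SX | Selection.size SX | Selection.unique SX | Selection.from SX
         | Selection.list SY | Selection.size SY | Selection.unique SY | Selection.from SY
         | Selection.list SZ | Selection.unique SZ | Selection.from SZ | Selection.size SZ
    ... | xs@(x₁ ∷ x₂ ∷ x₃ ∷ x₄ ∷ x) | l₁ | u₁ | f₁ | ys@(y₁ ∷ y₂ ∷ y₃ ∷ y₄ ∷ y) | l₂ | u₂ | f₂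
        | zs@(z₁ ∷ z₂ ∷ z₃ ∷ []) | u₃ | f₃ | _ =
      cycle (x₁ , y₄ ,
          triple-path (x₂ ∷ x₃ ∷ x₄ ∷ x) (y₂ ∷ y₃ ∷ y₄ ∷ y) (z₂ ∷ z₃ ∷ []) (xz a₁ a₁) (E-sym (yz a₁ a₁)) (E-sym (hXY (f₁ a₂) (f₂ a₁)))
            (triple-path (x₃ ∷ x₄ ∷ x) (y₃ ∷ y₄ ∷ y) (z₃ ∷ []) (xz a₂ a₂) (E-sym (yz a₂ a₂)) (E-sym (hXY (f₁ a₃) (f₂ a₂)))
              (triple-path (x₄ ∷ x) (y₄ ∷ y) [] (xz a₃ a₃) (E-sym (yz a₃ a₃)) (E-sym (hXY (f₁ a₄) (f₂ a₃)))
                (perm (↭-reflexive (cong ((x₄ ∷ x) ++_) (sym (++-identityʳ (y₄ ∷ y)))))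
                  (zigzag x₄ x y₄ y (suc-injective (suc-injective (suc-injective (suc-injective (trans l₁ (sym l₂))))))
                    λ p q → hXY (f₁ (there (there (there p)))) (f₂ (there (there (there q)))))))) ,
          E-sym (hXY (f₁ a₁) (f₂ a₄)))
        (Unique-++ u₁ (Unique-++ u₂ u₃ λ p q → YZ (f₂ p) (f₃ q))
          λ p q → ++-elim ys q (λ r → XY (f₁ p) (f₂ r)) (λ r → XZ (f₁ p) (f₃ r)))
        (trans (length-++ xs) (trans (cong₂ _+_ l₁ (trans (length-++ ys) (cong (_+ 3) l₂)))
          (linear-≡ 1 (λ j → (# 4 ⊕ j) ⊕ ((# 4 ⊕ j) ⊕ # 3) :≤ # 1 ⊕ 2 ⊛ (# 5 ⊕ j)) (j ∷ []))))
        λ p → ++-elim xs p (λ q → PX (f₁ q)) (λ q → ++-elim ys q (λ r → PY (f₂ r)) (λ r → PZ (f₃ r)))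
      where
      a₁ : ∀ {a : V} {as} → a ∈ a ∷ as
      a₁ = here refl
      a₂ : ∀ {a b : V} {as} → a ∈ b ∷ a ∷ as
      a₂ = there a₁
      a₃ : ∀ {a b d : V} {as} → a ∈ b ∷ d ∷ a ∷ as
      a₃ = there a₂
      a₄ : ∀ {a b d e : V} {as} → a ∈ b ∷ d ∷ e ∷ a ∷ as
      a₄ = there a₃
      xz : ∀ {a b} → a ∈ xs → b ∈ zs → E α a b
      xz p q = hXZ (f₁ p) (f₃ q)
      yz : ∀ {a b} → a ∈ ys → b ∈ zs → E α a b
      yz p q = hYZ (f₂ p) (f₃ q)

  module Finish (6≤k : 6 ≤ k) (noRed : NoRed) (noWheel : NoWheel) (T : Tripartite) where
    open Tripartite T

    1≤k : 1 ≤ k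
    1≤k = ≤-trans (s≤s z≤n) 6≤k

    Blues : V → List V → Set
    Blues h X = ∀ {x} → x ∈ X → BlueNbr h x

    -- Of two vertices joined in blue to each other and to a blue K_{k,k}, one is the hub and the
    -- other the odd vertex of the rim.
    wheel : ∀ {h w X Y} → Unique X → Unique Y → (∀ {x} → x ∈ X → x ∉ Y) → Complete blue X Y →
      k ≤ length X → k ≤ length Y → w ∉ X → w ∉ Y →
      BlueNbr h w → Blues h X → Blues h Y → Blues w X → Blues w Y → ⊥
    wheel {X = []} _ _ _ _ l _ _ _ _ _ _ _ _ = 1≰0 (≤-trans 1≤k l)
    wheel {X = _ ∷ _} {[]} _ _ _ _ _ l _ _ _ _ _ _ _ = 1≰0 (≤-trans 1≤k l)
    wheel {h} {X = e ∷ X} {o ∷ Y} uX uY d h' lX lY w∉X w∉Y hw hX hY wX wY =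
      noWheel h (odd-cycle 1≤k uX uY d h' lX lY w∉X w∉Y (here refl) (here refl)
        (proj₂ (wX (here refl))) (proj₂ (wY (here refl))) hw hX hY)

    module Two (i : Fin 3) where
      j j' : Fin 3
      j = next₃ i
      j' = prev₃ i
      j≢i = proj₁ (neighbours₃ i)
      j'≢i = proj₁ (proj₂ (neighbours₃ i))
      j≢j' = proj₂ (proj₂ (neighbours₃ i))

    cross-blue : ∀ {i j u} → i ≢ j → u ∈ K i → Blues u (K j)
    cross-blue i≢j p q = (λ { refl → K-disjoint i≢j p q }) , K-blue i≢j p q

    K-clique : ∀ i → Clique red (K i)
    K-clique i {u} {v} p q u≢v with E? red u v
    ... | yes e = e
    ... | no ¬e = ⊥-elim (wheel (K-unique j) (K-unique j') (K-disjoint j≢j') (K-blue j≢j')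
        (≤-trans (n≤1+n k) (K-size j)) (≤-trans (n≤1+n k) (K-size j'))
        (K-disjoint (j≢i ∘ sym) q) (K-disjoint (j'≢i ∘ sym) q) (u≢v , not-E ¬e)
        (cross-blue (j≢i ∘ sym) p) (cross-blue (j'≢i ∘ sym) p)
        (cross-blue (j≢i ∘ sym) q) (cross-blue (j'≢i ∘ sym) q))
      where open Two i

    reds blues : V → Fin 3 → List V
    reds x i = filter (E? red x) (K i)
    blues x i = filter (E? blue x) (K i)

    reds+blues : ∀ x i → suc k ≤ length (reds x i) + length (blues x i)
    reds+blues x i = ≤-trans (K-size i) (subst (length (K i) ≤_) (length-++ (reds x i)) (card (K-unique i) sub))
      where
      sub : K i ⊑ reds x i ++ blues x i
      sub {y} p with E? red x y
      ... | yes e = ∈-++⁺ˡ (∈-filter⁺ (E? red x) p e)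
      ... | no ¬e = ∈-++⁺ʳ (reds x i) (∈-filter⁺ (E? blue x) p (not-E ¬e))

    Assigned : V → Set
    Assigned x = ∃ λ i → x ∈ K i ⊎ (∀ j → x ∉ K j) × 3 ≤ length (reds x i)

    -- Otherwise `x` has at least k - 1 blue neighbours in every part, and `tripartite-cycle` makes
    -- a rim around `x` out of them. Three red neighbours are what `Blob.foot` requires, which has
    -- to avoid two vertices.
    many-reds : ∀ x → (∀ j → x ∉ K j) → ∃ λ i → 3 ≤ length (reds x i)
    many-reds x x∉ with any? (λ i → 3 ≤? length (reds x i))
    ... | yes r = r
    ... | no none = ⊥-elim (noWheel x (tripartite-cycle 6≤k (uB zero) (uB (suc zero)) (uB (suc (suc zero)))
        (enough zero) (enough (suc zero)) (≤-trans (s≤s (s≤s (s≤s z≤n))) (≤-pred (≤-trans 6≤k (enough (suc (suc zero))))))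
        (disj λ ()) (disj λ ()) (disj λ ()) (comp λ ()) (comp λ ()) (comp λ ())
        (nbr zero) (nbr (suc zero)) (nbr (suc (suc zero)))))
      where
      uB : ∀ i → Unique (blues x i)
      uB i = Uniq.filter⁺ (E? blue x) (K-unique i)
      mem : ∀ i {y} → y ∈ blues x i → y ∈ K i
      mem i p = proj₁ (∈-filter⁻ (E? blue x) {xs = K i} p)
      enough : ∀ i → k ≤ suc (length (blues x i))
      enough i = lin 3 (λ k r b → (# 1 ⊕ k :≤ r ⊕ b) ∷ (# 1 ⊕ r :≤ # 3) ∷ [] ⊢ k :≤ # 1 ⊕ b)
        (k ∷ length (reds x i) ∷ length (blues x i) ∷ []) (reds+blues x i , ≰⇒> (λ r → none (i , r)))
      disj : ∀ {i j} → i ≢ j → ∀ {y} → y ∈ blues x i → y ∉ blues x j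
      disj {i} {j} i≢j p q = K-disjoint i≢j (mem i p) (mem j q)
      comp : ∀ {i j} → i ≢ j → Complete blue (blues x i) (blues x j)
      comp {i} {j} i≢j p q = K-blue i≢j (mem i p) (mem j q)
      nbr : ∀ i {y} → y ∈ blues x i → BlueNbr x y
      nbr i p = (λ { refl → x∉ i (mem i p) }) , proj₂ (∈-filter⁻ (E? blue x) {xs = K i} p)

    abstract
      assign : ∀ x → Assigned x
      assign x with any? (λ i → x ∈? K i)
      ... | yes (i , p) = i , inj₁ p
      ... | no none with many-reds x (λ j p → none (j , p))
      ...   | i , r = i , inj₂ ((λ j p → none (j , p)) , r)

    cls : V → Fin 3
    cls x = proj₁ (assign x)

    cls-K : ∀ {i x} → x ∈ K i → cls x ≡ i
    cls-K {i} {x} p with assign x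
    ... | j , inj₂ (x∉ , _) = ⊥-elim (x∉ i p)
    ... | j , inj₁ q with j ≟ i
    ...   | yes e = e
    ...   | no j≢i = ⊥-elim (K-disjoint j≢i q p)

    blob : ∀ i → Blob red (suc k) (λ x → cls x ≡ i)
    blob i = record
      { K = K i ; K-unique = K-unique i ; K-size = K-size i ; K-clique = K-clique i ; K⊂Q = cls-K
      ; foot = foot }
      where
      foot : ∀ {a} → cls a ≡ i → a ∉ K i → ∀ p q → ∃ λ g → g ∈ K i × E red a g × g ≢ p × g ≢ q
      foot {a} e a∉ p q with assign a
      foot {a} refl a∉ p q | i , inj₁ r = ⊥-elim (a∉ r)
      foot {a} refl a∉ p q | i , inj₂ (_ , r)
        with pick {as = p ∷ q ∷ []} (Uniq.filter⁺ (E? red a) (K-unique i)) r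
      ... | g , m , av = g , proj₁ (∈-filter⁻ (E? red a) {xs = K i} m) , proj₂ (∈-filter⁻ (E? red a) {xs = K i} m)
        , (λ e → av (here e)) , (λ e → av (there (here e)))

    Cross : Fin 3 → V → V → Set
    Cross l a b = cls a ≡ next₃ l × cls b ≡ prev₃ l × E red a b

    Cross? : ∀ l a b → Dec (Cross l a b)
    Cross? l a b = (cls a ≟ next₃ l) ×-dec ((cls b ≟ prev₃ l) ×-dec E? red a b)

    crossing : ∀ l {a b a' b'} → Cross l a b → Cross l a' b' → a ≢ a' → b ≢ b' → ⊥
    crossing l (p , q , e) (p' , q' , e') a≢ b≢ =
      noRed (two-blobs (≤-trans (s≤s (s≤s (s≤s (s≤s z≤n)))) 6≤k) (blob (next₃ l)) (blob (prev₃ l))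
        (λ r s → proj₂ (proj₂ (neighbours₃ l)) (trans (sym r) s)) p q e p' q' e' a≢ b≢)

    K-point : ∀ i → ∃ λ x → x ∈ K i
    K-point i with K i | K-size i
    ... | [] | ()
    ... | x ∷ _ | _ = x , here refl

    abstract
      -- A centre of class `l` lies on no edge between the two other classes, so then there are no
      -- such edges and it can be exchanged. That the class differs from `l` is used in `leak`.
      centre : ∀ l → ∃ λ z → cls z ≢ l × (∀ {a b} → Cross l a b → a ≡ z ⊎ b ≡ z)
      centre l with star (Cross l) (Cross? l) (crossing l) (proj₁ (K-point l))
      ... | z , hit with cls z ≟ l
      ...   | no z≢ = z , z≢ , hit
      ...   | yes z≡ = proj₁ (K-point (next₃ l))
              , (λ e → proj₁ (neighbours₃ l) (trans (sym (cls-K (proj₂ (K-point (next₃ l))))) e))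
              , λ {a} {b} r → ⊥-elim ([ (λ { refl → proj₁ (neighbours₃ l) (trans (sym (proj₁ r)) z≡) })
                                      , (λ { refl → proj₁ (proj₂ (neighbours₃ l)) (trans (sym (proj₁ (proj₂ r))) z≡) }) ] (hit r))

    z : Fin 3 → V
    z l = proj₁ (centre l)

    z-class : ∀ l → cls (z l) ≢ l
    z-class l = proj₁ (proj₂ (centre l))

    hit : ∀ {l a b} → Cross l a b → a ≡ z l ⊎ b ≡ z l
    hit {l} = proj₂ (proj₂ (centre l))

    -- Such an edge would survive if `U₀` consisted of the centres belonging to the two other pairs
    -- of classes.
    Missed : Fin 3 → Set
    Missed l = ∃ λ a → ∃ λ b → Cross l a b × ((a ≢ z (next₃ l) × b ≢ z (next₃ l)) × (a ≢ z (prev₃ l) × b ≢ z (prev₃ l)))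

    Missed? : ∀ l → Dec (Missed l)
    Missed? l = any? λ a → any? λ b → Cross? l a b ×-dec
      ((¬? (a ≟ z (next₃ l)) ×-dec ¬? (b ≟ z (next₃ l))) ×-dec (¬? (a ≟ z (prev₃ l)) ×-dec ¬? (b ≟ z (prev₃ l))))

    triangle : ∀ {r s t a₀ b₀ a₁ b₁ a₂ b₂} →
      Link red (λ x → cls x ≡ zero) r b₁ a₂ → Link red (λ x → cls x ≡ suc zero) s b₂ a₀ →
      Link red (λ x → cls x ≡ suc (suc zero)) t b₀ a₁ →
      E red a₀ b₀ → E red a₁ b₁ → E red a₂ b₂ → (r + s) + t ≡ suc (2 * k) → ⊥
    triangle L₀ L₁ L₂ e₀ e₁ e₂ eq = noRed (subst (λ n → Cycle red n Anywhere) eq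
      (two-links (link-++ L₀ L₁ (λ p q → 0≢1 (trans (sym p) q)) e₂) L₂
        (λ { (inj₁ p) q → 0≢2 (trans (sym p) q) ; (inj₂ p) q → 1≢2 (trans (sym p) q) }) e₀ e₁))
      where
      0≢1 : zero ≢ suc {2} zero
      0≢1 ()
      0≢2 : zero ≢ suc {2} (suc zero)
      0≢2 ()
      1≢2 : suc {2} zero ≢ suc (suc zero)
      1≢2 ()

    not-all-missed : Missed zero → Missed (suc zero) → Missed (suc (suc zero)) → ⊥
    not-all-missed (a₀ , b₀ , r₀@(p₀ , q₀ , e₀) , (m₁ , m₂) , (m₃ , m₄))
                   (a₁ , b₁ , r₁@(p₁ , q₁ , e₁) , (n₁ , n₂) , (n₃ , n₄))
                   (a₂ , b₂ , r₂@(p₂ , q₂ , e₂) , (o₁ , o₂) , (o₃ , o₄)) =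
      go (b₁ ≟ a₂) (b₂ ≟ a₀) (b₀ ≟ a₁)
      where
      j : ℕ
      j = proj₁ (m≤n⇒∃[o]m+o≡n 6≤k)
      j-eq : 6 + j ≡ k
      j-eq = proj₂ (m≤n⇒∃[o]m+o≡n 6≤k)
      k≥ : 6 + j ≤ k
      k≥ = ≤-reflexive j-eq
      lk : ∀ i t {a b} → 4 + t ≤ suc k → cls a ≡ i → cls b ≡ i → a ≢ b → Link red (λ x → cls x ≡ i) (4 + t) a b
      lk i t h = link (blob i) t h
      four : 4 + 0 ≤ suc k
      four = lin 2 (λ k j → (# 6 ⊕ j :≤ k) ∷ [] ⊢ # 4 :≤ # 1 ⊕ k) (k ∷ j ∷ []) k≥
      k-2 : 4 + j ≤ suc k
      k-2 = lin 2 (λ k j → (# 6 ⊕ j :≤ k) ∷ [] ⊢ # 4 ⊕ j :≤ # 1 ⊕ k) (k ∷ j ∷ []) k≥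
      k-1 : 5 + j ≤ suc k
      k-1 = lin 2 (λ k j → (# 6 ⊕ j :≤ k) ∷ [] ⊢ # 5 ⊕ j :≤ # 1 ⊕ k) (k ∷ j ∷ []) k≥
      k-0 : 6 + j ≤ suc k
      k-0 = lin 2 (λ k j → (# 6 ⊕ j :≤ k) ∷ [] ⊢ # 6 ⊕ j :≤ # 1 ⊕ k) (k ∷ j ∷ []) k≥
      total-length : ∀ {n} → n ≡ suc (2 * (6 + j)) → n ≡ suc (2 * k)
      total-length e = trans e (cong (λ t → suc (2 * t)) j-eq)
      go : Dec (b₁ ≡ a₂) → Dec (b₂ ≡ a₀) → Dec (b₀ ≡ a₁) → ⊥
      -- A proper link has at least four vertices: 4 + (k - 2) + (k - 1) = 2k + 1. In the next three
      -- cases one link shrinks to a single vertex, and 1 + k + k gives the same total.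
      go (no x) (no y) (no w) =
        triangle (lk _ 0 four q₁ p₂ x) (lk _ j k-2 q₂ p₀ y) (lk _ (suc j) k-1 q₀ p₁ w) e₀ e₁ e₂
          (total-length (linear-≡ 1 (λ j → (# 8 ⊕ j) ⊕ (# 5 ⊕ j) :≤ # 1 ⊕ 2 ⊛ (# 6 ⊕ j)) (j ∷ [])))
      go (yes refl) (no y) (no w) =
        triangle (link-one _ q₁) (lk _ (2 + j) k-0 q₂ p₀ y) (lk _ (2 + j) k-0 q₀ p₁ w) e₀ e₁ e₂
          (total-length (linear-≡ 1 (λ j → # 1 ⊕ (# 6 ⊕ j) ⊕ (# 6 ⊕ j) :≤ # 1 ⊕ 2 ⊛ (# 6 ⊕ j)) (j ∷ [])))
      go (no x) (yes refl) (no w) =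
        triangle (lk _ (2 + j) k-0 q₁ p₂ x) (link-one _ q₂) (lk _ (2 + j) k-0 q₀ p₁ w) e₀ e₁ e₂
          (total-length (linear-≡ 1 (λ j → ((# 6 ⊕ j) ⊕ # 1) ⊕ (# 6 ⊕ j) :≤ # 1 ⊕ 2 ⊛ (# 6 ⊕ j)) (j ∷ [])))
      go (no x) (no y) (yes refl) =
        triangle (lk _ (2 + j) k-0 q₁ p₂ x) (lk _ (2 + j) k-0 q₂ p₀ y) (link-one _ q₀) e₀ e₁ e₂
          (total-length (linear-≡ 1 (λ j → ((# 6 ⊕ j) ⊕ (# 6 ⊕ j)) ⊕ # 1 :≤ # 1 ⊕ 2 ⊛ (# 6 ⊕ j)) (j ∷ [])))
      -- Two coincident ends would have to be the two ends of a single edge, one of which is its centre.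
      go (yes refl) (yes refl) _ = [ n₂ , m₃ ] (hit r₂)
      go (yes refl) (no _) (yes refl) = [ m₂ , o₃ ] (hit r₁)
      go (no _) (yes refl) (yes refl) = [ o₂ , n₃ ] (hit r₀)

    abstract
      covered : ∃ λ l → ¬ Missed l
      covered = choose (Missed? zero) (Missed? (suc zero)) (Missed? (suc (suc zero)))
        where
        choose : Dec (Missed zero) → Dec (Missed (suc zero)) → Dec (Missed (suc (suc zero))) → ∃ λ l → ¬ Missed l
        choose (no m) _ _ = zero , m
        choose (yes _) (no m) _ = suc zero , m
        choose (yes _) (yes _) (no m) = suc (suc zero) , m
        choose (yes m₀) (yes m₁) (yes m₂) = ⊥-elim (not-all-missed m₀ m₁ m₂)

    partition-from : ∀ l → ¬ Missed l → Partition
    partition-from l unmissed = record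
      { part = part
      ; exceptional = ≤-trans (card {ys = z m ∷ z m' ∷ []} (Uniq.filter⁺ (λ v → part v ≟ zero) vertices-unique)
          (λ {x} p → zero-part x (proj₂ (∈-filter⁻ (λ v → part v ≟ zero) {xs = vertices} p)))) ≤-refl
      ; small = small
      ; colours = λ u v u≢v pu pv → same u≢v (outside pu) (outside pv) , different (outside pu) (outside pv) }
      where
      m m' : Fin 3
      m = next₃ l
      m' = prev₃ l
      U : List V
      U = z m ∷ z m' ∷ []
      part : V → Fin 4
      part v with v ∈? U
      ... | yes _ = zero
      ... | no _ = suc (cls v)
      zero-part : ∀ v → part v ≡ zero → v ∈ U
      zero-part v e with v ∈? U
      ... | yes p = p
      zero-part v () | no _
      outside : ∀ {v} → part v ≢ zero → v ∉ U × part v ≡ suc (cls v)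
      outside {v} h with v ∈? U
      ... | yes _ = ⊥-elim (h refl)
      ... | no p = p , refl
      centre-in-U : ∀ {p} → p ≢ l → z p ∈ U
      centre-in-U {p} p≢l with p ≟ m
      ... | yes refl = here refl
      ... | no p≢m = there (here (cong z (trans (third-only l m p (proj₁ (neighbours₃ l) ∘ sym) p≢l p≢m)
          (sym (third-only l m m' (proj₁ (neighbours₃ l) ∘ sym) (proj₁ (proj₂ (neighbours₃ l))) (proj₂ (proj₂ (neighbours₃ l)) ∘ sym))))))
      not-missed : ∀ {a b} → Cross l a b → a ∉ U → b ∉ U → ⊥
      not-missed r a∉ b∉ = unmissed (_ , _ , r , ((λ e → a∉ (here e)) , (λ e → b∉ (here e)))
        , ((λ e → a∉ (there (here e))) , (λ e → b∉ (there (here e)))))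
      no-cross : ∀ {p a b} → Cross p a b → a ∉ U → b ∉ U → ⊥
      no-cross {p} r a∉ b∉ with p ≟ l
      ... | yes refl = not-missed r a∉ b∉
      ... | no p≢l = [ (λ q → a∉ (subst (_∈ U) (sym q) (centre-in-U p≢l))) , (λ q → b∉ (subst (_∈ U) (sym q) (centre-in-U p≢l))) ] (hit r)
      oriented : ∀ {a b} → cls a ≢ cls b → E red a b → ∃ λ p → p ≢ cls a × p ≢ cls b × (Cross p a b ⊎ Cross p b a)
      oriented {a} {b} a≢b e with third-≢ (cls a) (cls b) a≢b
      ... | x , y with pair₃ (third (cls a) (cls b)) (cls a) (cls b) a≢b x y
      ...   | inj₁ (p , q) = _ , x , y , inj₁ (p , q , e)
      ...   | inj₂ (p , q) = _ , x , y , inj₂ (q , p , E-sym e)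
      different : ∀ {u v} → u ∉ U × part u ≡ suc (cls u) → v ∉ U × part v ≡ suc (cls v) →
        part u ≢ part v → c u v ≡ blue
      different {u} {v} (u∉ , pu) (v∉ , pv) h with E? red u v
      ... | no ¬e = not-E ¬e
      ... | yes e with oriented (λ q → h (trans pu (trans (cong suc q) (sym pv)))) e
      ...   | _ , _ , _ , inj₁ r = ⊥-elim (no-cross r u∉ v∉)
      ...   | _ , _ , _ , inj₂ r = ⊥-elim (no-cross r v∉ u∉)
      -- If the centre for the classes `i` and `j` is in `U`, it is not `u`, so it is the other end
      -- of the edge. Otherwise the edge still meets `U`, hence `x` is in `U`; as `z j` is not of
      -- class `j`, it must be `z i`. The vertex `e` depends on the classes only, so in `same-class`
      -- one deletion from each part serves both vertices.
      leak : ∀ i j → i ≢ j → ∃ λ e → ∀ {u x} → u ∉ U → cls u ≡ i → x ∈ K j → E red u x → x ≡ e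
      leak i j i≢j with third i j ≟ l
      ... | no t≢l = z (third i j) , λ {u} {x} u∉ cu x∈ e → go u∉ cu (cls-K x∈) e
        where
        go : ∀ {u x} → u ∉ U → cls u ≡ i → cls x ≡ j → E red u x → x ≡ z (third i j)
        go {u} {x} u∉ refl refl e with third-≢ i j i≢j
        ... | a , b with pair₃ (third i j) i j i≢j a b
        ...   | inj₁ (p , q) = [ (λ q → ⊥-elim (u∉ (subst (_∈ U) (sym q) (centre-in-U t≢l)))) , id ] (hit (p , q , e))
        ...   | inj₂ (p , q) = [ id , (λ q → ⊥-elim (u∉ (subst (_∈ U) (sym q) (centre-in-U t≢l)))) ] (hit (q , p , E-sym e))
      ... | yes refl = z i , λ {u} {x} u∉ cu x∈ e → go u∉ cu (cls-K x∈) e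
        where
        inU : ∀ {x} → x ∈ U → cls x ≡ j → x ≡ z i
        inU {x} x∈ cx with pair₃ (third i j) i j i≢j (proj₁ (third-≢ i j i≢j)) (proj₂ (third-≢ i j i≢j))
        inU (here refl) cx | inj₁ (p , q) = cong z (sym p)
        inU (there (here refl)) cx | inj₁ (p , q) = ⊥-elim (z-class (prev₃ l) (trans cx q))
        inU (here refl) cx | inj₂ (p , q) = ⊥-elim (z-class (next₃ l) (trans cx q))
        inU (there (here refl)) cx | inj₂ (p , q) = cong z (sym p)
        go : ∀ {u x} → u ∉ U → cls u ≡ i → cls x ≡ j → E red u x → x ≡ z i
        go {u} {x} u∉ refl refl e with x ∈? U
        ... | yes x∈ = inU x∈ refl
        ... | no x∉ with pair₃ (third i j) i j i≢j (proj₁ (third-≢ i j i≢j)) (proj₂ (third-≢ i j i≢j))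
        ...   | inj₁ (p , q) = ⊥-elim (not-missed (p , q , e) u∉ x∉)
        ...   | inj₂ (p , q) = ⊥-elim (not-missed (q , p , E-sym e) x∉ u∉)
      same-class : ∀ {u v} → u ≢ v → u ∉ U → v ∉ U → cls u ≡ cls v → E red u v
      same-class {u} {v} u≢v u∉ v∉ cu with E? red u v
      ... | yes e = e
      ... | no ¬e = ⊥-elim (wheel (Unique-∖ (K-unique j)) (Unique-∖ (K-unique j'))
          (λ p q → K-disjoint j≢j' (proj₁ (∖⁻ (K j) _ p)) (proj₁ (∖⁻ (K j') _ q)))
          (λ p q → K-blue j≢j' (proj₁ (∖⁻ (K j) _ p)) (proj₁ (∖⁻ (K j') _ q)))
          (long j _) (long j' _) (∉K v refl (j≢i ∘ sym)) (∉K v refl (j'≢i ∘ sym)) (u≢v , not-E ¬e)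
          (bl u u∉ cu (j≢i ∘ sym)) (bl u u∉ cu (j'≢i ∘ sym)) (bl v v∉ refl (j≢i ∘ sym)) (bl v v∉ refl (j'≢i ∘ sym)))
        where
        i = cls v
        open Two i
        long : ∀ j e → k ≤ length (K j ∖ (e ∷ []))
        long j e = ≤-pred (≤-trans (K-size j) (subst (length (K j) ≤_) (+-comm _ 1) (card-∖ (e ∷ []) (K-unique j))))
        ∉K : ∀ w {j e} → cls w ≡ i → i ≢ j → w ∉ K j ∖ (e ∷ [])
        ∉K w {j} cw i≢j p = i≢j (trans (sym cw) (cls-K (proj₁ (∖⁻ (K j) _ p))))
        bl : ∀ w → w ∉ U → cls w ≡ i → ∀ {j} (i≢j : i ≢ j) → Blues w (K j ∖ (proj₁ (leak i j i≢j) ∷ []))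
        bl w w∉ cw {j} i≢j {x} p = (λ { refl → ∉K w cw i≢j p }) ,
          not-E (λ e → proj₂ (∖⁻ (K j) _ p) (here (proj₂ (leak i j i≢j) w∉ cw (proj₁ (∖⁻ (K j) _ p)) e)))
      same : ∀ {u v} → u ≢ v → u ∉ U × part u ≡ suc (cls u) → v ∉ U × part v ≡ suc (cls v) →
        part u ≡ part v → c u v ≡ red
      same u≢v (u∉ , pu) (v∉ , pv) e = same-class u≢v u∉ v∉ (suc-inj (trans (sym pu) (trans e pv)))
        where
        suc-inj : ∀ {a b : Fin 3} → suc a ≡ Fin.suc b → a ≡ b
        suc-inj refl = refl
      small : ∀ i → i ≢ zero → classSize part i ≤ 2 * k
      small i i≢0 with suc (2 * k) ≤? classSize part i
      ... | no h = ≤-pred (≰⇒> h)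
      ... | yes h = ⊥-elim (noRed (clq h))
        where
        C = filter (λ v → part v ≟ i) vertices
        mem : ∀ {v} → v ∈ C → part v ≡ i
        mem p = proj₂ (∈-filter⁻ (λ v → part v ≟ i) {xs = vertices} p)
        ok : ∀ {v} → v ∈ C → v ∉ U × part v ≡ suc (cls v)
        ok p = outside (λ e → i≢0 (trans (sym (mem p)) e))
        clq : suc (2 * k) ≤ length C → Cycle red (suc (2 * k)) Anywhere
        clq h = big-clique 1≤k (λ p q u≢v → same u≢v (ok p) (ok q) (trans (mem p) (sym (mem q))))
          (Uniq.filter⁺ (λ v → part v ≟ i) vertices-unique) h λ _ → tt

    partition : Partition
    partition = partition-from (proj₁ covered) (proj₂ covered)

-- Lengthening monochromatic cycles

half : ∀ L → 3 ≤ L → ∃ λ i → 1 ≤ i × (L ≡ suc (2 * i) ⊎ L ≡ suc (suc (2 * i)))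
half (suc (suc (suc zero))) _ = 1 , s≤s z≤n , inj₁ refl
half (suc (suc (suc (suc zero)))) _ = 1 , s≤s z≤n , inj₂ refl
half (suc (suc (suc (suc (suc L))))) _ with half (suc (suc (suc L))) (s≤s (s≤s (s≤s z≤n)))
... | i , p , inj₁ e = suc i , s≤s z≤n , inj₁ (trans (cong (2 +_) e) (cong (2 +_) (sym (+-suc i (i + 0)))))
... | i , p , inj₂ e = suc i , s≤s z≤n , inj₂ (trans (cong (2 +_) e) (cong (3 +_) (sym (+-suc i (i + 0)))))
half zero ()
half (suc zero) (s≤s ())
half (suc (suc zero)) (s≤s (s≤s ()))

suc-% : ∀ j n → suc j % suc n ≡ suc (j % suc n) % suc n
suc-% j n = trans (cong (λ t → suc t % suc n) (m≡m%n+[m/n]*n j (suc n))) ([m+kn]%n≡m%n (suc (j % suc n)) (j / suc n) (suc n))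

module Segments {N : ℕ} (c : Colouring N) (c-sym : Symmetric c) {α : Colour} (f : ℕ → Fin N) (n : ℕ)
    (edge : ∀ {i} → i < n → c (f i) (f (suc i)) ≡ α) (inj : ∀ {i j} → i ≤ n → j ≤ n → f i ≡ f j → i ≡ j) where
  open Graph c c-sym

  seg : ℕ → ℕ → List V
  seg a zero = f a ∷ []
  seg a (suc m) = f a ∷ seg (suc a) m

  seg-size : ∀ a m → length (seg a m) ≡ suc m
  seg-size a zero = refl
  seg-size a (suc m) = cong suc (seg-size (suc a) m)

  seg-path : ∀ a m → a + m ≤ n → HamPath α (f a) (f (a + m)) (seg a m)
  seg-path a zero h = subst (λ t → HamPath α (f a) (f t) (f a ∷ [])) (sym (+-identityʳ a)) (one (f a))
  seg-path a (suc m) h = join (one (f a)) (edge (≤-trans (s≤s (m≤m+n a m)) h'))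
      (subst (λ t → HamPath α (f (suc a)) (f t) (seg (suc a) m)) (sym (+-suc a m)) (seg-path (suc a) m h'))
    where
    h' : suc a + m ≤ n
    h' = subst (_≤ n) (+-suc a m) h

  seg⁻ : ∀ a m {x} → x ∈ seg a m → ∃ λ i → a ≤ i × i ≤ a + m × x ≡ f i
  seg⁻ a zero (here e) = a , ≤-refl , m≤m+n a 0 , e
  seg⁻ a (suc m) (here e) = a , ≤-refl , m≤m+n a (suc m) , e
  seg⁻ a (suc m) (there p) with seg⁻ (suc a) m p
  ... | i , h , h' , e = i , ≤-trans (n≤1+n a) h , subst (i ≤_) (sym (+-suc a m)) h' , e

  seg⁺ : ∀ a m {i} → a ≤ i → i ≤ a + m → f i ∈ seg a m
  seg⁺ a zero {i} h h' = here (cong f (≤-antisym (subst (i ≤_) (+-identityʳ a) h') h))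
  seg⁺ a (suc m) {i} h h' with m≤n⇒m<n∨m≡n h
  ... | inj₂ e = here (cong f (sym e))
  ... | inj₁ a<i = there (seg⁺ (suc a) m a<i (subst (i ≤_) (+-suc a m) h'))

  seg-unique : ∀ a m → a + m ≤ n → Unique (seg a m)
  seg-unique a zero h = Unique-[] (f a)
  seg-unique a (suc m) h = Unique-cons fresh (seg-unique (suc a) m h')
    where
    h' : suc a + m ≤ n
    h' = subst (_≤ n) (+-suc a m) h
    fresh : f a ∉ seg (suc a) m
    fresh p with seg⁻ (suc a) m p
    ... | i , l , u , e = <-irrefl (inj (≤-trans (m≤m+n a (suc m)) h) (≤-trans u h') e) l

  seg-∉ : ∀ {i} a m → a + m ≤ n → i ≤ n → (i < a ⊎ a + m < i) → f i ∉ seg a m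
  seg-∉ a m h i≤n o p with seg⁻ a m p
  ... | j , l , u , e with inj i≤n (≤-trans u h) e
  ...   | refl = [ (λ q → <⇒≱ q l) , (λ q → <⇒≱ q u) ] o

  seg-disjoint : ∀ a m b l → a + m ≤ n → b + l ≤ n → a + m < b → ∀ {x} → x ∈ seg a m → x ∉ seg b l
  seg-disjoint a m b l h h' o p q with seg⁻ a m p | seg⁻ b l q
  ... | i , _ , u , refl | j , l' , u' , e with inj (≤-trans u h) (≤-trans u' h') e
  ...   | refl = <⇒≱ (≤-trans (s≤s u) o) l'

module _ {N : ℕ} (c : Colouring N) (c-sym : Symmetric c) where
  open Graph c c-sym

  -- A cycle of length L as a sequence of period L.
  record Round (α : Colour) (L : ℕ) (S : List V) : Set where
    field
      F : ℕ → V
      adj : ∀ i → E α (F i) (F (suc i))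
      per : ∀ i → F (i + L) ≡ F i
      inj : ∀ {i j} → i < L → j < L → F i ≡ F j → i ≡ j
      on : ∀ i → F i ∈ S
      onto : ∀ {x} → x ∈ S → ∃ λ i → i < L × F i ≡ x

  round : ∀ {α S n} → HamCycle α S → Unique S → length S ≡ suc n → Round α (suc n) S
  round {α} {S} {n} (u , v , p , e) uS h = record
    { F = λ i → L.f (i % suc n)
    ; adj = adj
    ; per = λ i → cong L.f ([m+n]%n≡m%n i (suc n))
    ; inj = λ {i} {j} i< j< q → trans (sym (m<n⇒m%n≡m i<)) (trans (L.inj (b i) (b j) q) (m<n⇒m%n≡m j<))
    ; on = λ i → L.on (b i)
    ; onto = onto }
    where
    module L = Line (line p uS h)
    b : ∀ i → i % suc n ≤ n
    b i = ≤-pred (m%n<n i (suc n))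
    adj : ∀ i → E α (L.f (i % suc n)) (L.f (suc i % suc n))
    adj i with i % suc n <? n
    ... | yes i<n = trans (cong (c (L.f (i % suc n)) ∘ L.f)
                      (trans (suc-% i n) (m<n⇒m%n≡m (s≤s i<n)))) (L.edge i<n)
    ... | no i≮n = trans (cong₂ (λ a b → c (L.f a) (L.f b)) i≡n
                     (trans (suc-% i n) (trans (cong (λ a → suc a % suc n) i≡n) (n%n≡0 (suc n)))))
                     (trans (cong₂ c L.last L.first) e)
      where
      i≡n : i % suc n ≡ n
      i≡n = ≤-antisym (b i) (≮⇒≥ i≮n)
    onto : ∀ {x} → x ∈ S → ∃ λ i → i < suc n × L.f (i % suc n) ≡ x
    onto p with L.onto p
    ... | i , i≤ , q = i , s≤s i≤ , trans (cong L.f (m<n⇒m%n≡m (s≤s i≤))) q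

  rotate₁ : ∀ {α n S} → Round α (suc n) S → Round α (suc n) S
  rotate₁ {α} {n} {S} R = record
    { F = F ∘ suc ; adj = adj ∘ suc ; per = per ∘ suc ; inj = inj' ; on = on ∘ suc ; onto = onto' }
    where
    open Round R
    inj' : ∀ {i j} → i < suc n → j < suc n → F (suc i) ≡ F (suc j) → i ≡ j
    inj' {i} {j} (s≤s i≤) (s≤s j≤) e with m≤n⇒m<n∨m≡n i≤ | m≤n⇒m<n∨m≡n j≤
    ... | inj₁ i< | inj₁ j< = suc-injective (inj (s≤s i<) (s≤s j<) e)
    ... | inj₂ refl | inj₂ refl = refl
    ... | inj₂ refl | inj₁ j< = ⊥-elim (0≢1+n (inj (s≤s z≤n) (s≤s j<) (trans (sym (per 0)) e)))
    ... | inj₁ i< | inj₂ refl = ⊥-elim (0≢1+n (inj (s≤s z≤n) (s≤s i<) (trans (sym (per 0)) (sym e))))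
    onto' : ∀ {x} → x ∈ S → ∃ λ i → i < suc n × F (suc i) ≡ x
    onto' p with onto p
    ... | zero , _ , q = n , ≤-refl , trans (per 0) q
    ... | suc i , h , q = i , ≤-trans (n≤1+n _) h , q

  rotate : ∀ {α n S} (R : Round α (suc n) S) → ∀ p →
    Σ (Round α (suc n) S) λ R' → ∀ i → Round.F R' i ≡ Round.F R (p + i)
  rotate R zero = R , λ i → refl
  rotate R (suc p) with rotate (rotate₁ R) p
  ... | R' , e = R' , e

  module RoundSegments {α : Colour} {n : ℕ} {S : List V} (R : Round α (suc n) S) =
    Segments c c-sym {α} (Round.F R) n (λ {i} _ → Round.adj R i) (λ i≤ j≤ → Round.inj R (s≤s i≤) (s≤s j≤))

  -- Both colours are excluded together, because a cycle that cannot be lengthened in its own colour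
  -- produces longer cycles in the other.
  No : ℕ → Set
  No n = ∀ α → Cycle α n Anywhere → ⊥

  module Longer {α : Colour} {n : ℕ} {S : List V} (R : Round α (suc (suc n)) S) where
    open Round R
    open RoundSegments R

    close : E α (F (suc n)) (F 0)
    close = subst (λ t → E α (F (suc n)) t) (per 0) (adj (suc n))

    rim : HamPath α (F 1) (F 0) (seg 1 n ++ F 0 ∷ [])
    rim = join (seg-path 1 n ≤-refl) close (one (F 0))

    rim-unique : Unique (seg 1 n ++ F 0 ∷ [])
    rim-unique = Unique-++ (seg-unique 1 n ≤-refl) (Unique-[] _)
      λ { p (here refl) → seg-∉ 1 n ≤-refl z≤n (inj₁ (s≤s z≤n)) p }

    rim⊂S : (seg 1 n ++ F 0 ∷ []) ⊑ S
    rim⊂S p = ++-elim (seg 1 n) p (λ q → seg⊂S 1 n q) λ { (here refl) → on 0 }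
      where
      seg⊂S : ∀ a m {x} → x ∈ seg a m → x ∈ S
      seg⊂S a m q with seg⁻ a m q
      ... | i , _ , _ , refl = on i

    seg⊂ : ∀ a m → seg a m ⊑ S
    seg⊂ a m q with seg⁻ a m q
    ... | i , _ , _ , refl = on i

    rim-size : length (seg 1 n ++ F 0 ∷ []) ≡ suc (suc n)
    rim-size = trans (length-++ (seg 1 n)) (trans (+-comm _ 1) (cong suc (seg-size 1 n)))

    insert₁ : ∀ {x} → x ∉ S → E α x (F 0) → E α x (F 1) → Cycle α (suc (suc (suc n))) Anywhere
    insert₁ {x} x∉ e₀ e₁ = cycle (F 1 , x , join rim (E-sym e₀) (one x) , e₁)
      (Unique-++ rim-unique (Unique-[] x) λ { p (here refl) → x∉ (rim⊂S p) })
      (trans (length-++ (seg 1 n ++ F 0 ∷ [])) (trans (+-comm _ 1) (cong suc rim-size))) λ _ → tt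

    insert₂ : ∀ {x x'} → x ∉ S → x' ∉ S → x ≢ x' → E α x x' → E α x (F 0) → E α x' (F 1) →
      Cycle α (suc (suc (suc (suc n)))) Anywhere
    insert₂ {x} {x'} x∉ x'∉ x≢x' e e₀ e₁ = cycle (F 1 , x' , join rim (E-sym e₀) (join (one x) e (one x')) , e₁)
      (Unique-++ rim-unique (Unique-cons (λ { (here q) → x≢x' q }) (Unique-[] x'))
        λ { p (here refl) → x∉ (rim⊂S p) ; p (there (here refl)) → x'∉ (rim⊂S p) })
      (trans (length-++ (seg 1 n ++ F 0 ∷ [])) (trans (+-comm _ 2) (cong (2 +_) rim-size))) λ _ → tt

    -- x joins F 0 to F (m + 1) and x' joins F 1 to F (m + 2), with the arc between traversed backwards.
    insert₃ : ∀ {x x' m} → x ∉ S → x' ∉ S → x ≢ x' → m ≤ n →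
      E α x (F 0) → E α x (F (suc m)) → E α x' (F 1) → E α x' (F (suc (suc m))) →
      Cycle α (suc (suc (suc (suc n)))) Anywhere
    insert₃ {x} {x'} {m} x∉ x'∉ x≢x' m≤n e₀ e₁ e₂ e₃ with m≤n⇒m<n∨m≡n m≤n
    ... | inj₂ refl = cycle (F 0 , x' , join (one (F 0)) (E-sym e₀) (join (one x) e₁
            (join (rev (seg-path 1 n ≤-refl)) (E-sym e₂) (one x'))) , subst (E α x') (per 0) e₃)
          (Unique-cons (λ { (here q) → x∉ (subst (_∈ S) q (on 0))
                          ; (there p) → ++-elim (seg 1 n) p (seg-∉ 1 n ≤-refl z≤n (inj₁ (s≤s z≤n)))
                              λ { (here q) → x'∉ (subst (_∈ S) q (on 0)) } })
            (Unique-cons (λ p → ++-elim (seg 1 n) p (λ q → x∉ (seg⊂ 1 n q)) λ { (here q) → x≢x' q })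
              (Unique-++ (seg-unique 1 n ≤-refl) (Unique-[] x') λ { p (here refl) → x'∉ (seg⊂ 1 n p) })))
          (cong (2 +_) (trans (length-++ (seg 1 n)) (trans (+-comm _ 1) (cong suc (seg-size 1 n))))) λ _ → tt
    ... | inj₁ m<n = cycle (F 0 , F (suc n) , join (one (F 0)) (E-sym e₀) (join (one x) e₁
            (join (rev (seg-path 1 m (≤-trans (s≤s m≤n) ≤-refl))) (E-sym e₂) (join (one x') e₃ tail))) , close)
          (Unique-cons (λ { (here q) → x∉ (subst (_∈ S) q (on 0))
                          ; (there p) → ++-elim (seg 1 m) p (seg-∉ 1 m (s≤s m≤n) z≤n (inj₁ (s≤s z≤n)))
                              λ { (here q) → x'∉ (subst (_∈ S) q (on 0))
                                ; (there q) → seg-∉ (suc (suc m)) r tail≤ z≤n (inj₁ (s≤s z≤n)) q } })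
            (Unique-cons (λ p → ++-elim (seg 1 m) p (λ q → x∉ (seg⊂ 1 m q))
                λ { (here q) → x≢x' q ; (there q) → x∉ (seg⊂ _ r q) })
              (Unique-++ (seg-unique 1 m (s≤s m≤n))
                (Unique-cons (λ p → x'∉ (seg⊂ _ r p)) (seg-unique (suc (suc m)) r tail≤))
                λ { p (here refl) → x'∉ (seg⊂ 1 m p)
                  ; p (there q) → seg-disjoint 1 m (suc (suc m)) r (s≤s m≤n) tail≤ ≤-refl p q })))
          (cong (2 +_) (trans (length-++ (seg 1 m)) (trans (cong₂ (λ a b → a + suc b) (seg-size 1 m) (seg-size _ r))
            (trans (linear-≡ 2 (λ m r → # 1 ⊕ m ⊕ (# 2 ⊕ r) :≤ # 2 ⊕ (# 1 ⊕ m ⊕ r)) (m ∷ r ∷ [])) (cong (2 +_) r-eq))))) λ _ → tt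
      where
      r : ℕ
      r = proj₁ (m≤n⇒∃[o]m+o≡n m<n)
      r-eq : suc m + r ≡ n
      r-eq = proj₂ (m≤n⇒∃[o]m+o≡n m<n)
      tail≤ : suc (suc m) + r ≤ suc n
      tail≤ = ≤-reflexive (cong suc r-eq)
      tail : HamPath α (F (suc (suc m))) (F (suc n)) (seg (suc (suc m)) r)
      tail = subst (λ t → HamPath α (F (suc (suc m))) (F t) (seg (suc (suc m)) r)) (cong suc r-eq) (seg-path (suc (suc m)) r tail≤)

  -- Vertices off a cycle that cannot be lengthened

  module Up {k : ℕ} (M-size : 3 * k + 2 ≤ N) {α : Colour} {n : ℕ} {S : List V} (L≤ : suc (suc n) ≤ 2 * k)
            (no₁ : No (suc (suc (suc n)))) (no₂ : No (suc (suc (suc (suc n)))))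
            (R : Round α (suc (suc n)) S) (S-unique : Unique S) (S-size : length S ≡ suc (suc n)) where
    open Round R

    β : Colour
    β = op α

    L : ℕ
    L = suc (suc n)

    at-i : ∀ i → Σ (Round α L S) λ R' → Round.F R' 0 ≡ F i × Round.F R' 1 ≡ F (suc i)
    at-i i with rotate R i
    ... | R' , e = R' , trans (e 0) (cong F (+-identityʳ i)) , trans (e 1) (cong F (+-comm i 1))

    U₁ : ∀ {x} i → x ∉ S → E α x (F i) → E α x (F (suc i)) → ⊥
    U₁ {x} i x∉ e e' with at-i i
    ... | R' , p , q = no₁ α (Longer.insert₁ R' x∉ (subst (E α x) (sym p) e) (subst (E α x) (sym q) e'))

    U₂ : ∀ {x x'} i → x ∉ S → x' ∉ S → x ≢ x' → E α x x' → E α x (F i) → E α x' (F (suc i)) → ⊥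
    U₂ {x} {x'} i x∉ x'∉ x≢x' xx' e e' with at-i i
    ... | R' , p , q = no₂ α (Longer.insert₂ R' x∉ x'∉ x≢x' xx' (subst (E α x) (sym p) e) (subst (E α x') (sym q) e'))

    U₃ : ∀ {x x'} → x ∉ S → x' ∉ S → x ≢ x' → ∀ {i j} → i < j → j < L →
      E α x (F i) → E α x' (F (suc i)) → E α x (F j) → E α x' (F (suc j)) → ⊥
    U₃ {x} {x'} x∉ x'∉ x≢x' {i} {j} i<j j<L a b a' b' with rotate R i
    ... | R' , e = no₂ α (Longer.insert₃ R' {m = m} x∉ x'∉ x≢x' m≤n
        (subst (E α x) (sym (trans (e 0) (cong F (+-identityʳ i)))) a)
        (subst (E α x) (sym (trans (e (suc m)) (cong F eq))) a')
        (subst (E α x') (sym (trans (e 1) (cong F (+-comm i 1)))) b)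
        (subst (E α x') (sym (trans (e (suc (suc m))) (cong F (trans (+-suc i (suc m)) (cong suc eq))))) b'))
      where
      m : ℕ
      m = proj₁ (m≤n⇒∃[o]m+o≡n i<j)
      eq : i + suc m ≡ j
      eq = trans (+-suc i m) (proj₂ (m≤n⇒∃[o]m+o≡n i<j))
      m≤n : m ≤ n
      m≤n = lin 4 (λ i m j n → (i ⊕ (# 1 ⊕ m) :≤ j) ∷ (# 1 ⊕ j :≤ # 2 ⊕ n) ∷ [] ⊢ m :≤ n) (i ∷ m ∷ j ∷ n ∷ []) (≤-reflexive eq , j<L)

    X : List V
    X = vertices ∖ S

    X-unique : Unique X
    X-unique = Unique-∖ vertices-unique

    X∉S : ∀ {x} → x ∈ X → x ∉ S
    X∉S p = proj₂ (∖⁻ vertices S p)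

    X-size : 3 * k + 2 ≤ length X + L
    X-size = ≤-trans M-size (subst (_≤ length X + L) vertices-size
      (subst (λ t → length vertices ≤ length X + t) S-size (card-∖ S vertices-unique)))

    common : V → V → List V
    common x x' = filter (λ v → E? β x v ×-dec E? β x' v) S

    common⁻ : ∀ {x x' v} → v ∈ common x x' → v ∈ S × E β x v × E β x' v
    common⁻ p = ∈-filter⁻ (λ v → E? β _ v ×-dec E? β _ v) {xs = S} p

    common-unique : ∀ x x' → Unique (common x x')
    common-unique x x' = Uniq.filter⁺ _ S-unique

    module Count {x x' : V} (x∉ : x ∉ S) (x'∉ : x' ∉ S) (x≢x' : x ≢ x') where

      Common : ℕ → Set
      Common i = E β x (F i) × E β x' (F i)

      Common? : ∀ i → Dec (Common i)
      Common? i = E? β x (F i) ×-dec E? β x' (F i)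

      Conflict? : ∀ y y' i → Dec (E α y (F i) × E α y' (F (suc i)))
      Conflict? y y' i = E? α y (F i) ×-dec E? α y' (F (suc i))

      I J₁ J₂ : List ℕ
      I = filter Common? (upTo L)
      J₁ = filter (Conflict? x x') (upTo L)
      J₂ = filter (Conflict? x' x) (upTo L)

      before : ℕ → ℕ
      before zero = suc n
      before (suc i) = i

      -- If neither `F i` nor `F (suc i)` is a common neighbour in colour β, each has an edge of
      -- colour α to `x` or `x'`. By `U₁` the two edges do not come from the same vertex, so they
      -- form a conflict. The list `map before I` collects the positions, modulo L, whose successor
      -- is common.
      classify : upTo L ⊑ I ++ (map before I ++ (J₁ ++ J₂))
      classify {i} p with Common? i
      ... | yes q = ∈-++⁺ˡ (∈-filter⁺ Common? p q)
      ... | no ¬q with Common? (suc i)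
      ...   | yes q = ∈-++⁺ʳ I (∈-++⁺ˡ (shifted (m≤n⇒m<n∨m≡n (∈-upTo⁻ p))))
        where
        shifted : (suc i < L ⊎ suc i ≡ L) → i ∈ map before I
        shifted (inj₁ h) = ∈-map⁺ before (∈-filter⁺ Common? (∈-upTo⁺ h) q)
        shifted (inj₂ refl) = ∈-map⁺ before (∈-filter⁺ Common? (∈-upTo⁺ (s≤s z≤n)) (subst (λ v → E β x v × E β x' v) (per 0) q))
      ...   | no ¬q' = ∈-++⁺ʳ I (∈-++⁺ʳ (map before I) (bad (E? α x (F i)) (E? α x (F (suc i)))))
        where
        other : ∀ {j} → ¬ Common j → ¬ E α x (F j) → E α x' (F j)
        other {j} ¬r ¬e with E? α x' (F j)
        ... | yes e = e
        ... | no ¬e' = ⊥-elim (¬r (not-E ¬e , not-E ¬e'))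
        bad : Dec (E α x (F i)) → Dec (E α x (F (suc i))) → i ∈ J₁ ++ J₂
        bad (yes e) (yes e') = ⊥-elim (U₁ i x∉ e e')
        bad (yes e) (no ¬e') = ∈-++⁺ˡ (∈-filter⁺ (Conflict? x x') p (e , other ¬q' ¬e'))
        bad (no ¬e) (yes e') = ∈-++⁺ʳ J₁ (∈-filter⁺ (Conflict? x' x) p (other ¬q ¬e , e'))
        bad (no ¬e) (no ¬e') = ⊥-elim (U₁ i x'∉ (other ¬q ¬e) (other ¬q' ¬e'))

      I≤common : length I ≤ length (common x x')
      I≤common = subst (_≤ length (common x x')) (length-map F I) (card
          (Fs (Uniq.filter⁺ Common? (Uniq.upTo⁺ L)) λ p → ∈-upTo⁻ (proj₁ (∈-filter⁻ Common? {xs = upTo L} p))) sub)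
        where
        Fs : ∀ {is} → Unique is → (∀ {i} → i ∈ is → i < L) → Unique (map F is)
        Fs {[]} _ _ = AllPairs.[]
        Fs {i ∷ is} u b = Unique-cons fresh (Fs (Unique-tail u) (b ∘ there))
          where
          fresh : F i ∉ map F is
          fresh q with ∈-map⁻ F q
          ... | j , r , e with inj (b (here refl)) (b (there r)) e
          ...   | refl = Unique-head u r
        sub : map F I ⊑ common x x'
        sub q with ∈-map⁻ F q
        ... | i , r , refl = ∈-filter⁺ _ (on i) (proj₂ (∈-filter⁻ Common? {xs = upTo L} r))

      count : L ≤ length (common x x') + (length (common x x') + (length J₁ + length J₂))
      count = ≤-trans (≤-trans (≤-reflexive (sym (length-upTo L))) (card (Uniq.upTo⁺ L) classify))
        (≤-trans (≤-reflexive (trans (length-++ I) (cong (length I +_) (trans (length-++ (map before I))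
            (cong₂ _+_ (length-map before I) (length-++ J₁))))))
          (+-mono-≤ I≤common (+-monoˡ-≤ _ I≤common)))

      one-conflict : ∀ {y y'} → y ∉ S → y' ∉ S → y ≢ y' →
        length (filter (Conflict? y y') (upTo L)) ≤ 1
      one-conflict {y} {y'} y∉ y'∉ y≢y' = at-most-one (Uniq.filter⁺ P? (Uniq.upTo⁺ L)) same
        where
        P? = Conflict? y y'
        same : ∀ {i j} → i ∈ filter P? (upTo L) → j ∈ filter P? (upTo L) → i ≡ j
        same {i} {j} p q with ∈-filter⁻ P? {xs = upTo L} p | ∈-filter⁻ P? {xs = upTo L} q | <-cmp i j
        ... | _ , (a , b) | q∈ , (a' , b') | tri< i<j _ _ = ⊥-elim (U₃ y∉ y'∉ y≢y' i<j (∈-upTo⁻ q∈) a b a' b')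
        ... | _ | _ | tri≈ _ e _ = e
        ... | p∈ , (a , b) | _ , (a' , b') | tri> _ _ j<i = ⊥-elim (U₃ y∉ y'∉ y≢y' j<i (∈-upTo⁻ p∈) a' b' a b)

      count-any : L ≤ length (common x x') + length (common x x') + 2
      count-any = lin 4 (λ l m j₁ j₂ → (l :≤ m ⊕ (m ⊕ (j₁ ⊕ j₂))) ∷ (j₁ :≤ # 1) ∷ (j₂ :≤ # 1) ∷ [] ⊢ l :≤ m ⊕ m ⊕ # 2)
        (L ∷ length (common x x') ∷ length J₁ ∷ length J₂ ∷ []) (count , one-conflict x∉ x'∉ x≢x' , one-conflict x'∉ x∉ (x≢x' ∘ sym))

      count-α : E α x x' → L ≤ length (common x x') + length (common x x')
      count-α e = lin 4 (λ l m j₁ j₂ → (l :≤ m ⊕ (m ⊕ (j₁ ⊕ j₂))) ∷ (j₁ :≤ # 0) ∷ (j₂ :≤ # 0) ∷ [] ⊢ l :≤ m ⊕ m)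
        (L ∷ length (common x x') ∷ length J₁ ∷ length J₂ ∷ [])
        (count , none J₁ (λ p → U₂ _ x∉ x'∉ x≢x' e (proj₁ (f₁ p)) (proj₂ (f₁ p)))
               , none J₂ (λ p → U₂ _ x'∉ x∉ (x≢x' ∘ sym) (E-sym e) (proj₁ (f₂ p)) (proj₂ (f₂ p))))
        where
        none : ∀ (J : List ℕ) → (∀ {i} → i ∈ J → ⊥) → length J ≤ 0
        none [] _ = z≤n
        none (i ∷ J) h = ⊥-elim (h (here refl))
        f₁ : ∀ {i} → i ∈ J₁ → E α x (F i) × E α x' (F (suc i))
        f₁ p = proj₂ (∈-filter⁻ (Conflict? x x') {xs = upTo L} p)
        f₂ : ∀ {i} → i ∈ J₂ → E α x' (F i) × E α x (F (suc i))
        f₂ p = proj₂ (∈-filter⁻ (Conflict? x' x) {xs = upTo L} p)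

    record Woven (a b : V) (xs : List V) (m : ℕ) (D : List V) : Set where
      field
        {ds} : List V
        path : HamPath β a b (xs ++ ds)
        ds-unique : Unique ds
        ds-size : length ds ≡ m
        ds⊂S : ds ⊑ S
        ds∉D : ∀ {d} → d ∈ ds → d ∉ D

    -- A path of colour β through given vertices off the cycle, alternating with vertices of the cycle.
    weave : ∀ {m} → (∀ {x y} → x ∉ S → y ∉ S → x ≢ y → m ≤ length (common x y)) →
      ∀ a mid b D → Unique (a ∷ mid ++ b ∷ []) → (∀ {x} → x ∈ a ∷ mid ++ b ∷ [] → x ∉ S) →
      suc (length mid) + length D ≤ m → Woven a b (a ∷ mid ++ b ∷ []) (suc (length mid)) D
    weave {m} h a [] b D u o l
      with pick {as = D} (common-unique a b) (≤-trans l (h (o (here refl)) (o (there (here refl))) (λ e → Unique-head u (here e))))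
    ... | d , d∈ , d∉ = record
      { path = perm (prep a (swap d b ↭-refl)) (join (one a) (proj₁ (proj₂ (common⁻ d∈)))
          (join (one d) (E-sym (proj₂ (proj₂ (common⁻ d∈)))) (one b)))
      ; ds-unique = Unique-[] d ; ds-size = refl
      ; ds⊂S = λ { (here refl) → proj₁ (common⁻ d∈) } ; ds∉D = λ { (here refl) → d∉ } }
    weave {m} h a (x ∷ mid) b D u o l
      with pick {as = D} (common-unique a x) (≤-trans (≤-trans (s≤s (m≤n+m _ _)) l)
          (h (o (here refl)) (o (there (here refl))) (λ e → Unique-head u (here e))))
    ... | d , d∈ , d∉ with weave h x mid b (d ∷ D) (Unique-tail u) (o ∘ there)
        (≤-trans (≤-reflexive (+-suc (suc (length mid)) (length D))) l)
    ...   | w = record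
      { path = perm (prep a (↭-sym (shift d (x ∷ mid ++ b ∷ []) (Woven.ds w))))
          (join (one a) (proj₁ (proj₂ (common⁻ d∈))) (join (one d) (E-sym (proj₂ (proj₂ (common⁻ d∈)))) (Woven.path w)))
      ; ds-unique = Unique-cons (λ p → Woven.ds∉D w p (here refl)) (Woven.ds-unique w)
      ; ds-size = cong suc (Woven.ds-size w)
      ; ds⊂S = λ { (here refl) → proj₁ (common⁻ d∈) ; (there p) → Woven.ds⊂S w p }
      ; ds∉D = λ { (here refl) → d∉ ; (there p) → λ q → Woven.ds∉D w p (there q) } }

    -- The cycle length L will be 3 + 2i or 4 + 2i; the two hypotheses are half of L - 2 and half of
    -- L, rounded up. The one additional common neighbour of a pair of colour α is what closes the
    -- paths of colour β below.
    module Cases (i : ℕ) (i≤ : 2 + i ≤ k)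
        (any-common : ∀ {x y} → x ∉ S → y ∉ S → x ≢ y → suc i ≤ length (common x y))
        (α-common : ∀ {x y} → x ∉ S → y ∉ S → x ≢ y → E α x y → suc (suc i) ≤ length (common x y)) where

      record Woof (a b : V) (as : List V) : Set where
        field
          {xs ds} : List V
          path : HamPath β a b (xs ++ ds)
          unique : Unique (xs ++ ds)
          size : length (xs ++ ds) ≡ 3 + 2 * i
          ds-size : length ds ≡ suc i
          xs⊂X : xs ⊑ X
          ds⊂S : ds ⊑ S
          avoid : ∀ {x} → x ∈ xs → x ≢ a → x ≢ b → x ∉ as

      woof : ∀ {a b} as → a ∈ X → b ∈ X → a ≢ b → a ∈ as → b ∈ as → i + length as ≤ length X → Woof a b as
      woof {a} {b} as a∈ b∈ a≢b a∈as b∈as l = record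
        { path = W.path
        ; unique = Unique-++ u W.ds-unique λ p q → X∉S (sub p) (W.ds⊂S q)
        ; size = trans (length-++ (a ∷ mid ++ b ∷ [])) (trans (cong₂ (λ s t → suc s + t) (trans (length-++ mid) (cong (_+ 1) M.size))
            (trans W.ds-size (cong suc M.size)))
            (linear-≡ 1 (λ i → # 1 ⊕ (i ⊕ # 1) ⊕ (# 1 ⊕ i) :≤ # 3 ⊕ 2 ⊛ i) (i ∷ [])))
        ; ds-size = trans W.ds-size (cong suc M.size)
        ; xs⊂X = sub ; ds⊂S = W.ds⊂S
        ; avoid = λ { (here e) x≢a x≢b → ⊥-elim (x≢a e)
                    ; (there p) x≢a x≢b → ++-elim mid p M.avoid λ q → ⊥-elim (x≢b (∈-[]⁻ q)) } }
        where
        module M = Selection (select {i} as X-unique l)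
        mid = M.list
        sub : (a ∷ mid ++ b ∷ []) ⊑ X
        sub (here refl) = a∈
        sub (there p) = ++-elim mid p M.from λ { (here refl) → b∈ }
        u : Unique (a ∷ mid ++ b ∷ [])
        u = Unique-cons (λ p → ++-elim mid p (λ q → M.avoid q a∈as) λ q → a≢b (∈-[]⁻ q))
              (Unique-++ M.unique (Unique-[] b) λ { q (here refl) → M.avoid q b∈as })
        module W = Woven (weave any-common a mid b [] u (X∉S ∘ sub)
          (≤-reflexive (trans (+-identityʳ _) (cong suc M.size))))

      off : ∀ {a b as} (W : Woof a b as) {x} → x ∈ X → x ≢ a → x ≢ b → x ∈ as → x ∉ Woof.xs W ++ Woof.ds W
      off W x∈X x≢a x≢b x∈as p = ++-elim (Woof.xs W) p (λ q → Woof.avoid W q x≢a x≢b x∈as) (λ q → X∉S x∈X (Woof.ds⊂S W q))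

      closing : ∀ {a b as} (W : Woof a b as) → a ∈ X → b ∈ X → a ≢ b → E α a b →
        ∃ λ d → d ∈ S × d ∉ Woof.xs W ++ Woof.ds W × E β a d × E β b d
      closing {a} {b} W a∈ b∈ a≢b e
        with pick {as = Woof.ds W} (common-unique a b) (subst (_< length (common a b)) (sym (Woof.ds-size W))
            (α-common (X∉S a∈) (X∉S b∈) a≢b e))
      ... | d , d∈ , d∉ = d , proj₁ (common⁻ d∈)
        , (λ p → ++-elim (Woof.xs W) p (λ q → X∉S (Woof.xs⊂X W q) (proj₁ (common⁻ d∈))) d∉)
        , proj₂ (common⁻ d∈)

      -- The path from `woof` has 2i + 3 vertices and uses i + 1 vertices of the cycle; a common
      -- neighbour of `x` and `y` is left over and closes it to length L + 1 in colour β.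
      odd-mixed : ∀ {x y} → L ≡ 3 + 2 * i → i + 2 ≤ length X → x ∈ X → y ∈ X → x ≢ y → E α x y → ⊥
      odd-mixed {x} {y} L≡ l x∈ y∈ x≢y e with woof (x ∷ y ∷ []) x∈ y∈ x≢y (here refl) (there (here refl)) l
      ... | W with closing W x∈ y∈ x≢y e
      ...   | d , d∈ , d∉ , xd , yd = no₁ β (cycle (x , d , join (Woof.path W) yd (one d) , E-sym xd)
        (Unique-++ (Woof.unique W) (Unique-[] d) λ { p (here refl) → d∉ p })
        (trans (length-++ (Woof.xs W ++ Woof.ds W)) (trans (+-comm _ 1) (cong suc (trans (Woof.size W) (sym L≡))))) λ _ → tt)

      -- Here L + 1 = 2i + 5 requires one vertex more than in the odd case: `x` itself, reached from
      -- `z` by an edge of colour β and left through a spare common neighbour of `x` and `y`.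
      even-mixed : ∀ {x y z} → L ≡ 4 + 2 * i → i + 3 ≤ length X → x ∈ X → y ∈ X → z ∈ X → x ≢ y → x ≢ z →
        E α x y → E β x z → ⊥
      even-mixed {x} {y} {z} L≡ l x∈ y∈ z∈ x≢y x≢z e e'
        with woof (z ∷ y ∷ x ∷ []) z∈ y∈ (λ { refl → E-op e e' }) (here refl) (there (here refl)) l
      ... | W with closing′ W
        where
        closing′ : ∀ (W : Woof z y (z ∷ y ∷ x ∷ [])) → ∃ λ d → d ∈ S × d ∉ Woof.xs W ++ Woof.ds W × E β x d × E β y d
        closing′ W with pick {as = Woof.ds W} (common-unique x y) (subst (_< length (common x y)) (sym (Woof.ds-size W))
            (α-common (X∉S x∈) (X∉S y∈) x≢y e))
        ... | d , d∈ , d∉ = d , proj₁ (common⁻ d∈)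
          , (λ p → ++-elim (Woof.xs W) p (λ q → X∉S (Woof.xs⊂X W q) (proj₁ (common⁻ d∈))) d∉)
          , proj₂ (common⁻ d∈)
      ...   | d , d∈ , d∉ , xd , yd = no₁ β (cycle (x , d , join (one x) e' (join (Woof.path W) yd (one d)) , E-sym xd)
        (Unique-cons (λ p → ++-elim (Woof.xs W ++ Woof.ds W) p (off W x∈ x≢z x≢y (there (there (here refl)))) λ { (here refl) → X∉S x∈ d∈ })
          (Unique-++ (Woof.unique W) (Unique-[] d) λ { p (here refl) → d∉ p }))
        (cong suc (trans (length-++ (Woof.xs W ++ Woof.ds W)) (trans (+-comm _ 1) (trans (cong suc (Woof.size W)) (sym L≡))))) λ _ → tt)

      -- In a clique of colour β the path from `woof` is prolonged inside `X` itself, so no spare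
      -- common neighbour is needed.
      β-clique-cycle : ∀ t → i + (2 + t) ≤ length X → 1 ≤ t → Clique β X → Cycle β (3 + 2 * i + t) Anywhere
      β-clique-cycle (suc t) l _ h with select {2 + suc t} [] X-unique (≤-trans (≤-reflexive (+-identityʳ _)) (≤-trans (m≤n+m _ i) l))
      ... | s with Selection.list s | Selection.size s | Selection.unique s | Selection.from s
      ...   | a ∷ b ∷ x ∷ zs | sz | u | f
        with woof (a ∷ b ∷ x ∷ zs) (f (here refl)) (f (there (here refl))) (λ e → Unique-head u (here e)) (here refl) (there (here refl))
            (subst (λ t → i + t ≤ length X) (sym sz) l)
      ...     | W = cycle (a , _ , join (Woof.path W) (h (f (there (here refl))) (f (there (there (here refl))))
          (λ e → Unique-head (Unique-tail u) (here e))) (proj₂ tailPath) ,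
            h (f (there (there (proj₁ (proj₂ (proj₁ tailPath)))))) (f (here refl))
                (λ e → Unique-head u (there (subst (_∈ x ∷ zs) e (proj₁ (proj₂ (proj₁ tailPath)))))))
          (Unique-++ (Woof.unique W) (Unique-tail (Unique-tail u))
            λ p q → off W (f (there (there q))) (λ { refl → Unique-head u (there q) }) (λ { refl → Unique-head (Unique-tail u) q })
                (there (there q)) p)
          (trans (length-++ (Woof.xs W ++ Woof.ds W)) (cong₂ _+_ (Woof.size W) (suc-injective (suc-injective sz)))) λ _ → tt
        where
        straight : ∀ x zs → Unique (x ∷ zs) → (x ∷ zs) ⊑ X → Σ (∃ λ z → z ∈ x ∷ zs × ⊤) λ z → HamPath β x (proj₁ z) (x ∷ zs)
        straight x [] u f = (x , here refl , tt) , one x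
        straight x (y ∷ zs) u f with straight y zs (Unique-tail u) (f ∘ there)
        ... | (z , p , _) , q = (z , there p , tt) , join (one x) (h (f (here refl)) (f (there (here refl))) (λ e → Unique-head u (here e)))
            q
        tailPath = straight x zs (Unique-tail (Unique-tail u)) (λ p → f (there (there p)))

      X-path : Clique α X → ∀ {x y} t → t + 2 ≤ length X → x ∈ X → y ∈ X → x ≢ y →
        ∃ λ zs → HamPath α x y zs × Unique zs × length zs ≡ 2 + t × zs ⊑ X
      X-path h {x} {y} t l x∈ y∈ x≢y = x ∷ M.list ++ y ∷ [] , clique-path h x M.list y u sub , u
        , cong suc (trans (length-++ M.list) (trans (+-comm _ 1) (cong suc M.size))) , sub
        where
        module M = Selection (select {t} (x ∷ y ∷ []) X-unique l)
        sub : (x ∷ M.list ++ y ∷ []) ⊑ X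
        sub (here refl) = x∈
        sub (there p) = ++-elim M.list p M.from λ { (here refl) → y∈ }
        u : Unique (x ∷ M.list ++ y ∷ [])
        u = Unique-cons (λ p → ++-elim M.list p (λ q → M.avoid q (here refl)) λ q → x≢y (∈-[]⁻ q))
              (Unique-++ M.unique (Unique-[] y) λ { q (here refl) → M.avoid q (there (here refl)) })

      module _ (L≡ : L ≡ 4 + 2 * i) (lX : i + 4 ≤ length X) (h : Clique α X) where

        through : ∀ {x y u v T A} t → t + 2 ≤ length X → x ∈ X → y ∈ X → x ≢ y → E α x u → E α y v →
          HamPath α u v T → Unique T → T ⊑ S → length T ≡ A →
          (2 + t + A ≡ 5 + 2 * i ⊎ 2 + t + A ≡ 6 + 2 * i) → ⊥
        through {x} {y} {u} {v} {T} {A} t l x∈ y∈ x≢y xu yv p uT T⊂S lT eq with X-path h t l y∈ x∈ (x≢y ∘ sym)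
        ... | zs , q , uz , lz , z⊂X = [ (λ e → no₁ α (subst (λ n → Cycle α n Anywhere) (trans e (cong suc (sym L≡))) C))
                                       , (λ e → no₂ α (subst (λ n → Cycle α n Anywhere) (trans e (cong (2 +_) (sym L≡))) C)) ] eq
          where
          C : Cycle α (2 + t + A) Anywhere
          C = cycle (y , v , join q xu p , E-sym yv) (Unique-++ uz uT λ a b → X∉S (z⊂X a) (T⊂S b))
                (trans (length-++ zs) (cong₂ _+_ lz lT)) λ _ → tt

        n≡ : n ≡ 2 + 2 * i
        n≡ = suc-injective (suc-injective L≡)

        -- The two edges are joined through the clique `X` on one side and along an arc of the cycle
        -- on the other. The arc is chosen long enough for `X` to fill up the length to L + 1; if
        -- the ends are adjacent on the cycle, the arc contains all of it and two vertices of `X`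
        -- give L + 2.
        arcs : ∀ {x y} (R : Round α L S) → x ∈ X → y ∈ X → x ≢ y → ∀ d → 1 ≤ d → d ≤ suc n →
          E α x (Round.F R 0) → E α y (Round.F R d) → ⊥
        arcs {x} {y} R x∈ y∈ x≢y d 1≤d d≤ e e' = go d (d ≤? suc i) refl
          where
          open Round R using () renaming (F to G)
          open RoundSegments R
          module RL = Longer R
          r : ℕ
          r = proj₁ (m≤n⇒∃[o]m+o≡n d≤)
          r-eq : d + r ≡ suc n
          r-eq = proj₂ (m≤n⇒∃[o]m+o≡n d≤)
          r-eq' : d + r ≡ 3 + 2 * i
          r-eq' = trans r-eq (cong suc n≡)
          T : List V
          T = seg d r ++ G 0 ∷ []
          p : HamPath α (G d) (G 0) T
          p = join (subst (λ t → HamPath α (G d) (G t) (seg d r)) r-eq (seg-path d r (≤-reflexive r-eq))) RL.close (one (G 0))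
          uT : Unique T
          uT = Unique-++ (seg-unique d r (≤-reflexive r-eq)) (Unique-[] _)
            λ { q (here refl) → seg-∉ d r (≤-reflexive r-eq) z≤n (inj₁ 1≤d) q }
          T⊂S : T ⊑ S
          T⊂S q = ++-elim (seg d r) q (RL.seg⊂ d r) λ { (here refl) → Round.on R 0 }
          lT : length T ≡ suc r + 1
          lT = trans (length-++ (seg d r)) (cong (_+ 1) (seg-size d r))
          go : ∀ d' → Dec (d' ≤ suc i) → d ≡ d' → ⊥
          go zero _ refl = 1≰0 1≤d
          go (suc zero) _ refl = through 0 (≤-trans (s≤s (s≤s z≤n)) (≤-trans (m≤n+m 4 i) lX)) y∈ x∈ (x≢y ∘ sym) e' e p uT T⊂S lT
            (inj₂ (trans (linear-≡ 1 (λ r → # 2 ⊕ (# 1 ⊕ r ⊕ # 1) :≤ # 3 ⊕ (# 1 ⊕ r)) (r ∷ [])) (cong (3 +_) r-eq')))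
          go (suc (suc t)) (yes h') refl = through t (lin 3 (λ t i X → (# 2 ⊕ t :≤ # 1 ⊕ i) ∷ (i ⊕ # 4 :≤ X) ∷ [] ⊢ t ⊕ # 2 :≤ X)
              (t ∷ i ∷ length X ∷ []) (h' , lX))
            y∈ x∈ (x≢y ∘ sym) e' e p uT T⊂S lT
            (inj₁ (trans (linear-≡ 2 (λ t r → # 2 ⊕ t ⊕ (# 1 ⊕ r ⊕ # 1) :≤ # 2 ⊕ (# 2 ⊕ t ⊕ r)) (t ∷ r ∷ [])) (cong (2 +_) r-eq')))
          go (suc (suc _)) (no ¬h) refl with d ≤? 2 + 2 * i
          ... | no ¬h' = through 0 (≤-trans (s≤s (s≤s z≤n)) (≤-trans (m≤n+m 4 i) lX)) x∈ y∈ x≢y e e'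
              (seg-path 0 d d≤) (seg-unique 0 d d≤) (RL.seg⊂ 0 d) (seg-size 0 d)
              (inj₂ (cong (3 +_) (≤-antisym (≤-trans d≤ (≤-reflexive (cong suc n≡))) (≰⇒> ¬h'))))
          ... | yes h' = through t (lin 4 (λ t d i X → (d ⊕ t :≤ # 2 ⊕ 2 ⊛ i) ∷ (# 2 ⊕ i :≤ d) ∷ (i ⊕ # 4 :≤ X) ∷ [] ⊢ t ⊕ # 2 :≤ X)
                (t ∷ d ∷ i ∷ length X ∷ []) (≤-reflexive t-eq , ≰⇒> ¬h , lX)) x∈ y∈ x≢y e e'
              (seg-path 0 d d≤) (seg-unique 0 d d≤) (RL.seg⊂ 0 d) (seg-size 0 d)
              (inj₁ (trans (linear-≡ 2 (λ t d → # 2 ⊕ t ⊕ (# 1 ⊕ d) :≤ # 3 ⊕ (d ⊕ t)) (t ∷ d ∷ [])) (cong (3 +_) t-eq)))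
            where
            t : ℕ
            t = proj₁ (m≤n⇒∃[o]m+o≡n h')
            t-eq : d + t ≡ 2 + 2 * i
            t-eq = proj₂ (m≤n⇒∃[o]m+o≡n h')

        Spoke : V → V → Set
        Spoke x v = x ∈ X × v ∈ S × E α x v

        ordered : ∀ p q → p < q → q < L → ∀ {x y} → x ∈ X → y ∈ X → x ≢ y → E α x (F p) → E α y (F q) → ⊥
        ordered p q p<q q< {x} {y} x∈ y∈ x≢y e e' with rotate R p
        ... | R' , f = arcs R' x∈ y∈ x≢y (suc d) (s≤s z≤n)
            (lin 4 (λ p d q n → (p ⊕ (# 1 ⊕ d) :≤ q) ∷ (# 1 ⊕ q :≤ # 2 ⊕ n) ∷ [] ⊢ # 1 ⊕ d :≤ # 1 ⊕ n) (p ∷ d ∷ q ∷ n ∷ [])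
                (≤-reflexive eq , q<))
            (subst (E α x) (sym (trans (f 0) (cong F (+-identityʳ p)))) e)
            (subst (E α y) (sym (trans (f (suc d)) (cong F eq))) e')
          where
          d : ℕ
          d = proj₁ (m≤n⇒∃[o]m+o≡n p<q)
          eq : p + suc d ≡ q
          eq = trans (+-suc p d) (proj₂ (m≤n⇒∃[o]m+o≡n p<q))

        crossing : ∀ {x v y w} → Spoke x v → Spoke y w → x ≢ y → v ≢ w → ⊥
        crossing {x} {v} {y} {w} (x∈ , v∈ , e) (y∈ , w∈ , e') x≢y v≢w with onto v∈ | onto w∈
        ... | p , p< , refl | q , q< , refl with <-cmp p q
        ...   | tri≈ _ refl _ = v≢w refl
        ...   | tri< p<q _ _ = ordered p q p<q q< x∈ y∈ x≢y e e'
        ...   | tri> _ _ q<p = ordered q p q<p p< y∈ x∈ (x≢y ∘ sym) e' e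

        -- By `crossing` the edges of colour α between `X` and the cycle form a star. Without its
        -- centre there is a K_{i+3,i+3} of colour β, which contains a cycle of length 2i + 6 = L +
        -- 2.
        α-clique : ⊥
        α-clique with star Spoke (λ x v → (x ∈? X) ×-dec ((v ∈? S) ×-dec E? α x v)) crossing (F 0)
        ... | s , hits = no₂ β (subst (λ n → Cycle β n Anywhere) (trans (linear-≡ 1 (λ i → 2 ⊛ (# 3 ⊕ i) :≤ # 6 ⊕ 2 ⊛ i) (i ∷ []))
            (cong (2 +_) (sym L≡))) (go SX.list SX.size SX.unique SX.from SX.avoid SY.list SY.size SY.unique SY.from SY.avoid))
          where
          module SX = Selection (select {3 + i} (s ∷ []) X-unique (≤-trans
              (≤-reflexive (linear-≡ 1 (λ i → # 3 ⊕ i ⊕ # 1 :≤ i ⊕ # 4) (i ∷ []))) lX))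
          module SY = Selection (select {3 + i} (s ∷ []) S-unique (≤-trans (lin 1 (λ i → [] ⊢ # 3 ⊕ i ⊕ # 1 :≤ # 4 ⊕ 2 ⊛ i) (i ∷ []) tt)
              (≤-reflexive (sym (trans S-size L≡)))))
          go : ∀ xs → length xs ≡ 3 + i → Unique xs → xs ⊑ X → (∀ {x} → x ∈ xs → x ∉ s ∷ []) →
               ∀ ys → length ys ≡ 3 + i → Unique ys → ys ⊑ S → (∀ {x} → x ∈ ys → x ∉ s ∷ []) → Cycle β (2 * (3 + i)) Anywhere
          go (x ∷ xs) l u f av (y ∷ ys) l' u' f' av' =
            cycle (x , y , zigzag x xs y ys (suc-injective (trans l (sym l'))) joined , E-sym (joined (here refl) (here refl)))
              (Unique-++ u u' λ p q → X∉S (f p) (f' q))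
              (trans (length-++ (x ∷ xs)) (trans (cong₂ _+_ l l') (cong (3 + i +_) (sym (+-identityʳ (3 + i)))))) λ _ → tt
            where
            joined : Complete β (x ∷ xs) (y ∷ ys)
            joined {a} {b} p q = not-E λ e → [ (λ r → av p (here r)) , (λ r → av' q (here r)) ] (hits (f p , f' q , e))

      Mixed : Set
      Mixed = ∃ λ x → ∃ λ y → ∃ λ z → (x ∈ X × y ∈ X × z ∈ X) × (x ≢ y × x ≢ z) × (E α x y × E β x z)

      -- At least 3k + 2 - L vertices lie off the cycle. With L = l + 2i and i + 2 ≤ k this is at
      -- least i + 8 - l, which suffices for l ≤ 4.
      X-bound : ∀ {l} → L ≡ l + 2 * i → l ≤ 4 → i + l ≤ length X
      X-bound {l} L≡ l≤ = lin 5 (λ k i l X L → (3 ⊛ k ⊕ # 2 :≤ X ⊕ L) ∷ (L :≤ l ⊕ 2 ⊛ i) ∷ (3 ⊛ (# 2 ⊕ i) :≤ 3 ⊛ k) ∷ (2 ⊛ l :≤ # 8) ∷ [] ⊢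
          i ⊕ l :≤ X)
        (k ∷ i ∷ l ∷ length X ∷ L ∷ []) (X-size , ≤-reflexive L≡ , *-monoʳ-≤ 3 i≤ , *-monoʳ-≤ 2 l≤)

      homogeneous : ¬ Mixed → Clique α X ⊎ Clique β X
      homogeneous ¬m with any? (λ x → any? λ y → ((x ∈? X) ×-dec (y ∈? X)) ×-dec (¬? (x ≟ y) ×-dec E? α x y))
      ... | no none = inj₂ λ {u} {v} u∈ v∈ u≢v → not-E λ e → none (u , v , (u∈ , v∈) , u≢v , e)
      ... | yes (x , y , (x∈ , y∈) , x≢y , e) = inj₁ clq
        where
        clq : Clique α X
        clq {u} {v} u∈ v∈ u≢v with E? α u v
        ... | yes e' = e'
        ... | no ¬e with u ≟ x
        ...   | yes refl = ⊥-elim (¬m (x , y , v , (x∈ , y∈ , v∈) , (x≢y , u≢v) , e , not-E ¬e))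
        ...   | no u≢x with E? α x u
        ...     | yes e' = ⊥-elim (¬m (u , x , v , (u∈ , x∈ , v∈) , (u≢x , u≢v) , E-sym e' , not-E ¬e))
        ...     | no ¬e' = ⊥-elim (¬m (x , y , u , (x∈ , y∈ , u∈) , (x≢y , u≢x ∘ sym) , e , not-E ¬e'))

      Mixed? : Dec Mixed
      Mixed? = any? λ x → any? λ y → any? λ z → ((x ∈? X) ×-dec ((y ∈? X) ×-dec (z ∈? X))) ×-dec
        ((¬? (x ≟ y) ×-dec ¬? (x ≟ z)) ×-dec (E? α x y ×-dec E? β x z))

      odd : L ≡ 3 + 2 * i → ⊥
      odd L≡ with any? (λ x → any? λ y → ((x ∈? X) ×-dec (y ∈? X)) ×-dec (¬? (x ≟ y) ×-dec E? α x y))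
      ... | yes (x , y , (x∈ , y∈) , x≢y , e) = odd-mixed L≡ (≤-trans (+-monoʳ-≤ i (s≤s (s≤s z≤n))) (X-bound L≡ (n≤1+n 3))) x∈ y∈ x≢y e
      ... | no none = no₁ β (subst (λ n → Cycle β n Anywhere) (trans (+-comm (3 + 2 * i) 1) (cong suc (sym L≡)))
          (β-clique-cycle 1 (X-bound L≡ (n≤1+n 3)) ≤-refl λ {u} {v} u∈ v∈ u≢v → not-E λ e → none (u , v , (u∈ , v∈) , u≢v , e)))

      even : L ≡ 4 + 2 * i → ⊥
      even L≡ with Mixed?
      ... | yes (x , y , z , (x∈ , y∈ , z∈) , (x≢y , x≢z) , e , e') =
        even-mixed L≡ (≤-trans (+-monoʳ-≤ i (n≤1+n 3)) (X-bound L≡ ≤-refl)) x∈ y∈ z∈ x≢y x≢z e e'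
      ... | no ¬m with homogeneous ¬m
      ...   | inj₁ h = α-clique L≡ (X-bound L≡ ≤-refl) h
      ...   | inj₂ h = no₁ β (subst (λ n → Cycle β n Anywhere) (trans (+-comm (3 + 2 * i) 2) (cong suc (sym L≡)))
          (β-clique-cycle 2 (X-bound L≡ ≤-refl) (s≤s z≤n) h))

round-up : ∀ i m → suc (2 * i) ≤ m + m → suc i ≤ m
round-up i m h with suc i ≤? m
... | yes p = p
... | no ¬p = ⊥-elim (1≰0 (lin 2 (λ i m → (# 1 ⊕ 2 ⊛ i :≤ m ⊕ m) ∷ (# 1 ⊕ m :≤ # 1 ⊕ i) ∷ (# 1 ⊕ m :≤ # 1 ⊕ i) ∷ [] ⊢ # 1 :≤ # 0)
    (i ∷ m ∷ []) (h , ≰⇒> ¬p , ≰⇒> ¬p)))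

-- Unlike `2 * suc i`, `double (suc i)` reduces to two successors, as the adjacency of every other
-- vertex on a cycle requires.
double : ℕ → ℕ
double zero = zero
double (suc i) = suc (suc (double i))

double-* : ∀ i → double i ≡ 2 * i
double-* zero = refl
double-* (suc i) = cong suc (trans (cong suc (double-* i)) (sym (+-suc i (i + 0))))

double-+ : ∀ i j → double (i + j) ≡ double i + double j
double-+ zero j = refl
double-+ (suc i) j = cong (2 +_) (double-+ i j)

double-mono : ∀ {i j} → i ≤ j → double i ≤ double j
double-mono z≤n = z≤n
double-mono (s≤s h) = s≤s (s≤s (double-mono h))

double-injective : ∀ {i j} → double i ≡ double j → i ≡ j
double-injective {zero} {zero} e = refl
double-injective {suc i} {suc j} e = cong suc (double-injective (suc-injective (suc-injective e)))

double-odd : ∀ {i j} → double i ≢ suc (double j)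
double-odd {suc i} {zero} ()
double-odd {suc i} {suc j} e = double-odd (suc-injective (suc-injective e))

-- Descent to a monochromatic triangle

module _ {N : ℕ} (c : Colouring N) (c-sym : Symmetric c) where
  open Graph c c-sym

  up : ∀ {k L} → 3 * k + 2 ≤ N → 3 ≤ L → L ≤ 2 * k → No c c-sym (suc L) → No c c-sym (suc (suc L)) → No c c-sym L
  up {L = suc zero} _ (s≤s ())
  up {k} {suc (suc n)} N≥ 3≤L L≤ no₁ no₂ α (cycle {S} ham uS lS _) with half (suc (suc n)) 3≤L
  ... | suc i , _ , eq = [ odd-case , even-case ] eq
    where
    module U = Up c c-sym {k} N≥ {α} {n} {S} L≤ no₁ no₂ (round c c-sym ham uS lS) uS lS
    case : 3 + 2 * i ≤ suc (suc n) → (3 + 2 * i ≤ 2 * k)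
    case h = ≤-trans h L≤
    module C (h : 3 + 2 * i ≤ suc (suc n)) = U.Cases i
      (round-up (suc i) k (lin 2 (λ i k → (# 3 ⊕ 2 ⊛ i :≤ 2 ⊛ k) ∷ [] ⊢ # 1 ⊕ 2 ⊛ (# 1 ⊕ i) :≤ k ⊕ k) (i ∷ k ∷ []) (case h)))
      (λ {x} {y} x∉ y∉ x≢y → round-up i _ (lin 3 (λ i m L → (# 3 ⊕ 2 ⊛ i :≤ L) ∷ (L :≤ m ⊕ m ⊕ # 2) ∷ [] ⊢ # 1 ⊕ 2 ⊛ i :≤ m ⊕ m)
        (i ∷ length (U.common x y) ∷ suc (suc n) ∷ []) (h , U.Count.count-any x∉ y∉ x≢y)))
      (λ {x} {y} x∉ y∉ x≢y e → round-up (suc i) _ (lin 3 (λ i m L → (# 3 ⊕ 2 ⊛ i :≤ L) ∷ (L :≤ m ⊕ m) ∷ [] ⊢ # 1 ⊕ 2 ⊛ (# 1 ⊕ i) :≤ m ⊕ m)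
        (i ∷ length (U.common x y) ∷ suc (suc n) ∷ []) (h , U.Count.count-α x∉ y∉ x≢y e)))
    odd-case : suc (suc n) ≡ suc (2 * suc i) → ⊥
    odd-case e = C.odd (≤-reflexive (sym e')) e'
      where
      e' : suc (suc n) ≡ 3 + 2 * i
      e' = trans e (linear-≡ 1 (λ i → # 1 ⊕ 2 ⊛ (# 1 ⊕ i) :≤ # 3 ⊕ 2 ⊛ i) (i ∷ []))
    even-case : suc (suc n) ≡ suc (suc (2 * suc i)) → ⊥
    even-case e = C.even (≤-trans (n≤1+n _) (≤-reflexive (sym e'))) e'
      where
      e' : suc (suc n) ≡ 4 + 2 * i
      e' = trans e (linear-≡ 1 (λ i → # 2 ⊕ 2 ⊛ (# 1 ⊕ i) :≤ # 4 ⊕ 2 ⊛ i) (i ∷ []))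

  triangle-cycle : ∀ {α u v w} → u ≢ v → v ≢ w → w ≢ u → E α u v → E α v w → E α w u → Cycle α 3 Anywhere
  triangle-cycle {u = u} {v} {w} a b d e f g = cycle (u , w , join (one u) e (join (one v) f (one w)) , g)
    (Unique-cons (λ { (here p) → a p ; (there (here p)) → d (sym p) }) (Unique-cons (λ { (here p) → b p }) (Unique-[] w))) refl λ _ → tt

  -- R(3,3) ≤ 6.
  mono-triangle : 6 ≤ N → No c c-sym 3 → ⊥
  mono-triangle 6≤N none = among vertices vertices-unique (≤-trans 6≤N (≤-reflexive (sym vertices-size)))
    where
    star₃ : ∀ α v xs → Unique xs → 3 ≤ length xs → v ∉ xs → (∀ {x} → x ∈ xs → E α v x) → ⊥
    star₃ α v (_ ∷ []) _ (s≤s ()) _ _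
    star₃ α v (_ ∷ _ ∷ []) _ (s≤s (s≤s ())) _ _
    star₃ α v (x ∷ y ∷ z ∷ xs) u _ v∉ h = go (E? α x y) (E? α y z) (E? α z x)
      where
      vx = h (here refl)
      vy = h (there (here refl))
      vz = h (there (there (here refl)))
      x≢y : x ≢ y
      x≢y e = Unique-head u (here e)
      y≢z : y ≢ z
      y≢z e = Unique-head (Unique-tail u) (here e)
      z≢x : z ≢ x
      z≢x e = Unique-head u (there (here (sym e)))
      v≢x : v ≢ x
      v≢x e = v∉ (here e)
      v≢y : v ≢ y
      v≢y e = v∉ (there (here e))
      v≢z : v ≢ z
      v≢z e = v∉ (there (there (here e)))
      go : Dec (E α x y) → Dec (E α y z) → Dec (E α z x) → ⊥
      go (yes e) _ _ = none α (triangle-cycle v≢x x≢y (v≢y ∘ sym) vx e (E-sym vy))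
      go (no _) (yes e) _ = none α (triangle-cycle v≢y y≢z (v≢z ∘ sym) vy e (E-sym vz))
      go (no _) (no _) (yes e) = none α (triangle-cycle v≢z z≢x (v≢x ∘ sym) vz e (E-sym vx))
      go (no a) (no b) (no d) = none (op α) (triangle-cycle x≢y y≢z z≢x (not-E a) (not-E b) (not-E d))
    among : ∀ vs → Unique vs → 6 ≤ length vs → ⊥
    among (v ∷ vs) u (s≤s l) = go (3 ≤? length (filter (E? red v) vs)) (3 ≤? length (filter (E? blue v) vs))
      where
      split : vs ⊑ filter (E? red v) vs ++ filter (E? blue v) vs
      split {y} p with E? red v y
      ... | yes e = ∈-++⁺ˡ (∈-filter⁺ (E? red v) p e)
      ... | no ¬e = ∈-++⁺ʳ (filter (E? red v) vs) (∈-filter⁺ (E? blue v) p (not-E ¬e))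
      many : length vs ≤ length (filter (E? red v) vs) + length (filter (E? blue v) vs)
      many = subst (length vs ≤_) (length-++ (filter (E? red v) vs)) (card (Unique-tail u) split)
      nbrs : ∀ α → 3 ≤ length (filter (E? α v) vs) → ⊥
      nbrs α h = star₃ α v (filter (E? α v) vs) (Uniq.filter⁺ (E? α v) (Unique-tail u)) h
        (λ p → Unique-head u (proj₁ (∈-filter⁻ (E? α v) {xs = vs} p)))
        (λ p → proj₂ (∈-filter⁻ (E? α v) {xs = vs} p))
      go : Dec _ → Dec _ → ⊥
      go (yes h) _ = nbrs red h
      go (no _) (yes h) = nbrs blue h
      go (no ¬a) (no ¬b) = 1≰0 (lin 3 (λ l r b → (# 5 :≤ l) ∷ (l :≤ r ⊕ b) ∷ (# 1 ⊕ r :≤ # 3) ∷ (# 1 ⊕ b :≤ # 3) ∷ [] ⊢ # 1 :≤ # 0)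
        (length vs ∷ length (filter (E? red v) vs) ∷ length (filter (E? blue v) vs) ∷ []) (l , many , ≰⇒> ¬a , ≰⇒> ¬b))

  no-long-cycles : ∀ {k} → 2 ≤ k → 3 * k + 2 ≤ N → No c c-sym (suc (2 * k)) → No c c-sym (suc (suc (2 * k))) → ⊥
  no-long-cycles {k} 2≤k N≥ no₁ no₂ = mono-triangle
      (lin 2 (λ k N → (3 ⊛ # 2 :≤ 3 ⊛ k) ∷ (3 ⊛ k ⊕ # 2 :≤ N) ∷ [] ⊢ # 6 :≤ N) (k ∷ N ∷ []) (*-monoʳ-≤ 3 2≤k , N≥))
      (proj₁ (down (proj₁ gap) 3 (proj₂ gap) ≤-refl))
    where
    gap : ∃ λ t → 3 + t ≡ suc (2 * k)
    gap = m≤n⇒∃[o]m+o≡n (lin 1 (λ k → (2 ⊛ # 2 :≤ 2 ⊛ k) ∷ [] ⊢ # 3 :≤ # 1 ⊕ 2 ⊛ k) (k ∷ []) (*-monoʳ-≤ 2 2≤k))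
    down : ∀ t L → L + t ≡ suc (2 * k) → 3 ≤ L → No c c-sym L × No c c-sym (suc L)
    down zero L e 3≤L = subst (No c c-sym) (sym e') no₁ , subst (No c c-sym) (cong suc (sym e')) no₂
      where
      e' : L ≡ suc (2 * k)
      e' = trans (sym (+-identityʳ L)) e
    down (suc t) L e 3≤L with down t (suc L) (trans (sym (+-suc L t)) e) (≤-trans 3≤L (n≤1+n L))
    ... | a , b = up {k} N≥ 3≤L (≤-pred (≤-trans (m≤m+n (suc L) t) (≤-reflexive (trans (sym (+-suc L t)) e)))) a b , a

  -- Forced chords of a monochromatic C_{2k+2}

  module EvenOdd {k : ℕ} (1≤k : 1 ≤ k) (none : No c c-sym (suc (double k))) {α : Colour} {S : List V} where

    β : Colour
    β = op α

    n : ℕ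
    n = suc (double k)

    module At (R : Round c c-sym α (suc n) S) where
      open Round R renaming (F to G)
      open RoundSegments c c-sym R

      -- In colour α this chord would bypass `G 1` and leave a C_{2k+1}.
      next-next : E β (G 0) (G 2)
      next-next = not-E λ e → none α (cycle
          (G 2 , G 0 , join path close (one (G 0)) , e)
          (Unique-++ (seg-unique 2 r r≤) (Unique-[] _) λ { p (here refl) → seg-∉ 2 r r≤ z≤n (inj₁ (s≤s z≤n)) p })
          (trans (length-++ (seg 2 r)) (trans (+-comm _ 1) (trans (cong suc (seg-size 2 r)) r-eq))) λ _ → tt)
        where
        r : ℕ
        r = proj₁ (m≤n⇒∃[o]m+o≡n (s≤s (≤-trans 1≤k (≤-trans (m≤m+n k k)
            (≤-reflexive (trans (cong (k +_) (sym (+-identityʳ k))) (sym (double-* k))))))))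
        r-eq : 2 + r ≡ n
        r-eq = proj₂ (m≤n⇒∃[o]m+o≡n (s≤s (≤-trans 1≤k (≤-trans (m≤m+n k k)
            (≤-reflexive (trans (cong (k +_) (sym (+-identityʳ k))) (sym (double-* k))))))))
        r≤ : 2 + r ≤ n
        r≤ = ≤-reflexive r-eq
        path : HamPath α (G 2) (G n) (seg 2 r)
        path = subst (λ t → HamPath α (G 2) (G t) (seg 2 r)) r-eq (seg-path 2 r r≤)
        close : E α (G n) (G 0)
        close = subst (λ t → E α (G n) t) (per 0) (adj n)

    next-next : (R : Round c c-sym α (suc n) S) → ∀ p → E β (Round.F R p) (Round.F R (2 + p))
    next-next R p with rotate c c-sym R p
    ... | R' , e = subst₂ (E β) (trans (e 0) (cong (Round.F R) (+-identityʳ p))) (trans (e 2) (cong (Round.F R) (+-comm p 2)))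
        (At.next-next R')

    module Chord (R : Round c c-sym α (suc n) S) (a d : ℕ) (k≡ : suc (a + d) ≡ k) where
      open Round R renaming (F to G)
      open RoundSegments c c-sym R

      s : ℕ
      s = suc (suc (double a))

      n≡ : suc (s + double d) ≡ n
      n≡ = cong suc (trans (sym (double-+ (suc a) d)) (cong double k≡))

      close : E α (G n) (G 0)
      close = subst (λ t → E α (G n) t) (per 0) (adj n)

      module _ (e : E α (G 0) (G s)) where

        below : 2 + double a ≤ n
        below = ≤-trans (≤-trans (m≤m+n s (double d)) (n≤1+n _)) (≤-reflexive n≡)

        below' : 1 + double a ≤ n
        below' = ≤-trans (n≤1+n _) below

        above : suc s + double d ≤ n
        above = ≤-reflexive n≡

        above' : s + double d ≤ n
        above' = ≤-trans (n≤1+n _) above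

        -- Otherwise this edge and the chord from `G 0` to `G s` reroute the cycle so that only
        -- `G 1` is missed, which leaves 2k + 1 vertices.
        chord₁ : E β (G 2) (G (suc s))
        chord₁ = not-E λ e' → none α (cycle
          (G 0 , G n , join (one (G 0)) e (join (rev (seg-path 2 (double a) below)) e'
              (subst (λ t → HamPath α (G (suc s)) (G t) (seg (suc s) (double d))) n≡ (seg-path (suc s) (double d) above))) , close)
          (Unique-cons (λ p → ++-elim (seg 2 (double a)) p (seg-∉ 2 (double a) below z≤n (inj₁ (s≤s z≤n)))
              (seg-∉ (suc s) (double d) above z≤n (inj₁ (s≤s z≤n))))
            (Unique-++ (seg-unique 2 _ below) (seg-unique (suc s) _ above)
                (seg-disjoint 2 (double a) (suc s) (double d) below above ≤-refl)))
          (cong suc (trans (length-++ (seg 2 (double a))) (trans (cong₂ _+_ (seg-size 2 (double a)) (seg-size (suc s) (double d)))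
            (trans (cong suc (+-suc (double a) (double d))) (suc-injective n≡))))) λ _ → tt)

        -- The mirror image: here the rerouted cycle misses only `G n`.
        chord₂ : E β (G (s + double d)) (G (suc (double a)))
        chord₂ = not-E λ e' → none α (cycle
          (G 0 , G 1 , join (one (G 0)) e (join (seg-path s (double d) above') e' (rev (seg-path 1 (double a) below'))) , E-sym (adj 0))
          (Unique-cons (λ p → ++-elim (seg s (double d)) p (seg-∉ s (double d) above' z≤n (inj₁ (s≤s z≤n)))
              (seg-∉ 1 (double a) below' z≤n (inj₁ (s≤s z≤n))))
            (Unique-++ (seg-unique s _ above') (seg-unique 1 _ below') (λ p q → seg-disjoint 1 (double a) s (double d) below' above' ≤-refl
                q p)))
          (cong suc (trans (length-++ (seg s (double d))) (trans (cong₂ _+_ (seg-size s (double d)) (seg-size 1 (double a)))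
            (trans (cong suc (trans (+-suc (double d) (double a)) (cong suc (+-comm (double d) (double a))))) (suc-injective n≡))))) λ _ →
                tt)

    module Halves (R : Round c c-sym α (suc n) S) where
      open Round R renaming (F to G)

      e-inj : ∀ {i j} → i ≤ k → j ≤ k → G (double i) ≡ G (double j) → i ≡ j
      e-inj i≤ j≤ q = double-injective (inj (s≤s (≤-trans (double-mono i≤) (n≤1+n _))) (s≤s (≤-trans (double-mono j≤) (n≤1+n _))) q)

      o-inj : ∀ {i j} → i ≤ k → j ≤ k → G (suc (double i)) ≡ G (suc (double j)) → i ≡ j
      o-inj i≤ j≤ q = double-injective (suc-injective (inj (s≤s (s≤s (double-mono i≤))) (s≤s (s≤s (double-mono j≤))) q))

      e≢o : ∀ {i j} → i ≤ k → j ≤ k → G (double i) ≢ G (suc (double j))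
      e≢o i≤ j≤ q = double-odd (inj (s≤s (≤-trans (double-mono i≤) (n≤1+n _))) (s≤s (s≤s (double-mono j≤))) q)

      module Ev = Segments c c-sym {β} (G ∘ double) k (λ {i} _ → next-next R (double i)) e-inj
      module Od = Segments c c-sym {β} (G ∘ suc ∘ double) k (λ {i} _ → next-next R (suc (double i))) o-inj

      Ev∩Od : ∀ a m b l → a + m ≤ k → b + l ≤ k → ∀ {x} → x ∈ Ev.seg a m → x ∉ Od.seg b l
      Ev∩Od a m b l h h' p q with Ev.seg⁻ a m p | Od.seg⁻ b l q
      ... | i , _ , u , refl | j , _ , u' , e = e≢o (≤-trans u h) (≤-trans u' h') e

      -- The two chords forced by a chord (0, 2a+2) of colour α close up the even and odd halves.
      chord : ∀ a d → suc (a + d) ≡ k → E β (G 0) (G (suc (suc (double a))))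
      chord a d k≡ = not-E λ e → none β (cycle
          (G 2 , G (suc (suc (suc (double a)))) ,
            join evens (subst (λ t → E β (G t) (G (suc (double a)))) (suc-injective (Chord.n≡ R a d k≡)) (Chord.chord₂ R a d k≡ e))
              (join (rev (Od.seg-path 0 a a≤)) wrap (rev odds)) ,
            E-sym (Chord.chord₁ R a d k≡ e))
          (Unique-++ (Ev.seg-unique 1 (a + d) (≤-reflexive k≡))
            (Unique-++ (Od.seg-unique 0 a a≤) (Od.seg-unique (suc a) d (≤-reflexive k≡))
                (Od.seg-disjoint 0 a (suc a) d a≤ (≤-reflexive k≡) ≤-refl))
            λ p q → ++-elim (Od.seg 0 a) q (Ev∩Od 1 (a + d) 0 a (≤-reflexive k≡) a≤ p)
                (Ev∩Od 1 (a + d) (suc a) d (≤-reflexive k≡) (≤-reflexive k≡) p))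
          (trans (length-++ (Ev.seg 1 (a + d))) (trans (cong₂ _+_ (Ev.seg-size 1 (a + d))
              (trans (length-++ (Od.seg 0 a)) (cong₂ _+_ (Od.seg-size 0 a) (Od.seg-size (suc a) d))))
            (trans (linear-≡ 2 (λ a d → # 1 ⊕ (a ⊕ d) ⊕ (# 1 ⊕ a ⊕ (# 1 ⊕ d)) :≤ # 1 ⊕ 2 ⊛ (# 1 ⊕ (a ⊕ d))) (a ∷ d ∷ []))
              (cong suc (trans (cong (2 *_) k≡) (sym (double-* k))))))) λ _ → tt)
        where
        a≤ : a ≤ k
        a≤ = ≤-trans (≤-trans (m≤m+n a d) (n≤1+n _)) (≤-reflexive k≡)
        evens : HamPath β (G 2) (G (double k)) (Ev.seg 1 (a + d))
        evens = subst (λ t → HamPath β (G 2) (G (double t)) (Ev.seg 1 (a + d))) k≡ (Ev.seg-path 1 (a + d) (≤-reflexive k≡))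
        odds : HamPath β (G (suc (double (suc a)))) (G n) (Od.seg (suc a) d)
        odds = subst (λ t → HamPath β (G (suc (double (suc a)))) (G (suc (double t))) (Od.seg (suc a) d)) k≡
            (Od.seg-path (suc a) d (≤-reflexive k≡))
        wrap : E β (G 1) (G n)
        wrap = E-sym (subst (E β (G n)) (per 1) (next-next R n))

    even-chord : (R : Round c c-sym α (suc n) S) → ∀ p a → suc a ≤ k → E β (Round.F R p) (Round.F R (p + suc (suc (double a))))
    even-chord R p a h with rotate c c-sym R p
    ... | R' , e = subst₂ (E β) (trans (e 0) (cong (Round.F R) (+-identityʳ p))) (e _)
      (Halves.chord R' a (proj₁ (m≤n⇒∃[o]m+o≡n h)) (proj₂ (m≤n⇒∃[o]m+o≡n h)))

  -- Two large cliques of one colour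

  -- Each clique has one vertex more than a part of K_{k+1,k+1,k+1}, because the centre of a star
  -- may have to be removed from it later. The total of 3k + 1 guarantees that the larger clique has
  -- at least half as many vertices.
  record Twin (β : Colour) (k : ℕ) : Set where
    field
      P Q : List V
      P-unique : Unique P
      Q-unique : Unique Q
      disjoint : ∀ {x} → x ∈ P → x ∉ Q
      P-clique : Clique β P
      Q-clique : Clique β Q
      between : Complete (op β) P Q
      P-size : 2 + k ≤ length P
      Q-size : 2 + k ≤ length Q
      size : 3 * k + 1 ≤ length P + length Q

  flip-twin : ∀ {β k} → Twin β k → Twin β k
  flip-twin T = record { P = Q ; Q = P ; P-unique = Q-unique ; Q-unique = P-unique ; disjoint = λ p q → disjoint q p
                       ; P-clique = Q-clique ; Q-clique = P-clique ; between = λ p q → E-sym (between q p)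
                       ; P-size = Q-size ; Q-size = P-size ; size = ≤-trans size (≤-reflexive (+-comm (length P) (length Q))) }
    where open Twin T

  module Pairing {k : ℕ} (6≤k : 6 ≤ k) (N≥ : 3 * k + 2 ≤ N) (none : No c c-sym (suc (2 * k))) where

    1≤k : 1 ≤ k
    1≤k = ≤-trans (s≤s z≤n) 6≤k

    complete-op : ∀ {β X Y} → Complete (op β) X Y → Complete (op β) Y X
    complete-op h p q = E-sym (h q p)

    -- An edge of the other colour inside `X` would be the odd ingredient of a C_{2k+1} between `X`
    -- and `Y`.
    clique-of : ∀ {β X Y} → Unique X → Unique Y → (∀ {x} → x ∈ X → x ∉ Y) → Complete (op β) X Y →
      suc k ≤ length X → k ≤ length Y → Clique β X
    clique-of {β} uX uY d h lX lY {u} {v} p q u≢v with E? β u v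
    ... | yes e = e
    ... | no ¬e = ⊥-elim (none (op β) (odd-cycle-edge 1≤k uX uY d h lX lY p q u≢v (not-E ¬e) (λ _ → tt) (λ _ → tt)))

    clique-small : ∀ {β X} → Unique X → Clique β X → length X ≤ 2 * k
    clique-small {β} {X} u h with suc (2 * k) ≤? length X
    ... | yes l = ⊥-elim (none β (big-clique 1≤k h u l λ _ → tt))
    ... | no l = ≤-pred (≰⇒> l)

    -- If X is short, a vertex with few neighbours in Y may be moved into it.
    transfer : ∀ {β X Y g} → Unique X → Unique Y → (∀ {x} → x ∈ X → x ∉ Y) → Complete (op β) X Y → g ∉ X → g ∉ Y →
      Clique β Y → suc k ≤ length X → 2 * k ≤ length Y → Twin β k
    transfer {β} {X} {Y} {g} uX uY d h g∉X g∉Y hY lX lY = record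
      { P = g ∷ X ; Q = Y'
      ; P-unique = Unique-cons g∉X uX ; Q-unique = Unique-∖ uY
      ; disjoint = dis ; P-clique = clique-of {X = g ∷ X} {Y = Y'} (Unique-cons g∉X uX) (Unique-∖ uY) dis bet (s≤s (≤-trans (n≤1+n k) lX))
          (≤-trans (≤-trans (n≤1+n k) (n≤1+n _)) lY')
      ; Q-clique = λ p q → hY (proj₁ (∖⁻ Y B p)) (proj₁ (∖⁻ Y B q))
      ; between = bet
      ; P-size = s≤s lX
      ; Q-size = lY'
      ; size = lin 4 (λ k x y b → (# 1 ⊕ k :≤ x) ∷ (2 ⊛ k :≤ y ⊕ b) ∷ (b :≤ # 1) ∷ [] ⊢ 3 ⊛ k ⊕ # 1 :≤ # 1 ⊕ x ⊕ y)
          (k ∷ length X ∷ length Y' ∷ length B ∷ []) (lX , ≤-trans lY (card-∖ B uY) , lB) }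
      where
      B : List V
      B = filter (E? β g) Y
      uB : Unique B
      uB = Uniq.filter⁺ (E? β g) uY
      B⁻ : ∀ {y} → y ∈ B → y ∈ Y × E β g y
      B⁻ = ∈-filter⁻ (E? β g) {xs = Y}
      insert : ∀ {a b} → a ∈ Y → b ∈ Y → a ≢ b → E β g a → E β g b → ⊥
      insert p q a≢b e e' = none β (go 1≤k lY)
        where
        go : 1 ≤ k → 2 * k ≤ length Y → Cycle β (suc (2 * k)) Anywhere
        go (s≤s {n = j} _) l = subst (λ t → Cycle β (suc (suc t)) Anywhere) (sym (+-suc j (j + 0)))
          (clique-insert hY uY (subst (λ t → suc t ≤ length Y) (+-suc j (j + 0)) l) g∉Y p q a≢b e e' tt λ _ → tt)
      lB : length B ≤ 1
      lB = at-most-one uB same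
        where
        same : ∀ {x y} → x ∈ B → y ∈ B → x ≡ y
        same {x} {y} p q with x ≟ y
        ... | yes e = e
        ... | no ne = ⊥-elim (insert (proj₁ (B⁻ p)) (proj₁ (B⁻ q)) ne (proj₂ (B⁻ p)) (proj₂ (B⁻ q)))
      Y' : List V
      Y' = Y ∖ B
      lY' : 2 + k ≤ length Y'
      lY' = lin 3 (λ k y b → (# 6 :≤ k) ∷ (2 ⊛ k :≤ y ⊕ b) ∷ (b :≤ # 1) ∷ [] ⊢ # 2 ⊕ k :≤ y)
          (k ∷ length Y' ∷ length B ∷ []) (6≤k , ≤-trans lY (card-∖ B uY) , lB)
      dis : ∀ {x} → x ∈ g ∷ X → x ∉ Y'
      dis (here refl) q = g∉Y (proj₁ (∖⁻ Y B q))
      dis (there p) q = d p (proj₁ (∖⁻ Y B q))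
      bet : Complete (op β) (g ∷ X) Y'
      bet (here refl) q = not-E λ e → proj₂ (∖⁻ Y B q) (∈-filter⁺ (E? β g) (proj₁ (∖⁻ Y B q)) e)
      bet (there p) q = h p (proj₁ (∖⁻ Y B q))

    -- `X` and `Y` have at least 3k + 1 vertices together. If one of them had just k, the other
    -- would be a clique on 2k + 1 vertices; if it has k + 1, the other has at least 2k, and the
    -- left-over vertex `g` is used to raise it to k + 2.
    pair : ∀ {β X Y g} → Unique X → Unique Y → (∀ {x} → x ∈ X → x ∉ Y) → Complete (op β) X Y → g ∉ X → g ∉ Y →
      k ≤ length X → k ≤ length Y → N ≤ length X + length Y + 1 → Twin β k
    pair {β} {X} {Y} {g} uX uY d h g∉X g∉Y lX lY cover with suc k ≤? length X | suc k ≤? length Y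
    ... | no ¬a | no ¬b = ⊥-elim (1≰0 (lin 4 (λ k x y N → (3 ⊛ k ⊕ # 2 :≤ N) ∷ (N :≤ x ⊕ y ⊕ # 1) ∷ (# 1 ⊕ x :≤ # 1 ⊕ k) ∷
        (# 1 ⊕ y :≤ # 1 ⊕ k) ∷ [] ⊢ # 1 :≤ # 0)
          (k ∷ length X ∷ length Y ∷ N ∷ []) (N≥ , cover , ≰⇒> ¬a , ≰⇒> ¬b)))
    ... | no ¬a | yes b = ⊥-elim (1≰0 (lin 4 (λ k x y N → (3 ⊛ k ⊕ # 2 :≤ N) ∷ (N :≤ x ⊕ y ⊕ # 1) ∷ (# 1 ⊕ x :≤ # 1 ⊕ k) ∷ (y :≤ 2 ⊛ k) ∷ []
        ⊢ # 1 :≤ # 0)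
          (k ∷ length X ∷ length Y ∷ N ∷ []) (N≥ , cover , ≰⇒> ¬a , clique-small uY
              (clique-of uY uX (λ p q → d q p) (complete-op h) b lX))))
    ... | yes a | no ¬b = ⊥-elim (1≰0 (lin 4 (λ k x y N → (3 ⊛ k ⊕ # 2 :≤ N) ∷ (N :≤ x ⊕ y ⊕ # 1) ∷ (# 1 ⊕ y :≤ # 1 ⊕ k) ∷ (x :≤ 2 ⊛ k) ∷ []
        ⊢ # 1 :≤ # 0)
          (k ∷ length X ∷ length Y ∷ N ∷ []) (N≥ , cover , ≰⇒> ¬b , clique-small uX (clique-of uX uY d h a lY))))
    ... | yes a | yes b with 2 + k ≤? length X | 2 + k ≤? length Y
    ...   | yes a' | yes b' = record { P = X ; Q = Y ; P-unique = uX ; Q-unique = uY ; disjoint = d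
              ; P-clique = clique-of uX uY d h a lY ; Q-clique = clique-of uY uX (λ p q → d q p) (complete-op h) b lX
              ; between = h ; P-size = a' ; Q-size = b'
              ; size = lin 4 (λ k x y N → (3 ⊛ k ⊕ # 2 :≤ N) ∷ (N :≤ x ⊕ y ⊕ # 1) ∷ [] ⊢ 3 ⊛ k ⊕ # 1 :≤ x ⊕ y)
                  (k ∷ length X ∷ length Y ∷ N ∷ []) (N≥ , cover) }
    ...   | no ¬a' | _ = transfer uX uY d h g∉X g∉Y (clique-of uY uX (λ p q → d q p) (complete-op h) b lX) a
              (lin 4 (λ k x y N → (3 ⊛ k ⊕ # 2 :≤ N) ∷ (N :≤ x ⊕ y ⊕ # 1) ∷ (# 1 ⊕ x :≤ # 2 ⊕ k) ∷ [] ⊢ 2 ⊛ k :≤ y)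
                  (k ∷ length X ∷ length Y ∷ N ∷ []) (N≥ , cover , ≰⇒> ¬a'))
    ...   | yes _ | no ¬b' = flip-twin (transfer uY uX (λ p q → d q p) (complete-op h) g∉Y g∉X (clique-of uX uY d h a lY) b
              (lin 4 (λ k x y N → (3 ⊛ k ⊕ # 2 :≤ N) ∷ (N :≤ x ⊕ y ⊕ # 1) ∷ (# 1 ⊕ y :≤ # 2 ⊕ k) ∷ [] ⊢ 2 ⊛ k :≤ x)
                  (k ∷ length X ∷ length Y ∷ N ∷ []) (N≥ , cover , ≰⇒> ¬b')))

    module _ {α : Colour} where
      β : Colour
      β = op α

      op-β : ∀ {u v} → E (op β) u v → E α u v
      op-β {u} {v} e = trans e (op-op α)

      -- Every vertex outside A and B is joined in β to all of A or all of B, apart from one vertex c₀.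
      grow : ∀ {A B} → Unique A → Unique B → (∀ {x} → x ∈ A → x ∉ B) → Clique β A → Clique β B →
        length A ≡ suc k → length B ≡ suc k → Twin β k
      grow {A} {B} uA uB A∩B hA hB lA lB = result
        where
        4≤k : 4 ≤ k
        4≤k = ≤-trans (s≤s (s≤s (s≤s (s≤s z≤n)))) 6≤k
        blob₀ : ∀ K → Unique K → Clique β K → length K ≡ suc k → Blob β (suc k) (_∈ K)
        blob₀ K u h l = record { K = K ; K-unique = u ; K-size = ≤-reflexive (sym l) ; K-clique = h ; K⊂Q = id
                               ; foot = λ p q → ⊥-elim (q p) }
        R₀ : V → V → Set
        R₀ a b = a ∈ A × b ∈ B × E β a b
        star₀ : ∃ λ z → ∀ {a b} → R₀ a b → a ≡ z ⊎ b ≡ z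
        star₀ = star R₀ (λ a b → (a ∈? A) ×-dec ((b ∈? B) ×-dec E? β a b))
          (λ (p , q , e) (p' , q' , e') ne ne' → none β (two-blobs 4≤k (blob₀ A uA hA lA) (blob₀ B uB hB lB) A∩B p q e p' q' e' ne ne'))
          (proj₁ (pick {as = []} uA (≤-trans (s≤s z≤n) (≤-reflexive (sym lA)))))
        c₀ : V
        c₀ = proj₁ star₀
        A' B' : List V
        A' = A ∖ (c₀ ∷ [])
        B' = B ∖ (c₀ ∷ [])
        A'⊂A : A' ⊑ A
        A'⊂A p = proj₁ (∖⁻ A _ p)
        B'⊂B : B' ⊑ B
        B'⊂B p = proj₁ (∖⁻ B _ p)
        lA' : k ≤ length A'
        lA' = ≤-pred (≤-trans (≤-reflexive (sym lA)) (≤-trans (card-∖ (c₀ ∷ []) uA) (≤-reflexive (+-comm _ 1))))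
        lB' : k ≤ length B'
        lB' = ≤-pred (≤-trans (≤-reflexive (sym lB)) (≤-trans (card-∖ (c₀ ∷ []) uB) (≤-reflexive (+-comm _ 1))))
        across : Complete α A' B'
        across p q = op-β (not-E λ e → [ (λ r → proj₂ (∖⁻ A _ p) (here r)) , (λ r → proj₂ (∖⁻ B _ q) (here r)) ]
          (proj₂ star₀ (A'⊂A p , B'⊂B q , e)))
        Left : V → Set
        Left x = x ∈ A ⊎ (x ∉ B × All (E β x) A')
        Left? : ∀ x → Dec (Left x)
        Left? x = (x ∈? A) ⊎-dec (¬? (x ∈? B) ×-dec All.all? (E? β x) A')
        -- A vertex with edges of colour α to both `A'` and `B'` would be the odd vertex of a
        -- C_{2k+1} of colour α, as all edges between these sets have colour α.
        right-β : ∀ {x} → ¬ Left x → x ∉ B → ∀ {o} → o ∈ B' → E β x o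
        right-β {x} ¬l x∉B {o} o∈ with E? β x o
        ... | yes e = e
        ... | no ¬e with All.all? (E? β x) A'
        ...   | yes all = ⊥-elim (¬l (inj₂ (x∉B , all)))
        ...   | no ¬all = ⊥-elim (bad (AllP.¬All⇒Any¬ (E? β x) A' ¬all))
          where
          bad : Any (λ y → ¬ E β x y) A' → ⊥
          bad any with find any
          ... | e , e∈ , ¬xe = none α (odd-cycle {X = A'} {Y = B'} 1≤k (Unique-∖ uA) (Unique-∖ uB) (λ p q → A∩B (A'⊂A p) (B'⊂B q)) across
              lA' lB'
            (λ p → ¬l (inj₁ (A'⊂A p))) (λ p → x∉B (B'⊂B p)) e∈ o∈ (op-β (not-E ¬xe)) (op-β (not-E ¬e)) tt (λ _ → tt) (λ _ → tt))
        foot-in : ∀ {K' x} → Unique K' → k ≤ length K' → (∀ {y} → y ∈ K' → E β x y) → ∀ p q →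
          ∃ λ g → g ∈ K' × E β x g × g ≢ p × g ≢ q
        foot-in u l h p q with pick {as = p ∷ q ∷ []} u (≤-trans (≤-trans (s≤s (s≤s (s≤s z≤n))) 4≤k) l)
        ... | g , g∈ , g∉ = g , g∈ , h g∈ , (λ e → g∉ (here e)) , (λ e → g∉ (there (here e)))
        left-blob : Blob β (suc k) Left
        left-blob = record { K = A ; K-unique = uA ; K-size = ≤-reflexive (sym lA) ; K-clique = hA ; K⊂Q = inj₁ ; foot = foot }
          where
          foot : ∀ {a} → Left a → a ∉ A → ∀ p q → ∃ λ g → g ∈ A × E β a g × g ≢ p × g ≢ q
          foot (inj₁ m) a∉ = ⊥-elim (a∉ m)
          foot (inj₂ (_ , h)) a∉ p q with foot-in {A'} (Unique-∖ uA) lA' (All.lookup h) p q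
          ... | g , m , r = g , A'⊂A m , r
        right-blob : Blob β (suc k) (¬_ ∘ Left)
        right-blob = record { K = B ; K-unique = uB ; K-size = ≤-reflexive (sym lB) ; K-clique = hB
          ; K⊂Q = λ { m (inj₁ m') → A∩B m' m ; m (inj₂ (n , _)) → n m } ; foot = foot }
          where
          foot : ∀ {a} → ¬ Left a → a ∉ B → ∀ p q → ∃ λ g → g ∈ B × E β a g × g ≢ p × g ≢ q
          foot ¬l a∉ p q with foot-in {B'} (Unique-∖ uB) lB' (right-β ¬l a∉) p q
          ... | g , m , r = g , B'⊂B m , r
        -- Both sides are now blobs, so the edges of colour β between them again form a star; once
        -- its centre `g` is set aside, only colour α remains between the sides.
        R₁ : V → V → Set
        R₁ a b = Left a × ¬ Left b × E β a b
        star₁ : ∃ λ z → ∀ {a b} → R₁ a b → a ≡ z ⊎ b ≡ z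
        star₁ = star R₁ (λ a b → Left? a ×-dec (¬? (Left? b) ×-dec E? β a b))
          (λ (p , q , e) (p' , q' , e') ne ne' → none β (two-blobs 4≤k left-blob right-blob (λ l r → r l) p q e p' q' e' ne ne'))
          c₀
        g : V
        g = proj₁ star₁
        X₀ Y₀ X Y : List V
        X₀ = filter Left? vertices
        Y₀ = filter (λ x → ¬? (Left? x)) vertices
        X = X₀ ∖ (g ∷ [])
        Y = Y₀ ∖ (g ∷ [])
        uX₀ : Unique X₀
        uX₀ = Uniq.filter⁺ Left? vertices-unique
        uY₀ : Unique Y₀
        uY₀ = Uniq.filter⁺ (λ x → ¬? (Left? x)) vertices-unique
        X-left : ∀ {x} → x ∈ X → Left x
        X-left p = proj₂ (∈-filter⁻ Left? {xs = vertices} (proj₁ (∖⁻ X₀ _ p)))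
        Y-right : ∀ {x} → x ∈ Y → ¬ Left x
        Y-right p = proj₂ (∈-filter⁻ (λ x → ¬? (Left? x)) {xs = vertices} (proj₁ (∖⁻ Y₀ _ p)))
        g∉X : g ∉ X
        g∉X p = proj₂ (∖⁻ X₀ _ p) (here refl)
        g∉Y : g ∉ Y
        g∉Y p = proj₂ (∖⁻ Y₀ _ p) (here refl)
        big : ∀ {K Z} → Unique K → length K ≡ suc k → K ∖ (g ∷ []) ⊑ Z → k ≤ length Z
        big {K} {Z} u l s = ≤-pred (≤-trans (≤-reflexive (sym l)) (≤-trans (card-∖ (g ∷ []) u)
            (≤-trans (≤-reflexive (+-comm _ 1)) (s≤s (card (Unique-∖ u) s)))))
        A⊂X : A ∖ (g ∷ []) ⊑ X
        A⊂X p = ∖⁺ (∈-filter⁺ Left? (∈-allFin _) (inj₁ (proj₁ (∖⁻ A _ p)))) (proj₂ (∖⁻ A _ p))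
        B⊂Y : B ∖ (g ∷ []) ⊑ Y
        B⊂Y p = ∖⁺ (∈-filter⁺ (λ x → ¬? (Left? x)) (∈-allFin _) (Blob.K⊂Q right-blob (proj₁ (∖⁻ B _ p)))) (proj₂ (∖⁻ B _ p))
        cover : N ≤ length X + length Y + 1
        cover = ≤-trans (vertices-card (X ++ (Y ++ g ∷ [])) all) (≤-reflexive
            (trans (length-++ X) (trans (cong (length X +_) (length-++ Y)) (sym (+-assoc (length X) (length Y) 1)))))
          where
          all : ∀ x → x ∈ X ++ (Y ++ g ∷ [])
          all x = place (x ≟ g) (Left? x)
            where
            place : Dec (x ≡ g) → Dec (Left x) → x ∈ X ++ (Y ++ g ∷ [])
            place (yes e) _ = ∈-++⁺ʳ X (∈-++⁺ʳ Y (here e))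
            place (no x≢g) (yes l) = ∈-++⁺ˡ (∖⁺ (∈-filter⁺ Left? (∈-allFin x) l) λ { (here e) → x≢g e })
            place (no x≢g) (no r) = ∈-++⁺ʳ X (∈-++⁺ˡ (∖⁺ (∈-filter⁺ (λ x → ¬? (Left? x)) (∈-allFin x) r) λ { (here e) → x≢g e }))
        result : Twin β k
        result = pair {X = X} {Y = Y} (Unique-∖ uX₀) (Unique-∖ uY₀) (λ p q → Y-right q (X-left p))
          (λ {x} {y} p q → not-E λ e → [ (λ { refl → g∉X p }) , (λ { refl → g∉Y q }) ] (proj₂ star₁ (X-left p , Y-right q , e)))
          g∉X g∉Y (big {A} {X} uA lA A⊂X) (big {B} {Y} uB lB B⊂Y) cover

      from-cycle : Cycle α (suc (suc (2 * k))) Anywhere → Twin β k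
      from-cycle (cycle {S} ham uS lS _) = grow uA uB dis cA cB (Evens.size) (Odds.size)
        where
        none' : No c c-sym (suc (double k))
        none' = subst (λ t → No c c-sym (suc t)) (sym (double-* k)) none
        R : Round c c-sym α (suc (suc (double k))) S
        R = round c c-sym ham uS (trans lS (cong (2 +_) (sym (double-* k))))
        module EO = EvenOdd 1≤k none' {α} {S}
        module H = EO.Halves R
        open Round R using (F)
        module Evens where
          size : length (H.Ev.seg 0 k) ≡ suc k
          size = H.Ev.seg-size 0 k
        module Odds where
          size : length (H.Od.seg 0 k) ≡ suc k
          size = H.Od.seg-size 0 k
        uA : Unique (H.Ev.seg 0 k)
        uA = H.Ev.seg-unique 0 k ≤-refl
        uB : Unique (H.Od.seg 0 k)
        uB = H.Od.seg-unique 0 k ≤-refl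
        dis : ∀ {x} → x ∈ H.Ev.seg 0 k → x ∉ H.Od.seg 0 k
        dis = H.Ev∩Od 0 k 0 k ≤-refl ≤-refl
        chord : ∀ p {i j} → i < j → j ≤ k → E β (F (p + double i)) (F (p + double j))
        chord p {i} {j} i<j j≤k = subst (λ t → E β (F (p + double i)) (F t)) eq
            (EO.even-chord R (p + double i) d (≤-trans (≤-trans (m≤n+m (suc d) i) (≤-reflexive (trans (+-suc i d) d-eq))) j≤k))
          where
          d : ℕ
          d = proj₁ (m≤n⇒∃[o]m+o≡n i<j)
          d-eq : suc i + d ≡ j
          d-eq = proj₂ (m≤n⇒∃[o]m+o≡n i<j)
          eq : p + double i + suc (suc (double d)) ≡ p + double j
          eq = trans (+-assoc p (double i) _) (cong (p +_) (trans (sym (double-+ i (suc d))) (cong double (trans (+-suc i d) d-eq))))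
        clq : ∀ p {K : List V} → (∀ {x} → x ∈ K → ∃ λ i → i ≤ k × x ≡ F (p + double i)) → Clique β K
        clq p h {u} {v} m m' u≢v with h m | h m'
        ... | i , i≤ , refl | j , j≤ , refl with <-cmp i j
        ...   | tri< l _ _ = chord p l j≤
        ...   | tri≈ _ refl _ = ⊥-elim (u≢v refl)
        ...   | tri> _ _ l = E-sym (chord p l i≤)
        cA : Clique β (H.Ev.seg 0 k)
        cA = clq 0 λ m → let (i , _ , u , e) = H.Ev.seg⁻ 0 k m in i , u , e
        cB : Clique β (H.Od.seg 0 k)
        cB = clq 1 λ m → let (i , _ , u , e) = H.Od.seg⁻ 0 k m in i , u , e

  -- The conclusion is a double negation because `no-long-cycles` only refutes the absence of a
  -- C_{2k+2} and exhibits none.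
  twin : ∀ {k} → 6 ≤ k → 3 * k + 2 ≤ N → No c c-sym (suc (2 * k)) → (∀ β → Twin β k → ⊥) → ⊥
  twin {k} 6≤k N≥ none no-twin = no-long-cycles {k} (≤-trans (s≤s (s≤s z≤n)) 6≤k) N≥ none
    λ α C → no-twin (op α) (Pairing.from-cycle 6≤k N≥ none C)

-- A vertex of large blue degree

lookup-injective : ∀ {A : Set} {xs : List A} → Unique xs → ∀ {i j} → lookup xs i ≡ lookup xs j → i ≡ j
lookup-injective {xs = x ∷ xs} u {zero} {zero} e = refl
lookup-injective {xs = x ∷ xs} u {zero} {suc j} e = ⊥-elim (Unique-head u (subst (_∈ xs) (sym e) (∈-lookup j)))
lookup-injective {xs = x ∷ xs} u {suc i} {zero} e = ⊥-elim (Unique-head u (subst (_∈ xs) e (∈-lookup i)))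
lookup-injective {xs = x ∷ xs} u {suc i} {suc j} e = cong suc (lookup-injective (Unique-tail u) e)

-- Results about all of K_M are applied to a set of vertices of K_N by pulling the colouring back
-- along an enumeration of the set.
module Pull {M N : ℕ} (c : Colouring N) (c-sym : Symmetric c) (g : Fin M → Fin N) (g-inj : ∀ {i j} → g i ≡ g j → i ≡ j) where

  c' : Colouring M
  c' i j = c (g i) (g j)

  c'-sym : Symmetric c'
  c'-sym i j = c-sym (g i) (g j)

  module G = Graph c c-sym
  module G' = Graph c' c'-sym

  path : ∀ {α u v S} → G'.HamPath α u v S → G.HamPath α (g u) (g v) (map g S)
  path (Graph.one u) = Graph.one (g u)
  path (Graph.join {S = S} {T} p e q) = subst (G.HamPath _ _ _) (sym (map-++ g S T)) (Graph.join (path p) e (path q))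
  path (Graph.perm h p) = Graph.perm (map⁺ g h) (path p)

  image-unique : ∀ {S} → Unique S → Unique (map g S)
  image-unique = Uniq.map⁺ g-inj

  image-∈ : ∀ {S x} → g x ∈ map g S → x ∈ S
  image-∈ {S} p with ∈-map⁻ g p
  ... | y , q , e = subst (_∈ S) (sym (g-inj e)) q

  pull-cycle : ∀ {α n P Q} → (∀ {x} → P x → Q (g x)) → G'.Cycle α n P → G.Cycle α n Q
  pull-cycle {Q = Q} h (Graph.cycle {S} (u , v , p , e) uS l w) =
    Graph.cycle (g u , g v , path p , e) (image-unique uS) (trans (length-map g S) l) sat
    where
    sat : ∀ {x} → x ∈ map g S → Q x
    sat m with ∈-map⁻ g m
    ... | y , q , refl = h (w q)

  image-disjoint : ∀ {S T} → (∀ {x} → x ∈ S → x ∉ T) → ∀ {x} → x ∈ map g S → x ∉ map g T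
  image-disjoint d p q with ∈-map⁻ g p
  ... | y , r , refl = d r (image-∈ q)

  pull-twin : ∀ {β k} → Twin c' c'-sym β k → Σ (Twin c c-sym β k) λ T →
    (∀ {x} → x ∈ Twin.P T ⊎ x ∈ Twin.Q T → ∃ λ i → x ≡ g i)
  pull-twin {β} {k} T = record
      { P = map g P ; Q = map g Q ; P-unique = image-unique P-unique ; Q-unique = image-unique Q-unique
      ; disjoint = image-disjoint disjoint
      ; P-clique = clq P-clique ; Q-clique = clq Q-clique ; between = bet
      ; P-size = ≤-trans P-size (≤-reflexive (sym (length-map g P)))
      ; Q-size = ≤-trans Q-size (≤-reflexive (sym (length-map g Q)))
      ; size = ≤-trans size (≤-reflexive (sym (cong₂ _+_ (length-map g P) (length-map g Q)))) }
    , λ { (inj₁ p) → from p ; (inj₂ p) → from p }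
    where
    open Twin T
    from : ∀ {S x} → x ∈ map g S → ∃ λ i → x ≡ g i
    from p with ∈-map⁻ g p
    ... | i , _ , e = i , e
    clq : ∀ {K} → G'.Clique β K → G.Clique β (map g K)
    clq h p q ne with ∈-map⁻ g p | ∈-map⁻ g q
    ... | i , p' , refl | j , q' , refl = h p' q' λ e → ne (cong g e)
    bet : G.Complete (op β) (map g P) (map g Q)
    bet p q with ∈-map⁻ g p | ∈-map⁻ g q
    ... | i , p' , refl | j , q' , refl = between p' q'

module Degrees {N : ℕ} (c : Colouring N) (c-sym : Symmetric c) (k : ℕ) where
  open Graph c c-sym

  tripartite : ∀ {A B C} → Unique A → Unique B → Unique C →
    suc k ≤ length A → suc k ≤ length B → suc k ≤ length C →
    (∀ {x} → x ∈ A → x ∉ B) → (∀ {x} → x ∈ A → x ∉ C) → (∀ {x} → x ∈ B → x ∉ C) →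
    Complete blue A B → Complete blue A C → Complete blue B C → Tripartite c c-sym k
  tripartite {A} {B} {C} uA uB uC lA lB lC AB AC BC hAB hAC hBC = record
    { K = K ; K-unique = u ; K-size = l ; K-disjoint = d ; K-blue = h }
    where
    K : Fin 3 → List V
    K zero = A
    K (suc zero) = B
    K (suc (suc zero)) = C
    u : ∀ i → Unique (K i)
    u zero = uA
    u (suc zero) = uB
    u (suc (suc zero)) = uC
    l : ∀ i → suc k ≤ length (K i)
    l zero = lA
    l (suc zero) = lB
    l (suc (suc zero)) = lC
    d : ∀ {i j x} → i ≢ j → x ∈ K i → x ∉ K j
    d {zero} {zero} ne = ⊥-elim (ne refl)
    d {zero} {suc zero} _ = AB
    d {zero} {suc (suc zero)} _ = AC
    d {suc zero} {zero} _ p q = AB q p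
    d {suc zero} {suc zero} ne = ⊥-elim (ne refl)
    d {suc zero} {suc (suc zero)} _ = BC
    d {suc (suc zero)} {zero} _ p q = AC q p
    d {suc (suc zero)} {suc zero} _ p q = BC q p
    d {suc (suc zero)} {suc (suc zero)} ne = ⊥-elim (ne refl)
    h : ∀ {i j} → i ≢ j → Complete blue (K i) (K j)
    h {zero} {zero} ne = ⊥-elim (ne refl)
    h {zero} {suc zero} _ = hAB
    h {zero} {suc (suc zero)} _ = hAC
    h {suc zero} {zero} _ p q = E-sym (hAB q p)
    h {suc zero} {suc zero} ne = ⊥-elim (ne refl)
    h {suc zero} {suc (suc zero)} _ = hBC
    h {suc (suc zero)} {zero} _ p q = E-sym (hAC q p)
    h {suc (suc zero)} {suc zero} _ p q = E-sym (hBC q p)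
    h {suc (suc zero)} {suc (suc zero)} ne = ⊥-elim (ne refl)

  nbrs : Colour → V → List V
  nbrs α v = filter (λ x → ¬? (v ≟ x) ×-dec E? α v x) vertices

  nbrs-unique : ∀ α v → Unique (nbrs α v)
  nbrs-unique α v = Uniq.filter⁺ (λ x → ¬? (v ≟ x) ×-dec E? α v x) vertices-unique

  nbrs⁻ : ∀ {α v x} → x ∈ nbrs α v → v ≢ x × E α v x
  nbrs⁻ {α} {v} p = proj₂ (∈-filter⁻ (λ x → ¬? (v ≟ x) ×-dec E? α v x) {xs = vertices} p)

  nbrs⁺ : ∀ {α v x} → v ≢ x → E α v x → x ∈ nbrs α v
  nbrs⁺ {α} {v} {x} ne e = ∈-filter⁺ (λ x → ¬? (v ≟ x) ×-dec E? α v x) (∈-allFin x) (ne , e)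

  degrees : ∀ v → N ≤ suc (length (nbrs red v) + length (nbrs blue v))
  degrees v = ≤-trans (vertices-card (v ∷ nbrs red v ++ nbrs blue v) all) (≤-reflexive (cong suc (length-++ (nbrs red v))))
    where
    all : ∀ x → x ∈ v ∷ nbrs red v ++ nbrs blue v
    all x = place (v ≟ x) (E? red v x)
      where
      place : Dec (v ≡ x) → Dec (E red v x) → x ∈ v ∷ nbrs red v ++ nbrs blue v
      place (yes e) _ = here (sym e)
      place (no ne) (yes e) = there (∈-++⁺ˡ (nbrs⁺ ne e))
      place (no ne) (no ¬e) = there (∈-++⁺ʳ (nbrs red v) (nbrs⁺ ne (not-E ¬e)))

-- Linear forests with all ends in a clique

module _ {N : ℕ} (c : Colouring N) (c-sym : Symmetric c) (k : ℕ) where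
  open Graph c c-sym
  open Degrees c c-sym k

  endpoint : ∀ {α u v S} → HamPath α u v S → u ∈ S
  endpoint (one u) = here refl
  endpoint (join p _ _) = ∈-++⁺ˡ (endpoint p)
  endpoint (perm h p) = ∈-resp-↭ h (endpoint p)

  -- Disjoint paths with both ends in O; the first list consists of their first vertices.
  data Forest (α : Colour) (O : List V) : List V → List V → Set where
    [] : Forest α O [] []
    grow : ∀ {h t S hs T} → HamPath α h t S → h ∈ O → t ∈ O → Forest α O hs T → Forest α O (h ∷ hs) (S ++ T)

  heads⊂ : ∀ {α O hs T} → Forest α O hs T → hs ⊑ T
  heads⊂ (grow p _ _ f) (here refl) = ∈-++⁺ˡ (endpoint p)
  heads⊂ (grow {S = S} p _ _ f) (there q) = ∈-++⁺ʳ S (heads⊂ f q)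

  heads-in : ∀ {α O hs T} → Forest α O hs T → hs ⊑ O
  heads-in (grow _ h _ f) (here refl) = h
  heads-in (grow _ _ _ f) (there q) = heads-in f q

  Unique-++⁻ : ∀ S {T : List V} → Unique (S ++ T) → Unique T × (∀ {x} → x ∈ S → x ∉ T)
  Unique-++⁻ [] u = u , λ ()
  Unique-++⁻ (x ∷ S) u with Unique-++⁻ S (Unique-tail u)
  ... | uT , d = uT , λ { (here refl) q → Unique-head u (∈-++⁺ʳ S q) ; (there p) q → d p q }

  heads-unique : ∀ {α O hs T} → Forest α O hs T → Unique T → Unique hs
  heads-unique [] u = AllPairs.[]
  heads-unique (grow {S = S} p _ _ f) u = Unique-cons (λ q → proj₂ (Unique-++⁻ S u) (endpoint p) (heads⊂ f q))
    (heads-unique f (proj₁ (Unique-++⁻ S u)))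

  record Extracted (α : Colour) (O : List V) (a : V) (hs T : List V) : Set where
    field
      {t} : V
      {S hs' T'} : List V
      path : HamPath α a t S
      t∈O : t ∈ O
      rest : Forest α O hs' T'
      support : T ↭ S ++ T'
      heads : hs ↭ a ∷ hs'

  extract : ∀ {α O hs T a} → a ∈ hs → Forest α O hs T → Extracted α O a hs T
  extract (here refl) (grow p _ t∈ f) = record { path = p ; t∈O = t∈ ; rest = f ; support = ↭-refl ; heads = ↭-refl }
  extract {a = a} (there q) (grow {h} {S = S₀} p h∈ t∈ f) = record
      { path = path ; t∈O = t∈O ; rest = grow p h∈ t∈ rest
      ; support = ↭-trans (++⁺ˡ S₀ support) (shifts S₀ S) ; heads = ↭-trans (prep h heads) (swap h a ↭-refl) }
    where open Extracted (extract q f)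

  -- The paths of the forest end in the clique `O`, so clique edges string them together in any
  -- order.
  chain : ∀ {α O h hs T} → Clique α O → Forest α O (h ∷ hs) T → Unique T → ∃ λ t → HamPath α h t T × t ∈ O × t ∈ T
  chain hO (grow {h} {t} {S} p h∈ t∈ []) u = t , perm (↭-reflexive (sym (++-identityʳ S))) p , t∈ , ∈-++⁺ˡ (endpoint (rev p))
  chain hO (grow {h} {t} {S} p h∈ t∈ f@(grow _ h'∈ _ _)) u with chain hO f (proj₁ (Unique-++⁻ S u))
  ... | t' , q , t'∈ , m = t' , join p (hO t∈ h'∈ λ { refl → proj₂ (Unique-++⁻ S u) (endpoint (rev p)) (endpoint q) }) q , t'∈ , ∈-++⁺ʳ S m

  chain-cycle : ∀ {α O h h' hs T} → Clique α O → Forest α O (h ∷ h' ∷ hs) T → Unique T → HamCycle α T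
  chain-cycle hO (grow {h} {t} {S} p h∈ t∈ f) u with chain hO f (proj₁ (Unique-++⁻ S u))
  ... | t' , q , t'∈ , m = h , t' , join p (hO t∈ (heads-in f (here refl)) λ
      { refl → proj₂ (Unique-++⁻ S u) (endpoint (rev p)) (endpoint q) }) q
        , hO t'∈ h∈ λ { refl → proj₂ (Unique-++⁻ S u) (endpoint p) m }

  -- Cliques in blue neighbourhoods

  module CaseOne (6≤k : 6 ≤ k) (N≥ : 5 * k + 3 ≤ N) (N≤ : N ≤ 5 * k + 3)
      (noRed : NoRed c c-sym k) (noWheel : NoWheel c c-sym k) (noTri : Tripartite c c-sym k → ⊥) where

    private
      B : V → List V
      B = nbrs blue

      1≤k : 1 ≤ k
      1≤k = ≤-trans (s≤s z≤n) 6≤k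

      4≤k : 4 ≤ k
      4≤k = ≤-trans (s≤s (s≤s (s≤s (s≤s z≤n)))) 6≤k

    twin-in : ∀ v → 3 * k + 2 ≤ length (B v) →
      (∀ β (T : Twin c c-sym β k) → (∀ {x} → x ∈ Twin.P T ⊎ x ∈ Twin.Q T → x ∈ B v) → ⊥) → ⊥
    twin-in v l kont = twin Pu.c' Pu.c'-sym 6≤k l none λ β T → kont β (proj₁ (Pu.pull-twin T)) λ p → inB (proj₂ (Pu.pull-twin T) p)
      where
      module Pu = Pull c c-sym (lookup (B v)) (lookup-injective (nbrs-unique blue v))
      none : No Pu.c' Pu.c'-sym (suc (2 * k))
      none red C = noRed (Pu.pull-cycle (λ _ → tt) C)
      none blue C = noWheel v (Pu.pull-cycle (λ {i} _ → nbrs⁻ (∈-lookup {xs = B v} i)) C)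
      inB : ∀ {x} → (∃ λ i → x ≡ lookup (B v) i) → x ∈ B v
      inB (i , refl) = ∈-lookup i

    -- A vertex of the clique K is the hub.
    hub-clique : ∀ {K Z u u'} → Unique K → Unique Z → (∀ {x} → x ∈ Z → x ∉ K) → Clique blue K → Complete blue Z K →
      suc k ≤ length K → suc k ≤ length Z → u ∈ Z → u' ∈ Z → u ≢ u' → E blue u u' → ⊥
    hub-clique {e ∷ K} uK uZ d hK hZK lK lZ p q ne e' =
      noWheel e (odd-cycle-edge 1≤k uZ (Unique-tail uK) (λ r s → d r (there s)) (λ r s → hZK r (there s)) lZ (≤-pred lK) p q ne e'
        (λ r → (λ { refl → d r (here refl) }) , E-sym (hZK r (here refl)))
        (λ r → (λ { refl → Unique-head uK r }) , hK (here refl) (there r) (λ { refl → Unique-head uK r })))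

    module BlueTwin {X Y : List V} (uX : Unique X) (uY : Unique Y) (X∩Y : ∀ {x} → x ∈ X → x ∉ Y)
        (hX : Clique blue X) (hY : Clique blue Y) (hXY : Complete red X Y)
        (lX : length X ≡ suc k) (lY : length Y ≡ suc k) where

      W WX WY : List V
      W = vertices ∖ (X ++ Y)
      WX = filter (λ x → All.all? (E? blue x) X) W
      WY = filter (λ x → All.all? (E? blue x) Y) W

      W⁻ : ∀ {x} → x ∈ W → x ∉ X × x ∉ Y
      W⁻ p = (λ q → proj₂ (∖⁻ vertices (X ++ Y) p) (∈-++⁺ˡ q)) , (λ q → proj₂ (∖⁻ vertices (X ++ Y) p) (∈-++⁺ʳ X q))

      WX⁻ : ∀ {x} → x ∈ WX → x ∈ W × All (E blue x) X
      WX⁻ = ∈-filter⁻ (λ x → All.all? (E? blue x) X) {xs = W}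

      WY⁻ : ∀ {x} → x ∈ WY → x ∈ W × All (E blue x) Y
      WY⁻ = ∈-filter⁻ (λ x → All.all? (E? blue x) Y) {xs = W}

      -- A vertex with red edges to both cliques would be the odd vertex of a red C_{2k+1}
      -- alternating between `X` and `Y`.
      sides : W ⊑ WX ++ WY
      sides {x} p = place (All.all? (E? blue x) X) (All.all? (E? blue x) Y)
        where
        place : Dec (All (E blue x) X) → Dec (All (E blue x) Y) → x ∈ WX ++ WY
        place (yes h) _ = ∈-++⁺ˡ (∈-filter⁺ (λ x → All.all? (E? blue x) X) p h)
        place (no _) (yes h) = ∈-++⁺ʳ WX (∈-filter⁺ (λ x → All.all? (E? blue x) Y) p h)
        place (no ¬h) (no ¬h') = bad (find (AllP.¬All⇒Any¬ (E? blue x) X ¬h)) (find (AllP.¬All⇒Any¬ (E? blue x) Y ¬h'))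
          where
          bad : (∃ λ e → e ∈ X × ¬ E blue x e) → (∃ λ o → o ∈ Y × ¬ E blue x o) → x ∈ WX ++ WY
          bad (e , e∈ , ¬e) (o , o∈ , ¬o) = ⊥-elim (noRed (odd-cycle 1≤k uX uY X∩Y hXY
            (≤-trans (n≤1+n k) (≤-reflexive (sym lX))) (≤-trans (n≤1+n k) (≤-reflexive (sym lY)))
            (proj₁ (W⁻ p)) (proj₂ (W⁻ p)) e∈ o∈ (not-E ¬e) (not-E ¬o) tt (λ _ → tt) (λ _ → tt)))

      W-size : N ≤ length WX + length WY + (suc k + suc k)
      W-size = ≤-trans (vertices-card (W ++ (X ++ Y)) all) (≤-trans (≤-reflexive
          (trans (length-++ W) (cong (length W +_) (trans (length-++ X) (cong₂ _+_ lX lY)))))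
          (+-monoˡ-≤ _ (≤-trans (card (Unique-∖ vertices-unique) sides) (≤-reflexive (length-++ WX)))))
        where
        all : ∀ x → x ∈ W ++ (X ++ Y)
        all x = place (x ∈? (X ++ Y))
          where
          place : Dec (x ∈ X ++ Y) → x ∈ W ++ (X ++ Y)
          place (yes p) = ∈-++⁺ʳ W p
          place (no p) = ∈-++⁺ˡ (∖⁺ (∈-allFin x) p)

      uWX : Unique WX
      uWX = Uniq.filter⁺ (λ x → All.all? (E? blue x) X) (Unique-∖ vertices-unique)

      uWY : Unique WY
      uWY = Uniq.filter⁺ (λ x → All.all? (E? blue x) Y) (Unique-∖ vertices-unique)

      -- If `WX` has k + 1 vertices, the blue edge yields a wheel with hub in `X`. Otherwise `WY`
      -- has at least 5k + 3 - (2k + 2) - k = 2k + 1 vertices: a blue edge in it yields a wheel with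
      -- hub in `Y`, and without one it contains a red C_{2k+1}.
      contradiction-from : ∀ {v w} → v ∈ WX → w ∈ WX → v ≢ w → E blue v w → ⊥
      contradiction-from {v} {w} v∈ w∈ ne e with suc k ≤? length WX
      ... | yes l = hub-clique uX uWX (λ p → proj₁ (W⁻ (proj₁ (WX⁻ p)))) hX (λ p q → All.lookup (proj₂ (WX⁻ p)) q) (≤-reflexive (sym lX)) l
          v∈ w∈ ne e
      ... | no ¬l = noRed (big-clique 1≤k red-clique uWY big λ _ → tt)
        where
        big : suc (2 * k) ≤ length WY
        big = lin 4 (λ k N x y → (5 ⊛ k ⊕ # 3 :≤ N) ∷ (N :≤ x ⊕ y ⊕ ((# 1 ⊕ k) ⊕ (# 1 ⊕ k))) ∷ (# 1 ⊕ x :≤ # 1 ⊕ k) ∷ [] ⊢ # 1 ⊕ 2 ⊛ k :≤ y)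
          (k ∷ N ∷ length WX ∷ length WY ∷ []) (N≥ , W-size , ≰⇒> ¬l)
        red-clique : Clique red WY
        red-clique {a} {b} p q a≢b with E? red a b
        ... | yes r = r
        ... | no ¬r = ⊥-elim (hub-clique uY uWY (λ p → proj₂ (W⁻ (proj₁ (WY⁻ p)))) hY (λ p q → All.lookup (proj₂ (WY⁻ p)) q)
            (≤-reflexive (sym lY))
              (≤-trans (s≤s (m≤m+n k (k + 0))) big) p q a≢b (not-E ¬r))

    -- The vertex `v` is joined in blue to both cliques, so together with any further blue neighbour
    -- it spans a blue edge in `WX` or in `WY`.
    no-blue-twin : ∀ v → 3 * k + 2 ≤ length (B v) → (T : Twin c c-sym blue k) →
      (∀ {x} → x ∈ Twin.P T ⊎ x ∈ Twin.Q T → x ∈ B v) → ⊥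
    no-blue-twin v l T inB = main (pick {as = X ++ Y} (nbrs-unique blue v) room)
      where
      open Twin T
      module SP = Selection (select {suc k} [] P-unique (≤-trans (≤-reflexive (+-identityʳ _)) (≤-trans (n≤1+n _) P-size)))
      module SQ = Selection (select {suc k} [] Q-unique (≤-trans (≤-reflexive (+-identityʳ _)) (≤-trans (n≤1+n _) Q-size)))
      X = SP.list
      Y = SQ.list
      room : length (X ++ Y) < length (B v)
      room = lin 3 (λ k s b → (3 ⊛ k ⊕ # 2 :≤ b) ∷ (s :≤ # 2 ⊕ 2 ⊛ k) ∷ (# 6 :≤ k) ∷ [] ⊢ # 1 ⊕ s :≤ b)
        (k ∷ length (X ++ Y) ∷ length (B v) ∷ [])
        (l , ≤-reflexive (trans (length-++ X) (trans (cong₂ _+_ SP.size SQ.size)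
            (linear-≡ 1 (λ k → (# 1 ⊕ k) ⊕ (# 1 ⊕ k) :≤ # 2 ⊕ 2 ⊛ k) (k ∷ [])))) , 6≤k)
      module BT = BlueTwin SP.unique SQ.unique (λ p q → disjoint (SP.from p) (SQ.from q)) (λ p q → P-clique (SP.from p) (SP.from q))
        (λ p q → Q-clique (SQ.from p) (SQ.from q)) (λ p q → between (SP.from p) (SQ.from q)) SP.size SQ.size
      module BT' = BlueTwin SQ.unique SP.unique (λ p q → disjoint (SP.from q) (SQ.from p)) (λ p q → Q-clique (SQ.from p) (SQ.from q))
        (λ p q → P-clique (SP.from p) (SP.from q)) (λ p q → E-sym (between (SP.from q) (SQ.from p))) SQ.size SP.size
      vX : ∀ {x} → x ∈ X → x ∈ B v
      vX p = inB (inj₁ (SP.from p))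
      vY : ∀ {x} → x ∈ Y → x ∈ B v
      vY p = inB (inj₂ (SQ.from p))
      v∉ : v ∉ X ++ Y
      v∉ p = ++-elim X p (λ q → proj₁ (nbrs⁻ (vX q)) refl) (λ q → proj₁ (nbrs⁻ (vY q)) refl)
      v∉' : v ∉ Y ++ X
      v∉' p = ++-elim Y p (λ q → proj₁ (nbrs⁻ (vY q)) refl) (λ q → proj₁ (nbrs⁻ (vX q)) refl)
      main : (∃ λ w → w ∈ B v × w ∉ X ++ Y) → ⊥
      main (w , w∈ , w∉) = ++-elim BT.WX (BT.sides w∈W)
          (λ p → BT.contradiction-from (∈-filter⁺ (λ x → All.all? (E? blue x) X) v∈W (All.tabulate (λ q → proj₂ (nbrs⁻ (vX q))))) p
              (proj₁ (nbrs⁻ w∈)) (proj₂ (nbrs⁻ w∈)))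
          (λ p → BT'.contradiction-from
            (∈-filter⁺ (λ x → All.all? (E? blue x) Y) (∖⁺ (∈-allFin v) v∉') (All.tabulate (λ q → proj₂ (nbrs⁻ (vY q)))))
            (∈-filter⁺ (λ x → All.all? (E? blue x) Y) (∖⁺ (∈-allFin w) (λ q → ++-elim Y q (λ r → w∉ (∈-++⁺ʳ X r)) (λ r → w∉ (∈-++⁺ˡ r))))
                (proj₂ (BT.WY⁻ p)))
            (proj₁ (nbrs⁻ w∈)) (proj₂ (nbrs⁻ w∈)))
        where
        w∈W : w ∈ BT.W
        w∈W = ∖⁺ (∈-allFin w) w∉
        v∈W : v ∈ BT.W
        v∈W = ∖⁺ (∈-allFin v) v∉

    -- A red C_{2k+1} arises from the single vertices of O by repeatedly merging two paths with
    -- ends in O through a vertex of X.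
    module Merge {O X : List V} (uO : Unique O) (uX : Unique X) (O∩X : ∀ {x} → x ∈ O → x ∉ X) (hO : Clique red O)
        (lO : 3 * k + 1 ≤ length O + length O) (lX : length X ≤ suc (2 * k))
        (many : ∀ {o} → o ∈ O → 2 * k + 2 ≤ length (filter (E? red o) X) + length O) where

      ω : ℕ
      ω = length O

      toX : V → List V
      toX o = filter (E? red o) X

      toX⁻ : ∀ {o w} → w ∈ toX o → w ∈ X × E red o w
      toX⁻ {o} = ∈-filter⁻ (E? red o) {xs = X}

      -- After `j` merges, ω - j disjoint paths cover `O` and the set `D` of the `j` vertices of `X`
      -- used so far; an isolated vertex of `O` counts as a path.
      record State (j : ℕ) : Set where
        field
          {hs T D} : List V
          forest : Forest red O hs T
          unique : Unique T
          support : T ⊑ O ++ D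
          D⊂X : D ⊑ X
          D-unique : Unique D
          D-size : length D ≡ j
          count : length hs + j ≡ ω
          size : length T ≡ ω + j

      start : State 0
      start = record { D = [] ; D-unique = AllPairs.[] ; forest = proj₂ (singles O id) ; unique = subst Unique (sym (proj₁ (singles O id)))
          uO
          ; support = λ p → ∈-++⁺ˡ (subst (_ ∈_) (proj₁ (singles O id)) p) ; D⊂X = λ () ; D-size = refl
          ; count = +-identityʳ ω ; size = trans (cong length (proj₁ (singles O id))) (sym (+-identityʳ ω)) }
        where
        flat : List V → List V
        flat [] = []
        flat (x ∷ xs) = (x ∷ []) ++ flat xs
        singles : ∀ xs → xs ⊑ O → flat xs ≡ xs × Forest red O xs (flat xs)
        singles [] s = refl , []
        singles (x ∷ xs) s with singles xs (s ∘ there)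
        ... | e , f = cong (x ∷_) e , grow (one x) (s (here refl)) (s (here refl)) f

      Shared : List V → List V → Set
      Shared hs D = ∃ λ a → ∃ λ b → ∃ λ w → (a ∈ hs × b ∈ hs × a ≢ b) × (w ∈ X × w ∉ D) × (E red a w × E red b w)

      Shared? : ∀ hs D → Dec (Shared hs D)
      Shared? hs D = any? λ a → any? λ b → any? λ w →
        ((a ∈? hs) ×-dec ((b ∈? hs) ×-dec ¬? (a ≟ b))) ×-dec (((w ∈? X) ×-dec ¬? (w ∈? D)) ×-dec (E? red a w ×-dec E? red b w))

      unshared : ∀ {D hs} → Unique hs → D ⊑ X → Unique D → (∀ {h} → h ∈ hs → 2 + length D ≤ length (toX h)) → ¬ Shared hs D →
        length D + (length hs + length hs) ≤ length X
      unshared {D} {hs} uh D⊂X uD h none = go hs uh id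
        where
        free : V → List V
        free h = toX h ∖ D
        bundle : List V → List V
        bundle [] = []
        bundle (h ∷ hs) = free h ++ bundle hs
        free⁻ : ∀ {h w} → w ∈ free h → w ∈ X × w ∉ D × E red h w
        free⁻ {h} p = proj₁ (toX⁻ (proj₁ (∖⁻ (toX h) D p))) , proj₂ (∖⁻ (toX h) D p) , proj₂ (toX⁻ (proj₁ (∖⁻ (toX h) D p)))
        bundle⁻ : ∀ hs {w} → w ∈ bundle hs → ∃ λ h → h ∈ hs × w ∈ free h
        bundle⁻ (h ∷ hs) p = ++-elim (free h) p (λ q → h , here refl , q) λ q → let (h' , m , r) = bundle⁻ hs q in h' , there m , r
        bundle-unique : ∀ hs' → Unique hs' → hs' ⊑ hs → Unique (bundle hs')
        bundle-unique [] _ _ = AllPairs.[]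
        bundle-unique (x ∷ hs') u s = Unique-++ (Unique-∖ (Uniq.filter⁺ (E? red x) uX)) (bundle-unique hs' (Unique-tail u) (s ∘ there)) dis
          where
          dis : ∀ {w} → w ∈ free x → w ∉ bundle hs'
          dis {w} p q = let (y , m , r) = bundle⁻ hs' q in
            none (x , y , w , (s (here refl) , s (there m) , λ e → Unique-head u (subst (_∈ hs') (sym e) m))
                 , (proj₁ (free⁻ {x} p) , proj₁ (proj₂ (free⁻ {x} p))) , proj₂ (proj₂ (free⁻ {x} p)) , proj₂ (proj₂ (free⁻ {y} r)))
        bundle-size : ∀ hs' → hs' ⊑ hs → length hs' + length hs' ≤ length (bundle hs')
        bundle-size [] _ = z≤n
        bundle-size (x ∷ hs') s = ≤-trans (lin 4 (λ n f b d → (n ⊕ n :≤ b) ∷ (# 2 ⊕ d :≤ f ⊕ d) ∷ [] ⊢ (# 1 ⊕ n) ⊕ (# 1 ⊕ n) :≤ f ⊕ b)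
            (length hs' ∷ length (free x) ∷ length (bundle hs') ∷ length D ∷ [])
            (bundle-size hs' (s ∘ there) , ≤-trans (h (s (here refl))) (card-∖ D (Uniq.filter⁺ (E? red x) uX))))
                (≤-reflexive (sym (length-++ (free x))))
        go : ∀ hs' → Unique hs' → hs' ⊑ hs → length D + (length hs' + length hs') ≤ length X
        go hs' u s = ≤-trans (+-monoʳ-≤ (length D) (bundle-size hs' s)) (≤-trans (≤-reflexive (sym (length-++ D)))
          (card (Unique-++ uD (bundle-unique hs' u s) λ p q → proj₁ (proj₂ (free⁻ (proj₂ (proj₂ (bundle⁻ hs' q))))) p)
            λ p → ++-elim D p D⊂X λ q → proj₁ (free⁻ (proj₂ (proj₂ (bundle⁻ hs' q))))))

      join-heads : ∀ {j} (S : State j) → Shared (State.hs S) (State.D S) → State (suc j)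
      join-heads {j} S (a , b , w , (a∈ , b∈ , a≢b) , (w∈ , w∉) , aw , bw) = record
          { forest = grow (join (rev Ea.path) aw (join (one w) (E-sym bw) Eb.path)) Ea.t∈O Eb.t∈O Eb.rest
          ; unique = Unique-↭ (↭-sym support') (Unique-cons w∉T unique)
          ; support = λ p → lift (∈-resp-↭ support' p)
          ; D⊂X = λ { (here refl) → w∈ ; (there p) → D⊂X p }
          ; D-unique = Unique-cons w∉ D-unique
          ; D-size = cong suc D-size
          ; count = trans (+-suc (suc (length Eb.hs')) j) (trans (cong (_+ j)
              (sym (trans (↭-length Ea.heads) (cong suc (↭-length Eb.heads))))) count)
          ; size = trans (↭-length support') (trans (cong suc size) (sym (+-suc ω j))) }
        where
        open State S
        module Ea = Extracted (extract a∈ forest)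
        b∈' : b ∈ Ea.hs'
        b∈' with ∈-resp-↭ Ea.heads b∈
        ... | here e = ⊥-elim (a≢b (sym e))
        ... | there p = p
        module Eb = Extracted (extract b∈' Ea.rest)
        support' : (Ea.S ++ (w ∷ Eb.S)) ++ Eb.T' ↭ w ∷ T
        support' = ↭-trans (↭-reflexive (++-assoc Ea.S (w ∷ Eb.S) Eb.T')) (↭-trans (shift w Ea.S (Eb.S ++ Eb.T'))
          (prep w (↭-sym (↭-trans Ea.support (++⁺ˡ Ea.S Eb.support)))))
        w∉T : w ∉ T
        w∉T p = ++-elim O (support p) (λ q → O∩X q w∈) w∉
        lift : ∀ {x} → x ∈ w ∷ T → x ∈ O ++ (w ∷ State.D S)
        lift (here e) = ∈-++⁺ʳ O (here e)
        lift (there p) = ++-elim O (support p) ∈-++⁺ˡ (λ q → ∈-++⁺ʳ O (there q))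

      iterate : ∀ j → j + ω ≤ suc (2 * k) → State j
      iterate zero _ = start
      iterate (suc j) h = onward (iterate j (≤-trans (n≤1+n _) h))
        where
        onward : State j → State (suc j)
        onward S with Shared? (State.hs S) (State.D S)
        ... | yes s = join-heads S s
        -- From j + 2(ω - j) ≤ 2k + 1 and j + ω ≤ 2k follows 3ω ≤ 4k + 1, against 2ω ≥ 3k + 1.
        ... | no none = ⊥-elim (1≰0 (lin 6 (λ k ω j hs D X →
              (3 ⊛ k ⊕ # 1 :≤ ω ⊕ ω) ∷ (3 ⊛ k ⊕ # 1 :≤ ω ⊕ ω) ∷ (3 ⊛ k ⊕ # 1 :≤ ω ⊕ ω) ∷
              (# 1 ⊕ j ⊕ ω :≤ # 1 ⊕ 2 ⊛ k) ∷ (# 1 ⊕ j ⊕ ω :≤ # 1 ⊕ 2 ⊛ k) ∷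
              (D ⊕ (hs ⊕ hs) :≤ X) ∷ (D ⊕ (hs ⊕ hs) :≤ X) ∷ (X :≤ # 1 ⊕ 2 ⊛ k) ∷ (X :≤ # 1 ⊕ 2 ⊛ k) ∷
              (ω :≤ hs ⊕ j) ∷ (ω :≤ hs ⊕ j) ∷ (ω :≤ hs ⊕ j) ∷ (ω :≤ hs ⊕ j) ∷ (j :≤ D) ∷ (j :≤ D) ∷ [] ⊢ # 1 :≤ # 0)
              (k ∷ ω ∷ j ∷ length hs ∷ length D ∷ length X ∷ [])
              (lO , lO , lO , h , h , u , u , lX , lX , c≥ , c≥ , c≥ , c≥ , ≤-reflexive (sym D-size) , ≤-reflexive (sym D-size))))
          where
          open State S
          c≥ : ω ≤ length hs + j
          c≥ = ≤-reflexive (sym count)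
          u : length D + (length hs + length hs) ≤ length X
          u = unshared (heads-unique forest unique) D⊂X D-unique
            (λ {x} m → lin 5 (λ k ω j D t → (2 ⊛ k ⊕ # 2 :≤ t ⊕ ω) ∷ (# 1 ⊕ j ⊕ ω :≤ # 1 ⊕ 2 ⊛ k) ∷ (D :≤ j) ∷ [] ⊢ # 2 ⊕ D :≤ t)
              (k ∷ ω ∷ j ∷ length D ∷ length (toX x) ∷ []) (many (heads-in forest m) , h , ≤-reflexive D-size)) none

      absurd : ⊥
      absurd with suc (2 * k) ≤? ω
      ... | yes big = noRed (big-clique 1≤k hO uO big λ _ → tt)
      ... | no small = finish (iterate j (≤-reflexive j-eq)) j-eq
        where
        ω≤ : ω ≤ suc (2 * k)
        ω≤ = ≤-trans (≤-pred (≰⇒> small)) (n≤1+n _)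
        j : ℕ
        j = proj₁ (m≤n⇒∃[o]m+o≡n ω≤)
        j-eq : j + ω ≡ suc (2 * k)
        j-eq = trans (+-comm j ω) (proj₂ (m≤n⇒∃[o]m+o≡n ω≤))
        finish : ∀ {j} → State j → j + ω ≡ suc (2 * k) → ⊥
        finish {j} S e = close hs forest unique count
          where
          open State S
          -- The forest has the right number of vertices, and red edges of `O` close it to a cycle.
          -- This requires two different paths, and the count excludes fewer.
          close : ∀ hs' → Forest red O hs' T → Unique T → length hs' + j ≡ ω → ⊥
          close (h ∷ h' ∷ hs') f u _ = noRed (cycle (chain-cycle hO f u) u (trans size (trans (+-comm ω j) e)) λ _ → tt)
          close [] _ _ cnt = 1≰0 (lin 3 (λ k ω j → (3 ⊛ k ⊕ # 1 :≤ ω ⊕ ω) ∷ (j ⊕ ω :≤ # 1 ⊕ 2 ⊛ k) ∷ (ω :≤ j) ∷ (# 6 :≤ k) ∷ [] ⊢ # 1 :≤ #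
              0)
            (k ∷ ω ∷ j ∷ []) (lO , ≤-reflexive e , ≤-reflexive (sym cnt) , 6≤k))
          close (_ ∷ []) _ _ cnt = 1≰0 (lin 3 (λ k ω j → (3 ⊛ k ⊕ # 1 :≤ ω ⊕ ω) ∷ (j ⊕ ω :≤ # 1 ⊕ 2 ⊛ k) ∷ (ω :≤ # 1 ⊕ j) ∷ (# 6 :≤ k) ∷ []
              ⊢ # 1 :≤ # 0)
            (k ∷ ω ∷ j ∷ []) (lO , ≤-reflexive e , ≤-reflexive (sym cnt) , 6≤k))

    clique-blob : ∀ {K} → Unique K → Clique red K → suc k ≤ length K → Blob red (suc k) (_∈ K)
    clique-blob {K} u h l = record { K = K ; K-unique = u ; K-size = l ; K-clique = h ; K⊂Q = id ; foot = λ p q → ⊥-elim (q p) }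

    one-star : ∀ {A C} → Unique A → Unique C → Clique red A → Clique red C → suc k ≤ length A → suc k ≤ length C →
      (∀ {x} → x ∈ A → x ∉ C) → V → ∃ λ z → ∀ {a b} → a ∈ A → b ∈ C → a ≢ z → b ≢ z → E blue a b
    one-star {A} {C} uA uC hA hC lA lC d v = proj₁ s , λ p q a≢ b≢ → not-E λ e → [ a≢ , b≢ ] (proj₂ s (p , q , e))
      where
      R : V → V → Set
      R a b = a ∈ A × b ∈ C × E red a b
      s : ∃ λ z → ∀ {a b} → R a b → a ≡ z ⊎ b ≡ z
      s = star R (λ a b → (a ∈? A) ×-dec ((b ∈? C) ×-dec E? red a b))
        (λ (p , q , e) (p' , q' , e') ne ne' → noRed (two-blobs 4≤k (clique-blob uA hA lA) (clique-blob uC hC lC) d p q e p' q' e' ne ne'))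
            v

    -- `O` is disjoint from `A` and `C`, since its vertices are red to `o` and theirs blue. The red
    -- edges from `O` to each of the two form a star; deleting both centres costs `O` at most two
    -- vertices and `A` and `C` at most one each, which k + 3 and k + 2 vertices can afford.
    three-cliques : ∀ {o O A C} → Unique O → Unique A → Unique C → Clique red O → Clique red A → Clique red C →
      o ∈ O → (∀ {x} → x ∈ A ⊎ x ∈ C → x ∈ B o) → (∀ {x} → x ∈ A → x ∉ C) → Complete blue A C →
      3 * k + 1 ≤ length O + length O → 2 + k ≤ length A → 2 + k ≤ length C → ⊥
    three-cliques {o} {O} {A} {C} uO uA uC hO hA hC o∈ inB A∩C hAC lO lA lC =
      noTri (tripartite (Unique-∖ uA) (Unique-∖ uC) (Unique-∖ uO)
        (less lA (card-∖ (z ∷ []) uA)) (less lC (card-∖ (z' ∷ []) uC))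
        (≤-pred (≤-pred (≤-trans lO' (≤-trans (card-∖ (z ∷ z' ∷ []) uO) (≤-reflexive (+-comm _ 2))))))
        (λ p q → A∩C (proj₁ (∖⁻ A _ p)) (proj₁ (∖⁻ C _ q)))
        (λ p q → A∩O (inj₁ (proj₁ (∖⁻ A _ p))) (proj₁ (∖⁻ O _ q)))
        (λ p q → A∩O (inj₂ (proj₁ (∖⁻ C _ p))) (proj₁ (∖⁻ O _ q)))
        (λ p q → hAC (proj₁ (∖⁻ A _ p)) (proj₁ (∖⁻ C _ q)))
        (λ p q → proj₂ sA (proj₁ (∖⁻ A _ p)) (proj₁ (∖⁻ O _ q)) (λ e → proj₂ (∖⁻ A _ p) (here e)) (λ e → proj₂ (∖⁻ O _ q) (here e)))
        (λ p q → proj₂ sC (proj₁ (∖⁻ C _ p)) (proj₁ (∖⁻ O _ q)) (λ e → proj₂ (∖⁻ C _ p) (here e))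
            (λ e → proj₂ (∖⁻ O _ q) (there (here e)))))
      where
      A∩O : ∀ {x} → x ∈ A ⊎ x ∈ C → x ∉ O
      A∩O p q = E-op (hO o∈ q (proj₁ (nbrs⁻ (inB p)))) (proj₂ (nbrs⁻ (inB p)))
      lO' : 3 + k ≤ length O
      lO' with 3 + k ≤? length O
      ... | yes h = h
      ... | no h = ⊥-elim (1≰0 (lin 2 (λ k o → (3 ⊛ k ⊕ # 1 :≤ o ⊕ o) ∷ (# 1 ⊕ o :≤ # 3 ⊕ k) ∷ (# 1 ⊕ o :≤ # 3 ⊕ k) ∷ (# 6 :≤ k) ∷ [] ⊢ # 1
          :≤ # 0)
            (k ∷ length O ∷ []) (lO , ≰⇒> h , ≰⇒> h , 6≤k)))
      lO'' : suc k ≤ length O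
      lO'' = ≤-trans (≤-trans (n≤1+n _) (n≤1+n _)) lO'
      sA = one-star uA uO hA hO (≤-trans (n≤1+n _) lA) lO'' (λ p q → A∩O (inj₁ p) q) o
      sC = one-star uC uO hC hO (≤-trans (n≤1+n _) lC) lO'' (λ p q → A∩O (inj₂ p) q) o
      z z' : V
      z = proj₁ sA
      z' = proj₁ sC
      less : ∀ {x y} → 2 + k ≤ x → x ≤ y + 1 → suc k ≤ y
      less {x} {y} p q = ≤-pred (≤-trans p (≤-trans q (≤-reflexive (+-comm y 1))))

    -- A vertex of `Q` with at most 2k red neighbours has blue degree at least 3k + 2, and the
    -- cliques in its blue neighbourhood complete `Q` to three parts. If there is none, the red
    -- edges leaving `Q` all end outside `P` and `v`, in a set of at most 5k + 3 - (3k + 1) - 1 = 2k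
    -- + 1 vertices, and `Merge` applies.
    case-one-ordered : ∀ v → (T : Twin c c-sym red k) → (∀ {x} → x ∈ Twin.P T ⊎ x ∈ Twin.Q T → x ∈ B v) →
      length (Twin.P T) ≤ length (Twin.Q T) → ⊥
    case-one-ordered v T inB P≤Q with any? (λ o → (o ∈? Twin.Q T) ×-dec (length (nbrs red o) ≤? 2 * k))
    ... | yes (o , o∈ , few) = twin-in o (lin 4 (λ k N r b → (5 ⊛ k ⊕ # 3 :≤ N) ∷ (N :≤ # 1 ⊕ (r ⊕ b)) ∷ (r :≤ 2 ⊛ k) ∷ [] ⊢ 3 ⊛ k ⊕ # 2 :≤
        b)
            (k ∷ N ∷ length (nbrs red o) ∷ length (B o) ∷ []) (N≥ , degrees o , few)) both
      where
      both : ∀ β (T' : Twin c c-sym β k) → (∀ {x} → x ∈ Twin.P T' ⊎ x ∈ Twin.Q T' → x ∈ B o) → ⊥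
      both blue T' inB' = no-blue-twin o (lin 4 (λ k N r b → (5 ⊛ k ⊕ # 3 :≤ N) ∷ (N :≤ # 1 ⊕ (r ⊕ b)) ∷ (r :≤ 2 ⊛ k) ∷ [] ⊢ 3 ⊛ k ⊕ # 2 :≤
          b)
            (k ∷ N ∷ length (nbrs red o) ∷ length (B o) ∷ []) (N≥ , degrees o , few)) T' inB'
      both red T' inB' = three-cliques Q-unique T'.P-unique T'.Q-unique Q-clique T'.P-clique T'.Q-clique o∈ inB' T'.disjoint T'.between
          (≤-trans size (+-monoˡ-≤ _ P≤Q)) T'.P-size T'.Q-size
        where
        open Twin T
        module T' = Twin T'
    ... | no none = Merge.absurd Q-unique (Unique-∖ vertices-unique) (λ p q → proj₂ (∖⁻ vertices all q) (∈-++⁺ˡ p)) Q-clique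
          (≤-trans size (+-monoˡ-≤ _ P≤Q))
          (lin 5 (λ k N x o p → (x ⊕ (o ⊕ (p ⊕ # 1)) :≤ N) ∷ (N :≤ 5 ⊛ k ⊕ # 3) ∷ (3 ⊛ k ⊕ # 1 :≤ p ⊕ o) ∷ [] ⊢ x :≤ # 1 ⊕ 2 ⊛ k)
            (k ∷ N ∷ length X ∷ length Q ∷ length P ∷ []) (room , N≤ , size))
          many
      where
      open Twin T
      all : List V
      all = Q ++ (P ++ v ∷ [])
      X : List V
      X = vertices ∖ all
      room : length X + (length Q + (length P + 1)) ≤ N
      room = ≤-trans (≤-reflexive (sym (trans (length-++ X) (cong (length X +_) (trans (length-++ Q) (cong (length Q +_) (length-++ P)))))))
        (card-vertices (Unique-++ (Unique-∖ vertices-unique)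
          (Unique-++ Q-unique (Unique-++ P-unique (Unique-[] v) λ { p (here refl) → proj₁ (nbrs⁻ (inB (inj₁ p))) refl })
            λ p q → ++-elim P q (λ r → disjoint r p) λ { (here refl) → proj₁ (nbrs⁻ (inB (inj₂ p))) refl })
          λ p q → proj₂ (∖⁻ vertices all p) q))
      many : ∀ {o} → o ∈ Q → 2 * k + 2 ≤ length (filter (E? red o) X) + length Q
      many {o} o∈ = lin 5 (λ k r x q q' → (# 1 ⊕ 2 ⊛ k :≤ r) ∷ (r :≤ q' ⊕ x) ∷ (# 1 ⊕ q' :≤ q) ∷ [] ⊢ 2 ⊛ k ⊕ # 2 :≤ x ⊕ q)
          (k ∷ length (nbrs red o) ∷ length (filter (E? red o) X) ∷ length Q ∷ length (Q ∖ (o ∷ [])) ∷ [])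
          (≰⇒> (λ h → none (o , o∈ , h)) , ≤-trans (card (nbrs-unique red o) sub) (≤-reflexive (length-++ (Q ∖ (o ∷ []))))
            , card (Unique-cons (λ p → proj₂ (∖⁻ Q (o ∷ []) p) (here refl)) (Unique-∖ Q-unique)) λ
                { (here refl) → o∈ ; (there p) → proj₁ (∖⁻ Q (o ∷ []) p) })
        where
        sub : nbrs red o ⊑ (Q ∖ (o ∷ [])) ++ filter (E? red o) X
        sub {x} p = place (x ∈? Q) (x ∈? all)
          where
          place : Dec (x ∈ Q) → Dec (x ∈ all) → x ∈ (Q ∖ (o ∷ [])) ++ filter (E? red o) X
          place (yes q) _ = ∈-++⁺ˡ (∖⁺ q λ { (here e) → proj₁ (nbrs⁻ p) (sym e) })
          place (no _) (no a) = ∈-++⁺ʳ (Q ∖ (o ∷ [])) (∈-filter⁺ (E? red o) (∖⁺ (∈-allFin x) a) (proj₂ (nbrs⁻ p)))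
          place (no ¬q) (yes a) = ++-elim Q a (λ q → ⊥-elim (¬q q)) λ q → ++-elim P q
            (λ r → ⊥-elim (E-op {u = o} {v = x} (proj₂ (nbrs⁻ p)) (E-sym (between r o∈))))
            λ { (here refl) → ⊥-elim (E-op {u = o} {v = x} (proj₂ (nbrs⁻ p)) (E-sym (proj₂ (nbrs⁻ (inB (inj₂ o∈)))))) }

    case-one : ∀ v → 3 * k + 2 ≤ length (B v) → ⊥
    case-one v l = twin-in v l go
      where
      go : ∀ β (T : Twin c c-sym β k) → (∀ {x} → x ∈ Twin.P T ⊎ x ∈ Twin.Q T → x ∈ B v) → ⊥
      go blue T inB = no-blue-twin v l T inB
      go red T inB with ≤-total (length (Twin.P T)) (length (Twin.Q T))
      ... | inj₁ h = case-one-ordered v T inB h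
      ... | inj₂ h = case-one-ordered v (flip-twin c c-sym T) (λ { (inj₁ p) → inB (inj₂ p) ; (inj₂ p) → inB (inj₁ p) }) h

-- Red degrees at least 2k + 1

distinct-triple : ∀ {A : Set} {xs : List A} → Unique xs → 3 ≤ length xs →
  ∃ λ x → ∃ λ y → ∃ λ z → (x ∈ xs × y ∈ xs × z ∈ xs) × (x ≢ y × x ≢ z × y ≢ z)
distinct-triple {xs = x ∷ y ∷ z ∷ xs} u _ = x , y , z , (here refl , there (here refl) , there (there (here refl))) ,
  ((λ e → Unique-head u (here e)) , (λ e → Unique-head u (there (here e))) , λ e → Unique-head (Unique-tail u) (here e))
distinct-triple {xs = []} _ ()
distinct-triple {xs = _ ∷ []} _ (s≤s ())
distinct-triple {xs = _ ∷ _ ∷ []} _ (s≤s (s≤s ()))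

module _ {N : ℕ} (c : Colouring N) (c-sym : Symmetric c) (k : ℕ) where
  open Graph c c-sym
  open Degrees c c-sym k

  colour-split : ∀ v {xs} → Unique xs → length xs ≤ length (filter (E? blue v) xs) + length (filter (E? red v) xs)
  colour-split v {xs} u = ≤-trans (card u sub) (≤-reflexive (length-++ (filter (E? blue v) xs)))
    where
    sub : xs ⊑ filter (E? blue v) xs ++ filter (E? red v) xs
    sub {x} p = place (E? blue v x)
      where
      place : Dec (E blue v x) → x ∈ filter (E? blue v) xs ++ filter (E? red v) xs
      place (yes e) = ∈-++⁺ˡ (∈-filter⁺ (E? blue v) p e)
      place (no ¬e) = ∈-++⁺ʳ (filter (E? blue v) xs) (∈-filter⁺ (E? red v) p (not-E ¬e))

  module CaseTwo (6≤k : 6 ≤ k) (N≥ : 5 * k + 3 ≤ N) (N≤ : N ≤ 5 * k + 3)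
      (noRed : NoRed c c-sym k) (noWheel : NoWheel c c-sym k) (noTri : Tripartite c c-sym k → ⊥)
      (degree : ∀ v → suc (2 * k) ≤ length (nbrs red v)) where

    private
      R : V → List V
      R = nbrs red

      uR : ∀ {v} → Unique (R v)
      uR {v} = nbrs-unique red v

      1≤k : 1 ≤ k
      1≤k = ≤-trans (s≤s z≤n) 6≤k

    Triangle : V → V → V → Set
    Triangle x y z = (x ≢ y × x ≢ z × y ≢ z) × (E red x y × E red x z × E red y z)

    -- Red neighbourhoods are blue cliques, so they have at most 2k + 1 vertices. A vertex outside
    -- two disjoint ones is red to all but at most two vertices of each, hence has at least 4k - 2
    -- red neighbours, which is too many.
    triangle-free : (∀ {x y z} → Triangle x y z → ⊥) → ⊥
    triangle-free none = start (pick {as = []} vertices-unique (≤-trans (≤-trans (s≤s z≤n) (≤-trans (≤-reflexive (+-comm 3 (5 * k))) N≥))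
        (≤-reflexive (sym vertices-size))))
      where
      R-clique : ∀ {x} → Clique blue (R x)
      R-clique p q ne = not-E λ e → none ((proj₁ (nbrs⁻ p) , proj₁ (nbrs⁻ q) , ne) , (proj₂ (nbrs⁻ p) , proj₂ (nbrs⁻ q) , e))
      spokes : ∀ {x h} → h ∈ R x → ∀ {v} → v ∈ R x ∖ (h ∷ []) → h ≢ v × E blue h v
      spokes {x} {h} p {v} q = h≢v , R-clique p (proj₁ (∖⁻ (R x) _ q)) h≢v
        where
        h≢v : h ≢ v
        h≢v e = proj₂ (∖⁻ (R x) _ q) (here (sym e))
      rest-clique : ∀ x h → Clique blue (R x ∖ (h ∷ []))
      rest-clique x h p q = R-clique {x} (proj₁ (∖⁻ (R x) _ p)) (proj₁ (∖⁻ (R x) _ q))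
      rest-size : ∀ x h → length (R x) ≤ suc (length (R x ∖ (h ∷ [])))
      rest-size x h = ≤-trans (card-∖ (h ∷ []) uR) (≤-reflexive (+-comm _ 1))
      R-size : ∀ x → length (R x) ≤ suc (2 * k)
      R-size x = ≮⇒≥ λ l → hub l (pick {as = []} (uR {x}) (≤-trans (s≤s z≤n) l))
        where
        hub : 2 + 2 * k ≤ length (R x) → (∃ λ h → h ∈ R x × h ∉ []) → ⊥
        hub l (h , p , _) = noWheel h (big-clique 1≤k (rest-clique x h) (Unique-∖ uR) (≤-pred (≤-trans l (rest-size x h))) (spokes p))
      -- One of three blue neighbours of `w` in the blue clique `R x` becomes the hub, and `w` is
      -- inserted between the other two on the rim.
      side : ∀ x w → w ∉ R x → 3 ≤ length (filter (E? blue w) (R x)) → ⊥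
      side x w w∉ l = go (distinct-triple (Uniq.filter⁺ (E? blue w) uR) l)
          (m≤n⇒∃[o]m+o≡n {2} {2 * k} (≤-trans (s≤s (s≤s z≤n)) (≤-trans 6≤k (m≤m+n k _))))
        where
        B : List V
        B = filter (E? blue w) (R x)
        go : (∃ λ p → ∃ λ p' → ∃ λ p'' → (p ∈ B × p' ∈ B × p'' ∈ B) × (p ≢ p' × p ≢ p'' × p' ≢ p'')) → (∃ λ n → 2 + n ≡ 2 * k) → ⊥
        go (p , p' , p'' , (p∈ , p'∈ , p''∈) , (n , n' , n'')) (m , e) = noWheel p (subst (λ t → Cycle blue (suc t) (BlueNbr c c-sym k p)) e
            (clique-insert (rest-clique x p) (Unique-∖ uR) (≤-trans (≤-reflexive e) (≤-pred (≤-trans (degree x) (rest-size x p))))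
              (λ q → w∉ (proj₁ (∖⁻ (R x) _ q))) (∖⁺ (inR p'∈) λ { (here r) → n (sym r) }) (∖⁺ (inR p''∈) λ { (here r) → n' (sym r) }) n''
              (wB p'∈) (wB p''∈) ((λ { refl → w∉ (inR p∈) }) , E-sym (wB p∈)) (spokes (inR p∈))))
          where
          inR : ∀ {q} → q ∈ B → q ∈ R x
          inR r = proj₁ (∈-filter⁻ (E? blue w) {xs = R x} r)
          wB : ∀ {q} → q ∈ B → E blue w q
          wB r = proj₂ (∈-filter⁻ (E? blue w) {xs = R x} r)
      apart : ∀ {u v} → v ∈ R u → ∀ {x} → x ∈ R u → x ∉ R v
      apart {u} {v} p q r = none ((proj₁ (nbrs⁻ p) , proj₁ (nbrs⁻ q) , proj₁ (nbrs⁻ r)) ,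
          (proj₂ (nbrs⁻ p) , proj₂ (nbrs⁻ q) , proj₂ (nbrs⁻ r)))
      outer : ∀ u v → v ∈ R u → (∃ λ w → w ∈ vertices × w ∉ R u ++ R v) → ⊥
      outer u v v∈ (w , _ , w∉) = 1≰0 (lin 8 (λ k u v w bu bv ru rv →
          (# 1 ⊕ 2 ⊛ k :≤ u) ∷ (# 1 ⊕ 2 ⊛ k :≤ v) ∷ (w :≤ # 1 ⊕ 2 ⊛ k) ∷ (u :≤ bu ⊕ ru) ∷ (v :≤ bv ⊕ rv) ∷ (ru ⊕ rv :≤ w) ∷ (bu :≤ # 2) ∷
              (bv :≤ # 2) ∷ (# 6 :≤ k) ∷ [] ⊢ # 1 :≤ # 0)
          (k ∷ length (R u) ∷ length (R v) ∷ length (R w) ∷ length (filter (E? blue w) (R u)) ∷ length (filter (E? blue w) (R v))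
            ∷ length (filter (E? red w) (R u)) ∷ length (filter (E? red w) (R v)) ∷ [])
          (degree u , degree v , R-size w , colour-split w uR , colour-split w uR
            , ≤-trans (≤-reflexive (sym (length-++ (filter (E? red w) (R u)))))
                (card reds-unique λ p → ++-elim (filter (E? red w) (R u)) p (inR w∉u) (inR w∉v))
            , ≤-pred (≰⇒> (side u w w∉u)) , ≤-pred (≰⇒> (side v w w∉v)) , 6≤k))
        where
        w∉u : w ∉ R u
        w∉u p = w∉ (∈-++⁺ˡ p)
        w∉v : w ∉ R v
        w∉v p = w∉ (∈-++⁺ʳ (R u) p)
        inR : ∀ {t} → w ∉ R t → filter (E? red w) (R t) ⊑ R w
        inR {t} w∉t p = nbrs⁺ (λ { refl → w∉t (proj₁ (∈-filter⁻ (E? red w) {xs = R t} p)) }) (proj₂ (∈-filter⁻ (E? red w) {xs = R t} p))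
        reds-unique : Unique (filter (E? red w) (R u) ++ filter (E? red w) (R v))
        reds-unique = Unique-++ (Uniq.filter⁺ (E? red w) uR) (Uniq.filter⁺ (E? red w) uR)
          λ p q → apart v∈ (proj₁ (∈-filter⁻ (E? red w) {xs = R u} p)) (proj₁ (∈-filter⁻ (E? red w) {xs = R v} q))
      start : (∃ λ u → u ∈ vertices × u ∉ []) → ⊥
      start (u , _) = edge (pick {as = []} (uR {u}) (≤-trans (s≤s z≤n) (degree u)))
        where
        edge : (∃ λ v → v ∈ R u × v ∉ []) → ⊥
        edge (v , v∈ , _) = outer u v v∈ (pick {as = R u ++ R v} vertices-unique
          (lin 5 (λ k N s u v → (s :≤ u ⊕ v) ∷ (u :≤ # 1 ⊕ 2 ⊛ k) ∷ (v :≤ # 1 ⊕ 2 ⊛ k) ∷ (5 ⊛ k ⊕ # 3 :≤ N) ∷ [] ⊢ # 1 ⊕ s :≤ N)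
            (k ∷ length vertices ∷ length (R u ++ R v) ∷ length (R u) ∷ length (R v) ∷ [])
            (≤-reflexive (length-++ (R u)) , R-size u , R-size v , ≤-trans N≥ (≤-reflexive (sym vertices-size)))))

    -- Otherwise the three red neighbourhoods, each without the two other vertices of the triangle,
    -- are disjoint and miss `x`; this makes 1 + 3(2k - 1) = 6k - 2 vertices, more than 5k + 3 as k
    -- ≥ 6.
    overlapping : (∀ {x y z w} → Triangle x y z → w ∈ R x → w ∈ R y → w ≢ z → ⊥) → ∀ {x y z} → Triangle x y z → ⊥
    overlapping common {x} {y} {z} T@((x≢y , x≢z , y≢z) , (xy , xz , yz)) = 1≰0 (lin 5 (λ k N a b d →
        (# 1 ⊕ (a ⊕ (b ⊕ d)) :≤ N) ∷ (N :≤ 5 ⊛ k ⊕ # 3) ∷ (# 1 ⊕ 2 ⊛ k :≤ a ⊕ # 2) ∷ (# 1 ⊕ 2 ⊛ k :≤ b ⊕ # 2) ∷ (# 1 ⊕ 2 ⊛ k :≤ d ⊕ # 2) ∷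
            (# 6 :≤ k) ∷ [] ⊢ # 1 :≤ # 0)
        (k ∷ N ∷ length A ∷ length B ∷ length D ∷ [])
        (≤-trans (≤-reflexive (cong suc (sym (trans (length-++ A) (cong (length A +_) (length-++ B)))))) (card-vertices unique) , N≤
          , big x y z , big y x z , big z x y , 6≤k))
      where
      A B D : List V
      A = R x ∖ (y ∷ z ∷ [])
      B = R y ∖ (x ∷ z ∷ [])
      D = R z ∖ (x ∷ y ∷ [])
      big : ∀ u v w → suc (2 * k) ≤ length (R u ∖ (v ∷ w ∷ [])) + 2
      big u v w = ≤-trans (degree u) (card-∖ (v ∷ w ∷ []) uR)
      unique : Unique (x ∷ A ++ (B ++ D))
      unique = Unique-cons
        (λ p → ++-elim A p (λ q → proj₁ (nbrs⁻ {v = x} (proj₁ (∖⁻ (R x) (y ∷ z ∷ []) q))) refl) λ q → ++-elim B q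
          (λ r → proj₂ (∖⁻ (R y) (x ∷ z ∷ []) r) (here refl)) (λ r → proj₂ (∖⁻ (R z) (x ∷ y ∷ []) r) (here refl)))
        (Unique-++ (Unique-∖ uR) (Unique-++ (Unique-∖ uR) (Unique-∖ uR)
            λ p q → common ((y≢z , x≢y ∘ sym , x≢z ∘ sym) , (yz , E-sym xy , E-sym xz)) (proj₁ (∖⁻ (R y) (x ∷ z ∷ []) p))
                (proj₁ (∖⁻ (R z) (x ∷ y ∷ []) q))
              λ e → proj₂ (∖⁻ (R y) (x ∷ z ∷ []) p) (here e))
          λ p q → ++-elim B q
            (λ r → common T (proj₁ (∖⁻ (R x) (y ∷ z ∷ []) p)) (proj₁ (∖⁻ (R y) (x ∷ z ∷ []) r)) λ e → proj₂ (∖⁻ (R x) (y ∷ z ∷ []) p)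
                (there (here e)))
            (λ r → common ((x≢z , x≢y , y≢z ∘ sym) , (xz , xy , E-sym yz)) (proj₁ (∖⁻ (R x) (y ∷ z ∷ []) p))
                (proj₁ (∖⁻ (R z) (x ∷ y ∷ []) r))
              λ e → proj₂ (∖⁻ (R x) (y ∷ z ∷ []) p) (here e)))

-- Red paths between two vertices of a red triangle

module _ {N : ℕ} (c : Colouring N) (c-sym : Symmetric c) (k : ℕ) where
  open Graph c c-sym
  open Degrees c c-sym k

  module Detour (6≤k : 6 ≤ k)
      (noRed : NoRed c c-sym k) (noWheel : NoWheel c c-sym k) (noTri : Tripartite c c-sym k → ⊥)
      (degree : ∀ v → suc (2 * k) ≤ length (nbrs red v))
      {x y y' : V} (xy : E red x y) (xy' : E red x y') (yy' : E red y y') where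

    private
      1≤k : 1 ≤ k
      1≤k = ≤-trans (s≤s z≤n) 6≤k

    Path : ℕ → Set
    Path s = Link red (_≢ y') s x y

    no-path-2k : Path (2 * k) → ⊥
    no-path-2k L = noRed (cycle (y' , y , join (one y') (E-sym xy') path , yy')
        (Unique-cons (λ p → within p refl) unique) (cong suc size) λ _ → tt)
      where open Link L

    no-path-2k+1 : Path (suc (2 * k)) → ⊥
    no-path-2k+1 L = noRed (cycle (x , y , path , E-sym xy) unique size λ _ → tt)
      where open Link L

    module Shorter {n : ℕ} (2≤n : 2 ≤ n) (n≤ : 2 + n ≤ 2 * k) (L : Path (suc n))
        (no₁ : Path (2 + n) → ⊥) (no₂ : Path (3 + n) → ⊥) where

      private
        S : List V
        S = Link.support L
      open Line (line (Link.path L) (Link.unique L) (Link.size L))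
      open Segments c c-sym {red} f n edge inj

      U : List V
      U = vertices ∖ (y' ∷ S)

      U-unique : Unique U
      U-unique = Unique-∖ vertices-unique

      U≢y' : ∀ {u} → u ∈ U → u ≢ y'
      U≢y' p e = proj₂ (∖⁻ vertices (y' ∷ S) p) (here e)

      U∉S : ∀ {u} → u ∈ U → u ∉ S
      U∉S p q = proj₂ (∖⁻ vertices (y' ∷ S) p) (there q)

      U≢f : ∀ {u i} → u ∈ U → i ≤ n → u ≢ f i
      U≢f p h refl = U∉S p (on h)

      seg⊂S : ∀ a m → a + m ≤ n → seg a m ⊑ S
      seg⊂S a m h p with seg⁻ a m p
      ... | i , _ , l , refl = on (≤-trans l h)

      -- The `l` vertices strictly between `f i` and `f j` are replaced by `l + 1` or `l + 2`
      -- vertices off the path; the ends x and y stay, and `y'` is still avoided.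
      detour : ∀ {i j t w w'} l → suc l + i ≡ j → j ≤ n → Link red (_∈ U) t w w' → t ≡ suc l ⊎ t ≡ 2 + l →
        E red (f i) w → E red w' (f j) → ⊥
      detour {i} {t = t} {w} {w'} l refl j≤n W t≡ e e' = go (m≤n⇒∃[o]m+o≡n j≤n)
        where
        module W = Link W
        go : (∃ λ r → suc l + i + r ≡ n) → ⊥
        go (r , eq) = [ (λ { refl → no₁ (subst Path (trans (linear-≡ 3 (λ i l r → (# 1 ⊕ i) ⊕ ((# 1 ⊕ l) ⊕ (# 1 ⊕ r)) :≤ # 2 ⊕
            ((# 1 ⊕ l) ⊕ i ⊕ r)) (i ∷ l ∷ r ∷ [])) (cong (2 +_) eq)) new) })
                      , (λ { refl → no₂ (subst Path (trans (linear-≡ 3 (λ i l r → (# 1 ⊕ i) ⊕ ((# 2 ⊕ l) ⊕ (# 1 ⊕ r)) :≤ # 3 ⊕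
                          ((# 1 ⊕ l) ⊕ i ⊕ r)) (i ∷ l ∷ r ∷ [])) (cong (3 +_) eq)) new) }) ] t≡
          where
          j : ℕ
          j = suc l + i
          i≤n : i ≤ n
          i≤n = ≤-trans (m≤n+m i (suc l)) j≤n
          j+r≤ : j + r ≤ n
          j+r≤ = ≤-reflexive eq
          new : Path (suc i + (t + suc r))
          new = record
            { path = subst₂ (λ a b → HamPath red a b (seg 0 i ++ (W.support ++ seg j r))) first (trans (cong f eq) last)
                (join (seg-path 0 i i≤n) e (join W.path e' (seg-path j r j+r≤)))
            ; unique = Unique-++ (seg-unique 0 i i≤n) (Unique-++ W.unique (seg-unique j r j+r≤) λ p q → U∉S (W.within p) (seg⊂S j r j+r≤ q))
                λ p q → ++-elim W.support q (λ q' → U∉S (W.within q') (seg⊂S 0 i i≤n p)) (seg-disjoint 0 i j r i≤n j+r≤ (s≤s (m≤n+m i l)) p)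
            ; size = trans (length-++ (seg 0 i)) (cong₂ _+_ (seg-size 0 i) (trans (length-++ W.support) (cong₂ _+_ W.size (seg-size j r))))
            ; within = λ p → ++-elim (seg 0 i) p (λ q → Link.within L (seg⊂S 0 i i≤n q))
                λ p' → ++-elim W.support p' (λ q → U≢y' (W.within q)) (λ q → Link.within L (seg⊂S j r j+r≤ q)) }

      -- The path f 0, ..., f i, u, f j, f (j - 1), ..., f (i + 1), f (j + 1), ..., f n.
      reversal : ∀ {i u} m → 2 + m + i ≤ n → u ∈ U → E red (f i) u → E red (f (suc m + i)) u → E blue (f (suc i)) (f (2 + m + i))
      reversal {i} {u} m h u∈ e e' = not-E λ e″ → go e″ (m≤n⇒∃[o]m+o≡n h)
        where
        j : ℕ
        j = suc m + i
        i≤n : i ≤ n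
        i≤n = ≤-trans (m≤n+m i (2 + m)) h
        mid≤ : suc i + m ≤ n
        mid≤ = ≤-trans (≤-reflexive (cong suc (+-comm i m))) (≤-trans (n≤1+n _) h)
        go : E red (f (suc i)) (f (suc j)) → (∃ λ r → suc j + r ≡ n) → ⊥
        go e″ (r , eq) = no₁ (record
            { path = subst₂ (λ a b → HamPath red a b (seg 0 i ++ (u ∷ (seg (suc i) m ++ seg (suc j) r)))) first (trans (cong f eq) last)
                (join (seg-path 0 i i≤n) e (join (one u) (E-sym (subst (λ t → E red (f t) u) (cong suc (+-comm m i)) e'))
                  (join (rev (seg-path (suc i) m mid≤)) e″ (seg-path (suc j) r j+r≤))))
            ; unique = Unique-++ (seg-unique 0 i i≤n) (Unique-cons
                  (λ p → ++-elim (seg (suc i) m) p (λ q → U∉S u∈ (seg⊂S (suc i) m mid≤ q)) (λ q → U∉S u∈ (seg⊂S (suc j) r j+r≤ q)))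
                  (Unique-++ (seg-unique (suc i) m mid≤) (seg-unique (suc j) r j+r≤)
                      (seg-disjoint (suc i) m (suc j) r mid≤ j+r≤ (s≤s (≤-reflexive (cong suc (+-comm i m)))))))
                λ { p (here refl) → U∉S u∈ (seg⊂S 0 i i≤n p)
                  ; p (there q) → ++-elim (seg (suc i) m) q (seg-disjoint 0 i (suc i) m i≤n mid≤ ≤-refl p)
                      (seg-disjoint 0 i (suc j) r i≤n j+r≤ (s≤s (≤-trans (m≤n+m i m) (n≤1+n _))) p) }
            ; size = trans (length-++ (seg 0 i)) (trans (cong₂ _+_ (seg-size 0 i)
                (cong suc (trans (length-++ (seg (suc i) m)) (cong₂ _+_ (seg-size (suc i) m) (seg-size (suc j) r)))))
                (trans (linear-≡ 3 (λ i m r → (# 1 ⊕ i) ⊕ (# 1 ⊕ ((# 1 ⊕ m) ⊕ (# 1 ⊕ r))) :≤ # 2 ⊕ ((# 2 ⊕ m) ⊕ i ⊕ r)) (i ∷ m ∷ r ∷ []))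
                    (cong (2 +_) eq)))
            ; within = λ p → ++-elim (seg 0 i) p (λ q → Link.within L (seg⊂S 0 i i≤n q))
                λ { (here refl) → U≢y' u∈ ; (there p') → ++-elim (seg (suc i) m) p' (λ q → Link.within L (seg⊂S (suc i) m mid≤ q))
                    (λ q → Link.within L (seg⊂S (suc j) r j+r≤ q)) } })
          where
          j+r≤ : suc j + r ≤ n
          j+r≤ = ≤-reflexive eq

      A : ℕ → List V
      A i = filter (E? red (f i)) U

      A⁻ : ∀ {i u} → u ∈ A i → u ∈ U × E red (f i) u
      A⁻ {i} = ∈-filter⁻ (E? red (f i)) {xs = U}

      A-unique : ∀ {i} → Unique (A i)
      A-unique {i} = Uniq.filter⁺ (E? red (f i)) U-unique

      -- Of the at least 2k + 1 red neighbours of `f i`, at most n - |as| lie on the path and at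
      -- most one is `y'`. Each known blue edge on the path thus forces one more red neighbour
      -- outside.
      A-size : ∀ {i} as → i ≤ n → Unique (f i ∷ as) → as ⊑ S → (∀ {v} → v ∈ as → E blue (f i) v) →
        2 * k + length as ≤ n + length (A i)
      A-size {i} as i≤n u as⊂S blues = lin 6 (λ k n a r s b → (# 1 ⊕ 2 ⊛ k :≤ r) ∷ (r :≤ s ⊕ (# 1 ⊕ b)) ∷ (s ⊕ (# 1 ⊕ a) :≤ # 1 ⊕ n) ∷ [] ⊢
          2 ⊛ k ⊕ a :≤ n ⊕ b)
          (k ∷ n ∷ length as ∷ length (nbrs red (f i)) ∷ length S' ∷ length (A i) ∷ [])
          (degree (f i) , ≤-trans (card (nbrs-unique red (f i)) sub) (≤-reflexive (length-++ S'))
            , ≤-trans (≤-reflexive (sym (length-++ S'))) (≤-trans (card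
                (Unique-++ (Unique-∖ (Link.unique L)) u λ p q → proj₂ (∖⁻ S (f i ∷ as) p) q)
                λ p → ++-elim S' p (λ q → proj₁ (∖⁻ S (f i ∷ as) q)) λ { (here refl) → on i≤n ; (there q) → as⊂S q })
                    (≤-reflexive (Link.size L))))
        where
        S' : List V
        S' = S ∖ (f i ∷ as)
        sub : nbrs red (f i) ⊑ S' ++ (y' ∷ A i)
        sub {v} p = place (v ∈? S) (v ≟ y')
          where
          v∉ : v ∉ f i ∷ as
          v∉ (here refl) = proj₁ (nbrs⁻ p) refl
          v∉ (there q) = E-op {u = f i} {v = v} (proj₂ (nbrs⁻ p)) (blues q)
          place : Dec (v ∈ S) → Dec (v ≡ y') → v ∈ S' ++ (y' ∷ A i)
          place (yes q) _ = ∈-++⁺ˡ (∖⁺ q v∉)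
          place (no _) (yes e) = ∈-++⁺ʳ S' (here e)
          place (no ¬q) (no ≢y') = ∈-++⁺ʳ S' (there (∈-filter⁺ (E? red (f i)) (∖⁺ (∈-allFin v) λ { (here e) → ≢y' e ; (there q) → ¬q q })
              (proj₂ (nbrs⁻ p))))

      A-size₀ : ∀ {i} → i ≤ n → 2 * k ≤ n + length (A i)
      A-size₀ h = ≤-trans (≤-reflexive (sym (+-identityʳ _))) (A-size [] h (Unique-[] _) (λ ()) λ ())

      walk₁ : ∀ {a} → a ∈ U → Link red (_∈ U) 1 a a
      walk₁ = link-one _

      walk₂ : ∀ {a b} → a ∈ U → b ∈ U → a ≢ b → E red a b → Link red (_∈ U) 2 a b
      walk₂ a∈ b∈ n₁ e = link-cons a∈ e (walk₁ b∈) λ { (here q) → n₁ q }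

      walk₃ : ∀ {a b d} → a ∈ U → b ∈ U → d ∈ U → a ≢ b → a ≢ d → b ≢ d → E red a b → E red b d → Link red (_∈ U) 3 a d
      walk₃ a∈ b∈ d∈ n₁ n₂ n₃ e e' = link-cons a∈ e (walk₂ b∈ d∈ n₃ e') λ { (here q) → n₁ q ; (there (here q)) → n₂ q }

      walk₄ : ∀ {a b d g} → a ∈ U → b ∈ U → d ∈ U → g ∈ U → a ≢ b → a ≢ d → a ≢ g → b ≢ d → b ≢ g → d ≢ g →
        E red a b → E red b d → E red d g → Link red (_∈ U) 4 a g
      walk₄ a∈ b∈ d∈ g∈ n₁ n₂ n₃ n₄ n₅ n₆ e e' e″ =
        link-cons a∈ e (walk₃ b∈ d∈ g∈ n₄ n₅ n₆ e' e″) λ { (here q) → n₁ q ; (there (here q)) → n₂ q ; (there (there (here q))) → n₃ q }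

      A-disjoint : ∀ {i u} → suc i ≤ n → u ∈ A i → u ∉ A (suc i)
      A-disjoint h p q = detour 0 refl h (walk₁ (proj₁ (A⁻ p))) (inj₁ refl) (proj₂ (A⁻ p)) (E-sym (proj₂ (A⁻ q)))

      A-blue₁ : ∀ {i} → suc i ≤ n → Complete blue (A i) (A (suc i))
      A-blue₁ {i} h p q = not-E λ e → detour 0 refl h (walk₂ (proj₁ (A⁻ p)) (proj₁ (A⁻ q)) (λ { refl → A-disjoint {i} h p q }) e)
          (inj₂ refl) (proj₂ (A⁻ p)) (E-sym (proj₂ (A⁻ q)))

      A-blue₂ : ∀ {i u v} → 2 + i ≤ n → u ∈ A i → v ∈ A (2 + i) → u ≢ v → E blue u v
      A-blue₂ {i} h p q ne = not-E λ e → detour 1 refl h (walk₂ (proj₁ (A⁻ p)) (proj₁ (A⁻ q)) ne e) (inj₁ refl) (proj₂ (A⁻ p))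
          (E-sym (proj₂ (A⁻ q)))

      -- A₀, A₁ and A₂ are mutually blue, and a vertex common to A₀ and A₂ gives a wheel with its hub in A₂.
      short : 2 + n ≤ k → ⊥
      short h = noTri (tripartite (A-unique {0}) (A-unique {1}) (A-unique {2}) (big {0} z≤n) (big {1} 1≤n) (big {2} 2≤n)
          (A-disjoint {0} 1≤n) (λ p q → apart p q) (A-disjoint {1} 2≤n) (A-blue₁ {0} 1≤n)
              (λ {u} {v} p q → A-blue₂ {0} 2≤n p q λ { refl → apart p q }) (A-blue₁ {1} 2≤n))
        where
        1≤n : 1 ≤ n
        1≤n = ≤-trans (n≤1+n 1) 2≤n
        big₂ : ∀ {i} → i ≤ n → 2 + k ≤ length (A i)
        big₂ {i} h' = lin 3 (λ k n a → (2 ⊛ k :≤ n ⊕ a) ∷ (# 2 ⊕ n :≤ k) ∷ [] ⊢ # 2 ⊕ k :≤ a) (k ∷ n ∷ length (A i) ∷ []) (A-size₀ h' , h)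
        big : ∀ {i} → i ≤ n → suc k ≤ length (A i)
        big h' = ≤-trans (n≤1+n _) (big₂ h')
        apart : ∀ {p} → p ∈ A 0 → p ∉ A 2
        apart {p} p∈ p∈' = go (pick {as = p ∷ []} (A-unique {2}) (≤-trans (s≤s (≤-trans 1≤k (n≤1+n k))) (big₂ 2≤n)))
          where
          go : (∃ λ h → h ∈ A 2 × h ∉ p ∷ []) → ⊥
          go (h , h∈ , h∉) = go' (pick {as = p ∷ h ∷ []} (A-unique {0}) (≤-trans (s≤s (s≤s 1≤k)) (big₂ z≤n)))
            where
            go' : (∃ λ q → q ∈ A 0 × q ∉ p ∷ h ∷ []) → ⊥
            go' (q , q∈ , q∉) = noWheel h (odd-cycle-edge {X = A 0 ∖ (h ∷ [])} {Y = A 1} {w = p} {e = q} 1≤k (Unique-∖ (A-unique {0}))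
                (A-unique {1})
                (λ r → A-disjoint {0} 1≤n (proj₁ (∖⁻ (A 0) (h ∷ []) r))) (λ r → A-blue₁ {0} 1≤n (proj₁ (∖⁻ (A 0) (h ∷ []) r)))
                (≤-pred (≤-trans (big₂ z≤n) (≤-trans (card-∖ (h ∷ []) (A-unique {0})) (≤-reflexive (+-comm _ 1)))))
                    (≤-trans (n≤1+n k) (big 1≤n))
                (∖⁺ p∈ λ { (here e) → h∉ (here (sym e)) }) (∖⁺ q∈ λ { (here e) → q∉ (there (here e)) })
                (λ e → q∉ (here (sym e))) (E-sym (A-blue₂ {0} 2≤n q∈ p∈' λ e → q∉ (here e)))
                (λ r → spoke (proj₂ (∖⁻ (A 0) (h ∷ []) r) ∘ here ∘ sym)
                    (E-sym (A-blue₂ {0} 2≤n (proj₁ (∖⁻ (A 0) (h ∷ []) r)) h∈ (proj₂ (∖⁻ (A 0) (h ∷ []) r) ∘ here))))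
                (λ r → spoke (λ { refl → A-disjoint {1} 2≤n r h∈ }) (E-sym (A-blue₁ {1} 2≤n r h∈))))
              where
              spoke : ∀ {v} → h ≢ v → E blue h v → BlueNbr c c-sym k h v
              spoke = _,_

      D : V → List V
      D u = filter (_∈? U) (nbrs red u)

      D-unique : ∀ {u} → Unique (D u)
      D-unique {u} = Uniq.filter⁺ (_∈? U) (nbrs-unique red u)

      D⁻ : ∀ {u d} → d ∈ D u → d ∈ U × u ≢ d × E red u d
      D⁻ {u} p = proj₂ r , nbrs⁻ (proj₁ r)
        where r = ∈-filter⁻ (_∈? U) {xs = nbrs red u} p

      -- The neighbours of u on the path are pairwise non-consecutive, and they are not both ends
      -- of a path with 2k - 1 vertices if u is adjacent to y'.
      D-size : ∀ {u} → u ∈ U → suc k ≤ length (D u)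
      D-size {u} u∈ = ≮⇒≥ λ few → cases few (E? red u y')
        where
        I : List ℕ
        I = filter (λ i → E? red u (f i)) (upTo (suc n))
        I-unique : Unique I
        I-unique = Uniq.filter⁺ (λ i → E? red u (f i)) (Uniq.upTo⁺ (suc n))
        I⁻ : ∀ {i} → i ∈ I → i ≤ n × E red u (f i)
        I⁻ p = ≤-pred (∈-upTo⁻ (proj₁ r)) , proj₂ r
          where r = ∈-filter⁻ (λ i → E? red u (f i)) {xs = upTo (suc n)} p
        sparse : ∀ {i} → i ∈ I → suc i ∈ I → ⊥
        sparse p q = detour 0 refl (proj₁ (I⁻ q)) (walk₁ u∈) (inj₁ refl) (E-sym (proj₂ (I⁻ p))) (proj₂ (I⁻ q))
        2I-unique : Unique (I ++ map suc I)
        2I-unique = Unique-++ I-unique (Uniq.map⁺ suc-injective I-unique) λ p q → let (i , r , e) = ∈-map⁻ suc q in sparse r (subst (_∈ I) e p)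
        2I-length : length I + length I ≡ length (I ++ map suc I)
        2I-length = sym (trans (length-++ I) (cong (length I +_) (length-map suc I)))
        2I≤ : length I + length I ≤ 2 + n
        2I≤ = ≤-trans (≤-reflexive 2I-length) (≤-trans (card 2I-unique sub) (≤-reflexive (length-upTo (2 + n))))
          where
          sub : (I ++ map suc I) ⊑ upTo (2 + n)
          sub p = ++-elim I p (λ q → ∈-upTo⁺ (s≤s (≤-trans (proj₁ (I⁻ q)) (n≤1+n n))))
            λ q → let (i , r , e) = ∈-map⁻ suc q in subst (_∈ upTo (2 + n)) (sym e) (∈-upTo⁺ (s≤s (s≤s (proj₁ (I⁻ r)))))
        2I≤′ : 0 ∉ I ⊎ n ∉ I → length I + length I ≤ 1 + n
        2I≤′ (inj₁ 0∉) = ≤-trans (≤-reflexive 2I-length) (≤-trans (card 2I-unique sub)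
            (≤-reflexive (trans (length-map suc (upTo (suc n))) (length-upTo (suc n)))))
          where
          sub : (I ++ map suc I) ⊑ map suc (upTo (suc n))
          sub p = ++-elim I p positive λ q → let (i , r , e) = ∈-map⁻ suc q in subst (_∈ map suc (upTo (suc n))) (sym e) (∈-map⁺ suc (∈-upTo⁺ (s≤s (proj₁ (I⁻ r)))))
            where
            positive : I ⊑ map suc (upTo (suc n))
            positive {zero} q = ⊥-elim (0∉ q)
            positive {suc i} q = ∈-map⁺ suc (∈-upTo⁺ (≤-trans (proj₁ (I⁻ q)) (n≤1+n n)))
        2I≤′ (inj₂ n∉) = ≤-trans (≤-reflexive 2I-length) (≤-trans (card 2I-unique sub) (≤-reflexive (length-upTo (suc n))))
          where
          below : ∀ {i} → i ∈ I → i < n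
          below {i} q = ≤∧≢⇒< (proj₁ (I⁻ q)) λ { refl → n∉ q }
          sub : (I ++ map suc I) ⊑ upTo (suc n)
          sub p = ++-elim I p (λ q → ∈-upTo⁺ (≤-trans (below q) (n≤1+n n)))
            λ q → let (i , r , e) = ∈-map⁻ suc q in subst (_∈ upTo (suc n)) (sym e) (∈-upTo⁺ (s≤s (below r)))
        on-path : ∀ {v} → v ∈ nbrs red u → v ∈ S → v ∈ map f I
        on-path {v} p q = let (i , h , e) = onto q in subst (_∈ map f I) e (∈-map⁺ f (∈-filter⁺ (λ i → E? red u (f i)) (∈-upTo⁺ (s≤s h)) (subst (E red u) (sym e) (proj₂ (nbrs⁻ p)))))
        cover : nbrs red u ⊑ y' ∷ (D u ++ map f I)
        cover {v} p = place (v ∈? S) (v ≟ y')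
          where
          place : Dec (v ∈ S) → Dec (v ≡ y') → v ∈ y' ∷ (D u ++ map f I)
          place (yes q) _ = there (∈-++⁺ʳ (D u) (on-path p q))
          place (no _) (yes e) = here e
          place (no ¬q) (no ≢y') = there (∈-++⁺ˡ (∈-filter⁺ (_∈? U) p (∖⁺ (∈-allFin v) λ { (here e) → ≢y' e ; (there q) → ¬q q })))
        count : length (nbrs red u) ≤ 1 + (length (D u) + length I)
        count = ≤-trans (card (nbrs-unique red u) cover) (s≤s (≤-reflexive
            (trans (length-++ (D u)) (cong (length (D u) +_) (length-map f I)))))
        tight : length (D u) < suc k → length I + length I ≤ 1 + n → ⊥
        tight few h = 1≰0 (lin 5 (λ k n r d i → (# 1 ⊕ 2 ⊛ k :≤ r) ∷ (# 1 ⊕ 2 ⊛ k :≤ r) ∷ (r :≤ # 1 ⊕ (d ⊕ i)) ∷ (r :≤ # 1 ⊕ (d ⊕ i)) ∷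
            (# 1 ⊕ d :≤ # 1 ⊕ k) ∷ (# 1 ⊕ d :≤ # 1 ⊕ k) ∷ (i ⊕ i :≤ # 1 ⊕ n) ∷ (# 2 ⊕ n :≤ 2 ⊛ k) ∷ [] ⊢ # 1 :≤ # 0)
            (k ∷ n ∷ length (nbrs red u) ∷ length (D u) ∷ length I ∷ []) (degree u , degree u , count , count , few , few , h , n≤))
        cases : length (D u) < suc k → Dec (E red u y') → ⊥
        cases few (no ¬e) = 1≰0 (lin 5 (λ k n r d i → (# 1 ⊕ 2 ⊛ k :≤ r) ∷ (# 1 ⊕ 2 ⊛ k :≤ r) ∷ (r :≤ d ⊕ i) ∷ (r :≤ d ⊕ i) ∷
            (# 1 ⊕ d :≤ # 1 ⊕ k) ∷ (# 1 ⊕ d :≤ # 1 ⊕ k) ∷ (i ⊕ i :≤ # 2 ⊕ n) ∷ (# 2 ⊕ n :≤ 2 ⊛ k) ∷ [] ⊢ # 1 :≤ # 0)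
            (k ∷ n ∷ length (nbrs red u) ∷ length (D u) ∷ length I ∷ []) (degree u , degree u , count' , count' , few , few , 2I≤ , n≤))
          where
          cover' : nbrs red u ⊑ D u ++ map f I
          cover' p with cover p
          ... | here refl = ⊥-elim (¬e (proj₂ (nbrs⁻ p)))
          ... | there q = q
          count' : length (nbrs red u) ≤ length (D u) + length I
          count' = ≤-trans (card (nbrs-unique red u) cover') (≤-reflexive
              (trans (length-++ (D u)) (cong (length (D u) +_) (length-map f I))))
        cases few (yes e) with E? red u (f 0) | E? red u (f n)
        ... | no ¬e₀ | _ = tight few (2I≤′ (inj₁ λ p → ¬e₀ (proj₂ (I⁻ p))))
        ... | yes _ | no ¬eₙ = tight few (2I≤′ (inj₂ λ p → ¬eₙ (proj₂ (I⁻ p))))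
        ... | yes e₀ | yes eₙ with m≤n⇒m<n∨m≡n n≤
        ...   | inj₁ h = 1≰0 (lin 5 (λ k n r d i → (# 1 ⊕ 2 ⊛ k :≤ r) ∷ (# 1 ⊕ 2 ⊛ k :≤ r) ∷ (r :≤ # 1 ⊕ (d ⊕ i)) ∷ (r :≤ # 1 ⊕ (d ⊕ i)) ∷
            (# 1 ⊕ d :≤ # 1 ⊕ k) ∷ (# 1 ⊕ d :≤ # 1 ⊕ k) ∷ (i ⊕ i :≤ # 2 ⊕ n) ∷ (# 3 ⊕ n :≤ 2 ⊛ k) ∷ [] ⊢ # 1 :≤ # 0)
            (k ∷ n ∷ length (nbrs red u) ∷ length (D u) ∷ length I ∷ []) (degree u , degree u , count , count , few , few , 2I≤ , h))
        ...   | inj₂ h = noRed (cycle (u , y , join (one u) e (join (one y') (E-sym xy') (Link.path L)) , E-sym (subst (E red u) last eₙ))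
            (Unique-cons (λ { (here q) → U≢y' u∈ q ; (there q) → U∉S u∈ q }) (Unique-cons (λ q → Link.within L q refl) (Link.unique L)))
            (cong suc (trans (cong suc (Link.size L)) h)) λ _ → tt)

      flex : ∀ {w d} → w ∈ U → Clique red (D w) → d ∈ D w → ∀ t → t ≤ k → Link red (_∈ U) (2 + t) w d
      flex {w} {d} w∈ hD d∈ t t≤k = go S′.list S′.unique S′.size S′.from S′.avoid
        where
        module S′ = Selection (select {t} (d ∷ []) (D-unique {w}) (≤-trans (≤-reflexive (+-comm t 1)) (≤-trans (s≤s t≤k) (D-size w∈))))
        go : ∀ {t} (m : List V) → Unique m → length m ≡ t → m ⊑ D w → (∀ {x} → x ∈ m → x ∉ d ∷ []) → Link red (_∈ U) (2 + t) w d
        go [] _ refl _ _ = walk₂ w∈ (proj₁ (D⁻ d∈)) (proj₁ (proj₂ (D⁻ d∈))) (proj₂ (proj₂ (D⁻ d∈)))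
        go (a ∷ m) u refl s av = record
          { path = join (one w) (proj₂ (proj₂ (D⁻ (s (here refl))))) (clique-path hD a m d u' s')
          ; unique = Unique-cons (λ p → proj₁ (proj₂ (D⁻ {w} (s' p))) refl) u'
          ; size = cong (2 +_) (trans (length-++ m) (+-comm _ 1))
          ; within = λ { (here refl) → w∈ ; (there p) → proj₁ (D⁻ (s' p)) } }
          where
          u' : Unique (a ∷ m ++ d ∷ [])
          u' = Unique-++ u (Unique-[] d) av
          s' : (a ∷ m ++ d ∷ []) ⊑ D w
          s' p = ++-elim (a ∷ m) p s λ { (here refl) → d∈ }

      -- Inside a red clique the number of vertices can be chosen freely; only for `l = 0` must it
      -- be `l + 2`, because `w` and `d` are two vertices already.
      spans : ∀ {w d} → w ∈ U → Clique red (D w) → d ∈ D w → ∀ l → l ≤ suc k →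
        ∃ λ t → Link red (_∈ U) t w d × (t ≡ suc l ⊎ t ≡ 2 + l)
      spans w∈ hD d∈ zero _ = 2 , flex w∈ hD d∈ 0 z≤n , inj₂ refl
      spans w∈ hD d∈ (suc l) h = 2 + l , flex w∈ hD d∈ l (≤-pred h) , inj₁ refl

      -- A red edge from `f j` to `d` would permit a detour between positions `a` and `j` through
      -- the clique `D w`. The bound k + 2 on their distance is what k + 1 vertices in `D w` allow.
      near : ∀ {a j w d} → w ∈ A a → Clique red (D w) → d ∈ D w → a ≤ n → j ≤ n → j ≢ a → j ≤ a + (2 + k) → a ≤ j + (2 + k) → E blue (f j) d
      near {a} {j} {w} {d} w∈ hD d∈ a≤ j≤ j≢a h h' = not-E λ e → go e (<-cmp j a)
        where
        bound : ∀ l b e → suc l + b ≡ e → e ≤ b + (2 + k) → l ≤ suc k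
        bound l b e eq h = ≤-pred (+-cancelʳ-≤ b _ _ (≤-trans (≤-reflexive eq) (≤-trans h (≤-reflexive (+-comm b (2 + k))))))
        go : E red (f j) d → Tri (j < a) (j ≡ a) (a < j) → ⊥
        go e (tri< lt _ _) = let (l , eq) = m≤n⇒∃[o]m+o≡n lt
                                 (t , W , t≡) = spans (proj₁ (A⁻ w∈)) hD d∈ l (bound l j a (trans (cong suc (+-comm l j)) eq) h') in
          detour l (trans (cong suc (+-comm l j)) eq) a≤ (link-rev W) t≡ e (E-sym (proj₂ (A⁻ w∈)))
        go e (tri≈ _ eq _) = j≢a eq
        go e (tri> _ _ gt) = let (l , eq) = m≤n⇒∃[o]m+o≡n gt
                                 (t , W , t≡) = spans (proj₁ (A⁻ w∈)) hD d∈ l (bound l a j (trans (cong suc (+-comm l a)) eq) h) in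
          detour l (trans (cong suc (+-comm l a)) eq) j≤ W t≡ (proj₂ (A⁻ w∈)) (E-sym e)

      -- The sets `D w` and `D w'` have at least k + 1 vertices and become two parts of the
      -- tripartite graph: a red edge between them would complete a detour on four vertices past
      -- `f (1 + i)`, `f (2 + i)` and `f (3 + i)`. That `ww'` is blue keeps `w` and `w'` out of
      -- them.
      module Window (i : ℕ) (i≤4 : i ≤ 4) (h : 4 + i ≤ n) {w w' : V} (w∈ : w ∈ A i) (w'∈ : w' ∈ A (4 + i)) (w≢w' : w ≢ w') (ww' : E blue w w') where

        private
          i≤n : i ≤ n
          i≤n = ≤-trans (m≤n+m i 4) h
          1+i≤ : 1 + i ≤ n
          1+i≤ = ≤-trans (m≤n+m (1 + i) 3) h
          2+i≤ : 2 + i ≤ n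
          2+i≤ = ≤-trans (m≤n+m (2 + i) 2) h
          3+i≤ : 3 + i ≤ n
          3+i≤ = ≤-trans (n≤1+n _) h
          U-w : w ∈ U
          U-w = proj₁ (A⁻ w∈)
          U-w' : w' ∈ U
          U-w' = proj₁ (A⁻ w'∈)
          fw : E red (f i) w
          fw = proj₂ (A⁻ w∈)
          w'f : E red w' (f (4 + i))
          w'f = E-sym (proj₂ (A⁻ w'∈))

        w∉D : ∀ {d} → d ∈ D w' → w ≢ d
        w∉D p refl = E-op {u = w'} {v = w} (proj₂ (proj₂ (D⁻ p))) (E-sym ww')

        w'∉D : ∀ {d} → d ∈ D w → w' ≢ d
        w'∉D p refl = E-op {u = w} {v = w'} (proj₂ (proj₂ (D⁻ p))) ww'

        D-blue : ∀ {d d'} → d ∈ D w → d' ∈ D w' → d ≢ d' → E blue d d'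
        D-blue {d} {d'} p q ne = not-E λ e → detour 3 refl h
          (walk₄ U-w (proj₁ (D⁻ p)) (proj₁ (D⁻ q)) U-w' (proj₁ (proj₂ (D⁻ p))) (w∉D q) w≢w' ne (w'∉D p ∘ sym) (proj₁ (proj₂ (D⁻ q)) ∘ sym)
            (proj₂ (proj₂ (D⁻ p))) e (E-sym (proj₂ (proj₂ (D⁻ q))))) (inj₁ refl) fw w'f

        step₁ : ∀ {d} → d ∈ D w → E blue (f (1 + i)) d
        step₁ p = not-E λ e → detour 0 refl 1+i≤ (walk₂ U-w (proj₁ (D⁻ p)) (proj₁ (proj₂ (D⁻ p))) (proj₂ (proj₂ (D⁻ p)))) (inj₂ refl) fw
            (E-sym e)

        step₂ : ∀ {d} → d ∈ D w → E blue (f (2 + i)) d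
        step₂ p = not-E λ e → detour 1 refl 2+i≤ (walk₂ U-w (proj₁ (D⁻ p)) (proj₁ (proj₂ (D⁻ p))) (proj₂ (proj₂ (D⁻ p)))) (inj₁ refl) fw
            (E-sym e)

        step₂′ : ∀ {d} → d ∈ D w' → E blue (f (2 + i)) d
        step₂′ p = not-E λ e → detour 1 refl h (walk₂ (proj₁ (D⁻ p)) U-w' (proj₁ (proj₂ (D⁻ p)) ∘ sym) (E-sym (proj₂ (proj₂ (D⁻ p)))))
            (inj₁ refl) e w'f

        spoke : ∀ {h v} → h ≢ v → E blue h v → BlueNbr c c-sym k h v
        spoke = _,_

        -- A common vertex `z` of `D w` and `D w'` is blue to the rest of `D w`, because it belongs
        -- to `D w'`. It becomes the hub, and the red neighbourhood of some `q` in `A (3 + i)`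
        -- provides the other side of the rim.
        meeting : (2≤A : 2 ≤ length (A (3 + i))) → ∀ {z} → z ∈ D w → z ∈ D w' → ⊥
        meeting 2≤A {z} z∈ z∈' = go (pick {as = w ∷ []} (A-unique {3 + i}) 2≤A)
          where
          go : (∃ λ q → q ∈ A (3 + i) × q ∉ w ∷ []) → ⊥
          go (q , q∈ , q∉) = noWheel z (odd-cycle-edge {X = X} {Y = Y} {w = f (2 + i)} 1≤k X-unique (Unique-∖ (D-unique {q})) X∩Y X-Y X-size
              Y-size
              (there (here refl)) (there (there (proj₁ (proj₂ x₁)))) (λ e → U≢f (proj₁ (D⁻ (X⁻ (proj₁ (proj₂ x₁))))) 2+i≤ (sym e))
              (step₂ (X⁻ (proj₁ (proj₂ x₁)))) X-spokes Y-spokes)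
            where
            U-q : q ∈ U
            U-q = proj₁ (A⁻ q∈)
            w≢q : w ≢ q
            w≢q e = q∉ (here (sym e))
            qf : E red q (f (3 + i))
            qf = E-sym (proj₂ (A⁻ q∈))
            z≢q : z ≢ q
            z≢q refl = E-op {u = q} {v = w'} (E-sym (proj₂ (proj₂ (D⁻ z∈')))) (A-blue₁ {3 + i} h q∈ w'∈)
            D-apart : ∀ {v} → v ∈ D w → v ≢ q → v ∉ D q
            D-apart p ne r = detour 2 refl 3+i≤ (walk₃ U-w (proj₁ (D⁻ p)) U-q (proj₁ (proj₂ (D⁻ p))) w≢q ne (proj₂ (proj₂ (D⁻ p)))
                (E-sym (proj₂ (proj₂ (D⁻ r))))) (inj₁ refl) fw qf
            across : ∀ {v v'} → v ∈ D w → v ≢ q → v' ∈ D q → v' ≢ w → E blue v v'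
            across {v} {v'} p ne r ne' = not-E λ e → detour 2 refl 3+i≤
              (walk₄ U-w (proj₁ (D⁻ p)) (proj₁ (D⁻ r)) U-q (proj₁ (proj₂ (D⁻ p))) (ne' ∘ sym) w≢q (λ { refl → D-apart p ne r }) ne
                  (proj₁ (proj₂ (D⁻ r)) ∘ sym)
                (proj₂ (proj₂ (D⁻ p))) e (E-sym (proj₂ (proj₂ (D⁻ r))))) (inj₂ refl) fw qf
            back₁ : ∀ {v} → v ∈ D q → E blue (f (2 + i)) v
            back₁ p = not-E λ e → detour 0 refl 3+i≤ (walk₂ (proj₁ (D⁻ p)) U-q (proj₁ (proj₂ (D⁻ p)) ∘ sym) (E-sym (proj₂ (proj₂ (D⁻ p)))))
                (inj₂ refl) e qf
            back₂ : ∀ {v} → v ∈ D q → E blue (f (1 + i)) v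
            back₂ p = not-E λ e → detour 1 refl 3+i≤ (walk₂ (proj₁ (D⁻ p)) U-q (proj₁ (proj₂ (D⁻ p)) ∘ sym) (E-sym (proj₂ (proj₂ (D⁻ p)))))
                (inj₁ refl) e qf
            X₀ X Y : List V
            X₀ = D w ∖ (z ∷ q ∷ [])
            -- Two path vertices make up for the deletion of `z` and `q`, so that k + 1 vertices
            -- remain; a blue edge from `f (2 + i)` to `X₀` makes the rim odd.
            X = f (1 + i) ∷ f (2 + i) ∷ X₀
            Y = D q ∖ (w ∷ [])
            X⁻ : ∀ {v} → v ∈ X₀ → v ∈ D w
            X⁻ p = proj₁ (∖⁻ (D w) (z ∷ q ∷ []) p)
            X≢ : ∀ {v} → v ∈ X₀ → v ≢ z × v ≢ q
            X≢ p = (λ e → proj₂ (∖⁻ (D w) (z ∷ q ∷ []) p) (here e)) , (λ e → proj₂ (∖⁻ (D w) (z ∷ q ∷ []) p) (there (here e)))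
            Y⁻ : ∀ {v} → v ∈ Y → v ∈ D q × v ≢ w
            Y⁻ p = proj₁ (∖⁻ (D q) (w ∷ []) p) , (λ e → proj₂ (∖⁻ (D q) (w ∷ []) p) (here e))
            X₀-size : suc k ≤ length X₀ + 2
            X₀-size = ≤-trans (D-size U-w) (card-∖ (z ∷ q ∷ []) (D-unique {w}))
            x₁ : ∃ λ v → v ∈ X₀ × v ∉ []
            x₁ = pick {as = []} (Unique-∖ (D-unique {w})) (lin 2 (λ k a → (# 1 ⊕ k :≤ a ⊕ # 2) ∷ (# 6 :≤ k) ∷ [] ⊢ # 1 :≤ a)
                (k ∷ length X₀ ∷ []) (X₀-size , 6≤k))
            X-unique : Unique X
            X-unique = Unique-cons (λ { (here e) → 1+n≢n (sym (inj 1+i≤ 2+i≤ e)) ; (there p) → U≢f (proj₁ (D⁻ (X⁻ p))) 1+i≤ refl })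
              (Unique-cons (λ p → U≢f (proj₁ (D⁻ (X⁻ p))) 2+i≤ refl) (Unique-∖ (D-unique {w})))
            X∩Y : ∀ {v} → v ∈ X → v ∉ Y
            X∩Y (here refl) r = U≢f (proj₁ (D⁻ (proj₁ (Y⁻ r)))) 1+i≤ refl
            X∩Y (there (here refl)) r = U≢f (proj₁ (D⁻ (proj₁ (Y⁻ r)))) 2+i≤ refl
            X∩Y (there (there p)) r = D-apart (X⁻ p) (proj₂ (X≢ p)) (proj₁ (Y⁻ r))
            X-Y : Complete blue X Y
            X-Y (here refl) r = back₂ (proj₁ (Y⁻ r))
            X-Y (there (here refl)) r = back₁ (proj₁ (Y⁻ r))
            X-Y (there (there p)) r = across (X⁻ p) (proj₂ (X≢ p)) (proj₁ (Y⁻ r)) (proj₂ (Y⁻ r))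
            X-size : suc k ≤ length X
            X-size = ≤-trans X₀-size (≤-reflexive (+-comm _ 2))
            Y-size : k ≤ length Y
            Y-size = ≤-pred (≤-trans (D-size U-q) (≤-trans (card-∖ (w ∷ []) (D-unique {q})) (≤-reflexive (+-comm _ 1))))
            X-spokes : ∀ {v} → v ∈ X → BlueNbr c c-sym k z v
            X-spokes (here refl) = spoke (U≢f (proj₁ (D⁻ z∈)) 1+i≤) (E-sym (step₁ z∈))
            X-spokes (there (here refl)) = spoke (U≢f (proj₁ (D⁻ z∈)) 2+i≤) (E-sym (step₂ z∈))
            X-spokes (there (there p)) = spoke (proj₁ (X≢ p) ∘ sym) (E-sym (D-blue (X⁻ p) z∈' (proj₁ (X≢ p))))
            Y-spokes : ∀ {v} → v ∈ Y → BlueNbr c c-sym k z v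
            Y-spokes r = spoke (λ { refl → D-apart z∈ z≢q (proj₁ (Y⁻ r)) }) (across z∈ z≢q (proj₁ (Y⁻ r)) (proj₂ (Y⁻ r)))

        module Apart (D∩D : ∀ {d} → d ∈ D w → d ∉ D w') where

          D-complete : Complete blue (D w) (D w')
          D-complete p q = D-blue p q λ { refl → D∩D p q }

          -- `f (2 + i)` is blue to both sets, so a blue edge inside one of them would give a wheel
          -- with this hub.
          w-clique : Clique red (D w)
          w-clique p q ne = not-E {α = blue} λ e → noWheel (f (2 + i)) (odd-cycle-edge {X = D w} {Y = D w'} 1≤k D-unique D-unique D∩D
              D-complete (D-size U-w)
            (≤-trans (n≤1+n k) (D-size U-w')) p q ne e (λ r → spoke (U≢f (proj₁ (D⁻ r)) 2+i≤ ∘ sym) (step₂ r))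
                (λ r → spoke (U≢f (proj₁ (D⁻ r)) 2+i≤ ∘ sym) (step₂′ r)))

          w'-clique : Clique red (D w')
          w'-clique p q ne = not-E {α = blue} λ e → noWheel (f (2 + i))
              (odd-cycle-edge {X = D w'} {Y = D w} 1≤k D-unique D-unique (λ r s → D∩D s r) (λ r s → E-sym (D-complete s r)) (D-size U-w')
            (≤-trans (n≤1+n k) (D-size U-w)) p q ne e (λ r → spoke (U≢f (proj₁ (D⁻ r)) 2+i≤ ∘ sym) (step₂′ r))
                (λ r → spoke (U≢f (proj₁ (D⁻ r)) 2+i≤ ∘ sym) (step₂ r)))

          A₂ : List V
          A₂ = A (2 + i) ∖ (w ∷ w' ∷ [])

          A₂⁻ : ∀ {u} → u ∈ A₂ → u ∈ A (2 + i) × u ≢ w × u ≢ w'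
          A₂⁻ p = proj₁ r , (λ e → proj₂ r (here e)) , (λ e → proj₂ r (there (here e)))
            where r = ∖⁻ (A (2 + i)) (w ∷ w' ∷ []) p

          A₂∉D : ∀ {u} → u ∈ A₂ → u ∉ D w
          A₂∉D p q = E-op {α = red} (proj₂ (A⁻ (proj₁ (A₂⁻ p)))) (step₂ q)

          A₂∉D′ : ∀ {u} → u ∈ A₂ → u ∉ D w'
          A₂∉D′ p q = E-op {α = red} (proj₂ (A⁻ (proj₁ (A₂⁻ p)))) (step₂′ q)

          D-A₂ : ∀ {d u} → d ∈ D w → u ∈ A₂ → E blue d u
          D-A₂ p q = not-E λ e → detour 1 refl 2+i≤ (walk₃ U-w (proj₁ (D⁻ p)) (proj₁ (A⁻ (proj₁ (A₂⁻ q)))) (proj₁ (proj₂ (D⁻ p)))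
              (proj₁ (proj₂ (A₂⁻ q)) ∘ sym)
            (λ { refl → A₂∉D q p }) (proj₂ (proj₂ (D⁻ p))) e) (inj₂ refl) fw (E-sym (proj₂ (A⁻ (proj₁ (A₂⁻ q)))))

          D′-A₂ : ∀ {d u} → d ∈ D w' → u ∈ A₂ → E blue d u
          D′-A₂ p q = not-E λ e → detour 1 refl h (walk₃ (proj₁ (A⁻ (proj₁ (A₂⁻ q)))) (proj₁ (D⁻ p)) U-w' (λ { refl → A₂∉D′ q p })
              (proj₂ (proj₂ (A₂⁻ q)))
            (proj₁ (proj₂ (D⁻ p)) ∘ sym) (E-sym e) (E-sym (proj₂ (proj₂ (D⁻ p))))) (inj₂ refl) (proj₂ (A⁻ (proj₁ (A₂⁻ q)))) w'f

          -- The third part consists of the path vertices up to position `m` and of `A (2 + i)`.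
          -- Positions `i` and `4 + i`, where `near` does not apply to both sets, and the vertices
          -- `w` and `w'` are left out, which explains the k + 4 in `enough`.
          module Third (m : ℕ) (m≤n : m ≤ n) (m≤ : m ≤ 2 + k) (enough : 4 + k ≤ m + length (A (2 + i))) where

            I : List ℕ
            I = filter (λ j → ¬? (j ≟ℕ i) ×-dec ¬? (j ≟ℕ (4 + i))) (upTo (suc m))

            I⁻ : ∀ {j} → j ∈ I → j ≤ m × j ≢ i × j ≢ 4 + i
            I⁻ p = ≤-pred (∈-upTo⁻ (proj₁ r)) , proj₂ r
              where r = ∈-filter⁻ (λ j → ¬? (j ≟ℕ i) ×-dec ¬? (j ≟ℕ (4 + i))) {xs = upTo (suc m)} p

            Z : List V
            Z = map f I ++ A₂

            fI⁻ : ∀ {v} → v ∈ map f I → ∃ λ j → j ∈ I × v ≡ f j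
            fI⁻ = ∈-map⁻ f

            I≤n : ∀ {j} → j ∈ I → j ≤ n
            I≤n p = ≤-trans (proj₁ (I⁻ p)) m≤n

            fI-unique : ∀ (is : List ℕ) → Unique is → is ⊑ I → Unique (map f is)
            fI-unique [] _ _ = AllPairs.[]
            fI-unique (j ∷ is) u s = Unique-cons (λ p → let (j' , q , e) = ∈-map⁻ f p in
                Unique-head u (subst (_∈ is) (sym (inj (I≤n (s (here refl))) (I≤n (s (there q))) e)) q))
                    (fI-unique is (Unique-tail u) (s ∘ there))

            I-unique : Unique I
            I-unique = Uniq.filter⁺ (λ j → ¬? (j ≟ℕ i) ×-dec ¬? (j ≟ℕ (4 + i))) (Uniq.upTo⁺ (suc m))

            I-size : suc m ≤ length I + 2
            I-size = ≤-trans (≤-reflexive (sym (length-upTo (suc m)))) (≤-trans (card (Uniq.upTo⁺ (suc m)) sub) (≤-reflexive (length-++ I)))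
              where
              sub : upTo (suc m) ⊑ I ++ (i ∷ (4 + i) ∷ [])
              sub {j} p = place (j ≟ℕ i) (j ≟ℕ (4 + i))
                where
                place : Dec (j ≡ i) → Dec (j ≡ 4 + i) → j ∈ I ++ (i ∷ (4 + i) ∷ [])
                place (yes e) _ = ∈-++⁺ʳ I (here e)
                place (no _) (yes e) = ∈-++⁺ʳ I (there (here e))
                place (no ne) (no ne') = ∈-++⁺ˡ (∈-filter⁺ (λ j → ¬? (j ≟ℕ i) ×-dec ¬? (j ≟ℕ (4 + i))) p (ne , ne'))

            Z-size : suc k ≤ length Z
            Z-size = lin 6 (λ k m j a b z → (j ⊕ b :≤ z) ∷ (# 1 ⊕ m :≤ j ⊕ # 2) ∷ (a :≤ b ⊕ # 2) ∷ (# 4 ⊕ k :≤ m ⊕ a) ∷ [] ⊢ # 1 ⊕ k :≤ z)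
              (k ∷ m ∷ length I ∷ length (A (2 + i)) ∷ length A₂ ∷ length Z ∷ [])
              (≤-reflexive (sym (trans (length-++ (map f I)) (cong (_+ length A₂) (length-map f I)))) , I-size , card-∖ (w ∷ w' ∷ [])
                  (A-unique {2 + i}) , enough)

            Z-unique : Unique Z
            Z-unique = Unique-++ (fI-unique I I-unique id) (Unique-∖ (A-unique {2 + i}))
              λ p q → let (j , r , e) = fI⁻ p in U≢f (proj₁ (A⁻ (proj₁ (A₂⁻ q)))) (I≤n r) e

            -- Here 4 + i ≤ 8 ≤ k + 2, so windows starting at 4 at the latest are within reach of
            -- position 0.
            i≤2+k : 4 + i ≤ 2 + k
            i≤2+k = ≤-trans (+-monoʳ-≤ 4 i≤4) (≤-trans (≤-reflexive refl) (s≤s (s≤s 6≤k)))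

            D-f : ∀ {d j} → d ∈ D w → j ∈ I → E blue (f j) d
            D-f {j = j} p r = near w∈ w-clique p i≤n (I≤n r) (proj₁ (proj₂ (I⁻ r))) (≤-trans (≤-trans (proj₁ (I⁻ r)) m≤) (m≤n+m _ i))
              (≤-trans (≤-trans (m≤n+m i 4) i≤2+k) (m≤n+m _ j))

            D′-f : ∀ {d j} → d ∈ D w' → j ∈ I → E blue (f j) d
            D′-f {j = j} p r = near w'∈ w'-clique p h (I≤n r) (proj₂ (proj₂ (I⁻ r))) (≤-trans (≤-trans (proj₁ (I⁻ r)) m≤) (m≤n+m _ (4 + i)))
              (≤-trans i≤2+k (m≤n+m _ j))

            absurd : ⊥
            absurd = noTri (tripartite D-unique D-unique Z-unique (D-size U-w) (D-size U-w') Z-size D∩D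
              (λ p q → ++-elim (map f I) q (λ r → let (j , s , e) = fI⁻ r in U≢f (proj₁ (D⁻ p)) (I≤n s) e) (λ r → A₂∉D r p))
              (λ p q → ++-elim (map f I) q (λ r → let (j , s , e) = fI⁻ r in U≢f (proj₁ (D⁻ p)) (I≤n s) e) (λ r → A₂∉D′ r p))
              D-complete
              (λ {d} p q → ++-elim (map f I) q (λ r → let (j , s , e) = fI⁻ r in subst (E blue d) (sym e) (E-sym (D-f p s))) (D-A₂ p))
              (λ {d} p q → ++-elim (map f I) q (λ r → let (j , s , e) = fI⁻ r in subst (E blue d) (sym e) (E-sym (D′-f p s))) (D′-A₂ p)))

          -- The choice is m = min(n, k + 2). For m = n the sets `A` have at least 2k - n vertices,
          -- so 2k in total; for m = k + 2 two vertices in `A (2 + i)` are enough.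
          absurd : ⊥
          absurd with n ≤? 2 + k
          ... | yes small = Third.absurd n ≤-refl small (lin 3 (λ k n a → (2 ⊛ k :≤ n ⊕ a) ∷ (# 6 :≤ k) ∷ [] ⊢ # 4 ⊕ k :≤ n ⊕ a)
                  (k ∷ n ∷ length (A (2 + i)) ∷ []) (A-size₀ 2+i≤ , 6≤k))
          ... | no large = Third.absurd (2 + k) (≤-trans (n≤1+n _) (≰⇒> large)) ≤-refl
              (lin 3 (λ k n a → (2 ⊛ k :≤ n ⊕ a) ∷ (# 2 ⊕ n :≤ 2 ⊛ k) ∷ [] ⊢ # 4 ⊕ k :≤ # 2 ⊕ k ⊕ a)
                  (k ∷ n ∷ length (A (2 + i)) ∷ []) (A-size₀ 2+i≤ , n≤))

        absurd : ⊥
        absurd = Apart.absurd λ p q → meeting (lin 3 (λ k n a → (2 ⊛ k :≤ n ⊕ a) ∷ (# 2 ⊕ n :≤ 2 ⊛ k) ∷ [] ⊢ # 2 :≤ a)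
                  (k ∷ n ∷ length (A (3 + i)) ∷ []) (A-size₀ 3+i≤ , n≤)) p q

      -- If a b', b' b and b a' are all red, then a b' b a' is a detour.
      window : ∀ i → i ≤ 4 → 4 + i ≤ n → ∀ {a b a' b'} → a ∈ A i → b ∈ A i → a' ∈ A (4 + i) → b' ∈ A (4 + i) →
        a ≢ b → a' ≢ b' → a ≢ a' → a ≢ b' → b ≢ a' → b ≢ b' → ⊥
      window i i≤4 h {a} {b} {a'} {b'} a∈ b∈ a'∈ b'∈ n₁ n₂ n₃ n₄ n₅ n₆ = go (E? blue a b') (E? blue b b') (E? blue b a')
        where
        go : Dec (E blue a b') → Dec (E blue b b') → Dec (E blue b a') → ⊥
        go (yes e) _ _ = Window.absurd i i≤4 h a∈ b'∈ n₄ e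
        go (no _) (yes e) _ = Window.absurd i i≤4 h b∈ b'∈ n₆ e
        go (no _) (no _) (yes e) = Window.absurd i i≤4 h b∈ a'∈ n₅ e
        go (no e₁) (no e₂) (no e₃) = detour 3 refl h
          (walk₄ (proj₁ (A⁻ a∈)) (proj₁ (A⁻ b'∈)) (proj₁ (A⁻ b∈)) (proj₁ (A⁻ a'∈)) n₄ n₁ n₃ (n₆ ∘ sym) (n₂ ∘ sym) n₅ (not-E e₁)
              (E-sym (not-E e₂)) (not-E e₃))
          (inj₁ refl) (proj₂ (A⁻ a∈)) (E-sym (proj₂ (A⁻ a'∈)))

      A-size₂ : ∀ {i} → i ≤ n → 2 ≤ length (A i)
      A-size₂ {i} h = lin 3 (λ k n a → (2 ⊛ k :≤ n ⊕ a) ∷ (# 2 ⊕ n :≤ 2 ⊛ k) ∷ [] ⊢ # 2 :≤ a) (k ∷ n ∷ length (A i) ∷ []) (A-size₀ h , n≤)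

      Pair : List V → Set
      Pair xs = ∃ λ a → ∃ λ b → a ∈ xs × b ∈ xs × a ≢ b

      window-apart : ∀ i → i ≤ 4 → 4 + i ≤ n → (∀ {u} → u ∈ A i → u ∉ A (4 + i)) → ⊥
      window-apart i i≤4 h apart = go (distinct-pair (A-unique {i}) (A-size₂ (≤-trans (m≤n+m i 4) h)))
          (distinct-pair (A-unique {4 + i}) (A-size₂ h))
        where
        go : Pair (A i) → Pair (A (4 + i)) → ⊥
        go (a , b , a∈ , b∈ , ne) (a' , b' , a'∈ , b'∈ , ne') = window i i≤4 h a∈ b∈ a'∈ b'∈ ne ne'
          (λ { refl → apart a∈ a'∈ }) (λ { refl → apart a∈ b'∈ }) (λ { refl → apart b∈ a'∈ }) (λ { refl → apart b∈ b'∈ })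

      -- With four vertices in `A (4 + i)`, two of them differ from two chosen vertices of `A i`,
      -- even if these sets intersect.
      window-large : ∀ i → i ≤ 4 → 4 + i ≤ n → 4 ≤ length (A (4 + i)) → ⊥
      window-large i i≤4 h l = go (distinct-pair (A-unique {i}) (A-size₂ (≤-trans (m≤n+m i 4) h)))
        where
        go : Pair (A i) → ⊥
        go (a , b , a∈ , b∈ , ne) = go′ (distinct-pair {xs = A′} (Unique-∖ (A-unique {4 + i}))
            (≤-pred (≤-pred (≤-trans l (≤-trans (card-∖ (a ∷ b ∷ []) (A-unique {4 + i})) (≤-reflexive (+-comm (length A′) 2)))))))
          where
          A′ : List V
          A′ = A (4 + i) ∖ (a ∷ b ∷ [])
          A⁻′ : ∀ {u} → u ∈ A′ → u ∈ A (4 + i) × u ∉ a ∷ b ∷ []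
          A⁻′ = ∖⁻ (A (4 + i)) (a ∷ b ∷ [])
          go′ : Pair A′ → ⊥
          go′ (a' , b' , a'∈ , b'∈ , ne') = window i i≤4 h a∈ b∈ (proj₁ (A⁻′ a'∈)) (proj₁ (A⁻′ b'∈)) ne ne'
            (λ e → proj₂ (A⁻′ a'∈) (here (sym e))) (λ e → proj₂ (A⁻′ b'∈) (here (sym e))) (λ e → proj₂ (A⁻′ a'∈) (there (here (sym e))))
                (λ e → proj₂ (A⁻′ b'∈) (there (here (sym e))))

      -- Vertices common to A₀ and A₄ and to A₄ and A₈ make f 5 blue to f 1 and f 9.
      long : 9 ≤ n → ⊥
      long 9≤n = window-apart 0 z≤n 4≤n λ p∈ p∈' → window-apart 4 ≤-refl 8≤n λ q∈ q∈' →
          window-large 1 (s≤s z≤n) 5≤n (lin 3 (λ k n a → (2 ⊛ k ⊕ # 2 :≤ n ⊕ a) ∷ (# 2 ⊕ n :≤ 2 ⊛ k) ∷ [] ⊢ # 4 :≤ a)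
              (k ∷ n ∷ length (A 5) ∷ [])
            (A-size {5} (f 1 ∷ f 9 ∷ []) 5≤n
              (Unique-cons (λ { (here e) → ne 5≤n 1≤n (λ ()) e ; (there (here e)) → ne 5≤n 9≤n (λ ()) e })
                  (Unique-cons (λ { (here e) → ne 1≤n 9≤n (λ ()) e }) (Unique-[] _)))
              (λ { (here refl) → on 1≤n ; (there (here refl)) → on 9≤n })
              (λ { (here refl) → E-sym (reversal 3 5≤n (proj₁ (A⁻ p∈)) (proj₂ (A⁻ p∈)) (proj₂ (A⁻ p∈')))
                 ; (there (here refl)) → reversal 3 9≤n (proj₁ (A⁻ q∈)) (proj₂ (A⁻ q∈)) (proj₂ (A⁻ q∈')) }) , n≤))
        where
        8≤n : 8 ≤ n
        8≤n = ≤-trans (n≤1+n 8) 9≤n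
        5≤n : 5 ≤ n
        5≤n = ≤-trans (m≤m+n 5 4) 9≤n
        4≤n : 4 ≤ n
        4≤n = ≤-trans (n≤1+n 4) 5≤n
        1≤n : 1 ≤ n
        1≤n = ≤-trans (m≤m+n 1 4) 5≤n
        ne : ∀ {i j} → i ≤ n → j ≤ n → i ≢ j → f i ≢ f j
        ne h h' i≢j e = i≢j (inj h h' e)

      -- Since `A i` has at least 2k - n vertices, short paths make these sets larger than k and
      -- paths with n + 4 ≤ 2k still leave four vertices in `A 4`. In the remaining range only two
      -- are guaranteed, but there n ≥ 2k - 3 ≥ 9, and position 9 needed by `long` exists.
      absurd : ⊥
      absurd with 2 + n ≤? k | 4 + n ≤? 2 * k
      ... | yes h | _ = short h
      ... | no h | yes h' = window-large 0 z≤n 4≤n (lin 3 (λ k n a → (2 ⊛ k :≤ n ⊕ a) ∷ (# 4 ⊕ n :≤ 2 ⊛ k) ∷ [] ⊢ # 4 :≤ a)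
          (k ∷ n ∷ length (A 4) ∷ []) (A-size₀ 4≤n , h'))
        where
        4≤n : 4 ≤ n
        4≤n = lin 2 (λ k n → (# 1 ⊕ k :≤ # 2 ⊕ n) ∷ (# 6 :≤ k) ∷ [] ⊢ # 4 :≤ n) (k ∷ n ∷ []) (≰⇒> h , 6≤k)
      ... | no _ | no h = long (lin 2 (λ k n → (# 1 ⊕ 2 ⊛ k :≤ # 4 ⊕ n) ∷ (# 6 :≤ k) ∷ (# 6 :≤ k) ∷ [] ⊢ # 9 :≤ n) (k ∷ n ∷ [])
          (≰⇒> h , 6≤k , 6≤k))

    -- Two consecutive lengths are carried through the induction, because `Shorter` needs both of
    -- the next ones to be impossible.
    no-path : ∀ t s → s + t ≡ 2 * k → 3 ≤ s → (Path s → ⊥) × (Path (suc s) → ⊥)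
    no-path zero s e _ = (λ P → no-path-2k (subst Path e′ P)) , λ P → no-path-2k+1 (subst (Path ∘ suc) e′ P)
      where
      e′ : s ≡ 2 * k
      e′ = trans (sym (+-identityʳ s)) e
    no-path (suc t) (suc s) e h = (λ P → Shorter.absurd (≤-pred h) s≤ P (proj₁ longer) (proj₂ longer)) , proj₁ longer
      where
      longer : (Path (2 + s) → ⊥) × (Path (3 + s) → ⊥)
      longer = no-path t (2 + s) (trans (sym (+-suc (suc s) t)) e) (≤-trans h (n≤1+n _))
      s≤ : 2 + s ≤ 2 * k
      s≤ = ≤-trans (≤-trans (s≤s (m≤m+n (suc s) t)) (≤-reflexive (sym (+-suc (suc s) t)))) (≤-reflexive e)

  case-two : 6 ≤ k → 5 * k + 3 ≤ N → N ≤ 5 * k + 3 → NoRed c c-sym k → NoWheel c c-sym k → (Tripartite c c-sym k → ⊥) →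
    (∀ v → suc (2 * k) ≤ length (nbrs red v)) → ⊥
  case-two 6≤k N≥ N≤ noRed noWheel noTri degree = triangle-free (overlapping common)
    where
    open CaseTwo c c-sym k 6≤k N≥ N≤ noRed noWheel noTri degree
    common : ∀ {x y z w} → Triangle x y z → w ∈ nbrs red x → w ∈ nbrs red y → w ≢ z → ⊥
    common {x} {y} {z} {w} ((x≢y , x≢z , y≢z) , (xy , xz , yz)) p q w≢z =
      go (m≤n⇒∃[o]m+o≡n {3} {2 * k} (≤-trans (s≤s (s≤s (s≤s z≤n))) (≤-trans 6≤k (m≤m+n k _))))
      where
      path : Link red (_≢ z) 3 x y
      path = link-cons x≢z (proj₂ (nbrs⁻ p)) (link-cons w≢z (E-sym (proj₂ (nbrs⁻ q))) (link-one y y≢z) λ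
          { (here e) → proj₁ (nbrs⁻ q) (sym e) })
        λ { (here e) → proj₁ (nbrs⁻ p) e ; (there (here e)) → x≢y e }
      go : (∃ λ t → 3 + t ≡ 2 * k) → ⊥
      go (t , e) = proj₁ (Detour.no-path 6≤k noRed noWheel noTri degree xy xz yz t 3 e ≤-refl) path

-- Decidability of the conclusion and assembly

-- An exhaustive search rebuilds a function from its values and so recovers it only up to pointwise
-- equality, which `P` is therefore assumed to respect.
function-search : ∀ {m n} (P : (Fin n → Fin m) → Set) → (∀ {f g} → f ≗ g → P f → P g) → (∀ f → Dec (P f)) → Dec (∃ P)
function-search {n = zero} P resp P? = place (P? λ ())
  where
  place : Dec (P λ ()) → Dec (∃ P)
  place (yes p) = yes ((λ ()) , p)
  place (no ¬p) = no λ (f , p) → ¬p (resp (λ ()) p)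
function-search {m} {suc n} P resp P? = place (any? λ a → function-search (P ∘ cons a) (λ e → resp λ { zero → refl ; (suc i) → e i })
    (P? ∘ cons a))
  where
  cons : Fin m → (Fin n → Fin m) → Fin (suc n) → Fin m
  cons a f zero = a
  cons a f (suc i) = f i
  place : Dec (∃ λ a → ∃ λ f → P (cons a f)) → Dec (∃ P)
  place (yes (a , f , p)) = yes (cons a f , p)
  place (no none) = no λ (f , p) → none (f zero , f ∘ suc , resp (λ { zero → refl ; (suc i) → refl }) p)

module _ {N : ℕ} (c : Colouring N) (c-sym : Symmetric c) (k : ℕ) where
  open Graph c c-sym

  Good : (V → Fin 4) → Set
  Good part = classSize part zero ≤ 2
    × (∀ (i : Fin 4) → i ≢ zero → classSize part i ≤ 2 * k)
    × (∀ (u v : V) → u ≢ v → part u ≢ zero → part v ≢ zero →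
        (part u ≡ part v → c u v ≡ red) × (part u ≢ part v → c u v ≡ blue))

  Good? : ∀ part → Dec (Good part)
  Good? part = (classSize part zero ≤? 2) ×-dec
    (all? λ i → ¬? (i ≟ zero) →-dec (classSize part i ≤? 2 * k)) ×-dec
    (all? λ u → all? λ v → ¬? (u ≟ v) →-dec (¬? (part u ≟ zero) →-dec (¬? (part v ≟ zero) →-dec
      (((part u ≟ part v) →-dec E? red u v) ×-dec (¬? (part u ≟ part v) →-dec E? blue u v)))))

  Good-≗ : ∀ {p q} → p ≗ q → Good p → Good q
  Good-≗ {p} {q} e (s , t , h) = subst (_≤ 2) (size zero) s , (λ i ne → subst (_≤ 2 * k) (size i) (t i ne)) ,
      λ u v ne u≢ v≢ → let (same , diff) = h u v ne (u≢ ∘ trans (sym (e u))) (v≢ ∘ trans (sym (e v))) in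
        (λ r → same (trans (e u) (trans r (sym (e v))))) , (λ r → diff λ s → r (trans (sym (e u)) (trans s (e v))))
    where
    size : ∀ j → classSize p j ≡ classSize q j
    size j = cong length (filter-≐ (λ v → p v ≟ j) (λ v → q v ≟ j) ((λ {v} → trans (sym (e v))) , (λ {v} → trans (e v))) (allFin N))

  no-wheel : ¬ HasWheel c blue (2 * k) → NoWheel c c-sym k
  no-wheel none h C with toHasCycle C
  ... | (f , f-inj , rim) , spokes = none (h , f , f-inj , (λ i e → proj₁ (spokes i) (sym e)) , rim , λ i → proj₂ (spokes i))

  critical : 6 ≤ k → 5 * k + 3 ≤ N → N ≤ 5 * k + 3 → NoRed c c-sym k → NoWheel c c-sym k → (Tripartite c c-sym k → ⊥) → ⊥
  critical 6≤k N≥ N≤ noRed noWheel noTri = cases (any? λ v → 3 * k + 2 ≤? length (nbrs blue v))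
    where
    open Degrees c c-sym k
    cases : Dec (∃ λ v → 3 * k + 2 ≤ length (nbrs blue v)) → ⊥
    cases (yes (v , h)) = CaseOne.case-one c c-sym k 6≤k N≥ N≤ noRed noWheel noTri v h
    cases (no none) = case-two c c-sym k 6≤k N≥ N≤ noRed noWheel noTri λ v →
      lin 4 (λ k N r b → (N :≤ # 1 ⊕ (r ⊕ b)) ∷ (# 1 ⊕ b :≤ 3 ⊛ k ⊕ # 2) ∷ (5 ⊛ k ⊕ # 3 :≤ N) ∷ [] ⊢ # 1 ⊕ 2 ⊛ k :≤ r)
        (k ∷ N ∷ length (nbrs red v) ∷ length (nbrs blue v) ∷ []) (degrees v , ≰⇒> (λ h → none (v , h)) , N≥)

module _ {N : ℕ} (c : Colouring N) (c-sym : Symmetric c) (k : ℕ) where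

  -- A tripartite graph found among the first 5k + 3 vertices is one in the whole graph, and
  -- `Finish` classifies all N vertices from it. The upper bound on the number of vertices is thus
  -- confined to the search.
  tripartite-exists : 6 ≤ k → 5 * k + 3 ≤ N → NoRed c c-sym k → NoWheel c c-sym k → (Tripartite c c-sym k → ⊥) → ⊥
  tripartite-exists 6≤k N≥ noRed noWheel noTri = critical c' c'-sym k 6≤k ≤-refl ≤-refl
      (λ C → noRed (pull-cycle (λ _ → tt) C))
      (λ h C → noWheel (g h) (pull-cycle (λ (ne , e) → (λ e → ne (g-inj e)) , e) C))
      (λ T → noTri (image T))
    where
    g : Fin (5 * k + 3) → Fin N
    g i = inject≤ i N≥
    g-inj : ∀ {i j} → g i ≡ g j → i ≡ j
    g-inj = inject≤-injective N≥ N≥ _ _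
    open Pull c c-sym g g-inj
    image : Tripartite c' c'-sym k → Tripartite c c-sym k
    image T = record
      { K = λ i → map g (K i) ; K-unique = λ i → image-unique (K-unique i)
      ; K-size = λ i → ≤-trans (K-size i) (≤-reflexive (sym (length-map g (K i))))
      ; K-disjoint = λ ne → image-disjoint (K-disjoint ne)
      ; K-blue = λ ne p q → complete (∈-map⁻ g p) (∈-map⁻ g q) ne }
      where
      open Tripartite T
      complete : ∀ {i j x y} → (∃ λ a → a ∈ K i × x ≡ g a) → (∃ λ b → b ∈ K j × y ≡ g b) → i ≢ j → c x y ≡ blue
      complete (a , p , refl) (b , q , refl) ne = K-blue ne p q

theorem1 : (k N : ℕ) → 6 ≤ k → 5 * k + 3 ≤ N →
    (c : Colouring N) → Symmetric c →
    ¬ HasCycle c red (2 * k) →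
    ¬ HasWheel c blue (2 * k) →
    Σ (Fin N → Fin 4) λ part →
    classSize part zero ≤ 2
    × (∀ (i : Fin 4) → i ≢ zero → classSize part i ≤ 2 * k)
    × (∀ (u v : Fin N) → u ≢ v → part u ≢ zero → part v ≢ zero →
    (part u ≡ part v → c u v ≡ red)
    × (part u ≢ part v → c u v ≡ blue))
-- Only the absence of a tripartite graph has been refuted; since a good partition can be searched
-- for, its double negation is stable.
theorem1 k N 6≤k N≥ c c-sym no-red no-blue = decidable-stable (function-search (Good c c-sym k) (Good-≗ c c-sym k) (Good? c c-sym k))
    λ none → tripartite-exists c c-sym k 6≤k N≥ noRed noWheel λ T → none (good (Finish.partition c c-sym k 6≤k noRed noWheel T))
  where
  noRed : NoRed c c-sym k
  noRed C = no-red (proj₁ (Graph.toHasCycle c c-sym C))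
  noWheel : NoWheel c c-sym k
  noWheel = no-wheel c c-sym k no-blue
  good : Partition c c-sym k → ∃ (Good c c-sym k)
  good P = part , exceptional , small , colours
    where open Partition P
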